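{- Let $\mathbb{F}_q$ be a finite field, let $G\le \operatorname{PGL}_2(\mathbb{F}_q)$ be a cyclic subgroup of prime order $s$, and let $Q_G\in\mathbb{F}_q(x)$ be a quotient map for $G$. For all integers $n>d(G)$, $$|C(Q_G,n)|-(s-1)\,|D(Q_G,n)|=\begin{cases}0, & \text{if } s\nmid n,\\ |C(Q_G,\tfrac{n}{s})|, & \text{if } s\mid n.\end{cases}$$
   Context: $\mathcal{I}_q$ is the set of monic irreducible polynomials in $\mathbb{F}_q[x]$ and $\mathcal{I}_q^n$ the subset of those of degree $n$. For $A=\begin{pmatrix}a&b\\c&d\end{pmatrix}\in\operatorname{GL}_2(\mathbb{F}_q)$, $[A]$ denotes its class in $\operatorname{PGL}_2(\mathbb{F}_q)$, $[A]\circ x=\frac{ax+b}{cx+d}$, and $[A]\circ v=\frac{av+b}{cv+d}$ for $v\in\overline{\mathbb{F}}_q\cup\{\infty\}$ is the usual action. Quotient maps: for a subgroup $G\le\operatorname{PGL}_2(\mathbb{F}_q)$ let $\mathbb{F}_q(x)^G=\{Q\in\mathbb{F}_q(x)\mid Q([A]\circ x)=Q(x)\text{ for all }[A]\in G\}$. A quotient map for $G$ is a rational function $Q_G=g/h$ with $g,h\in\mathbb{F}_q[x]$ coprime, $g$ monic, $\deg(g)=|G|$, $0\le\deg(h)<\deg(g)$, and $\mathbb{F}_q(x)^G=\mathbb{F}_q(Q_G)$. Rational transformation: for $F\in\mathbb{F}_q[x]$ and $Q=g/h$, $F^{Q}(x):=h(x)^{\deg(F)}F\!\left(\frac{g(x)}{h(x)}\right)$.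 For $n\ge 1$: $C(Q_G,n):=\{f\in\mathcal{I}_q^n\mid f^{Q_G}\in\mathcal{I}_q^{|G|n}\}$ and $D(Q_G,n):=\mathcal{I}_q^n\setminus C(Q_G,n)$. Action on polynomials: $[A]\ast f(x)=\lambda_{A,f}(cx+d)^{\deg(f)}f\!\left(\frac{ax+b}{cx+d}\right)$, where $\lambda_{A,f}\in\mathbb{F}_q^{\ast}$ makes the result monic. Let $G\circ\infty$ be the $G$-orbit of $\infty$ and let $\mathcal{I}_q^G$ be the set of $r\in\mathcal{I}_q$ with no root in $G\circ\infty$; $G$ acts (on the right) on $\mathcal{I}_q^G$ via $\ast$. Write $G\ast r=\{[A]\ast r\mid [A]\in G\}$ and $\prod G\ast r:=\prod_{t\in G\ast r}t$. It is known that for every $F\in\mathcal{I}_q$ there are $r\in\mathcal{I}_q^G$ and an integer $k\ge 1$ with $F^{Q_G}=\left(\prod G\ast r\right)^k$. Definition of $d(G)$: $d(G)$ is the largest degree of a polynomial $F\in\mathcal{I}_q$ for which $F^{Q_G}=\left(\prod G\ast r\right)^k$ with $k>1$, and $d(G):=0$ if no such $F$ exists. One has $d(G)\in\{0,1,2\}$, and $d(G)$ does not depend on the choice of the quotient map $Q_G$. -}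

module Defs where

open import Algebra.Bundles using (CommutativeRing; Group; RawSemiring)
import Algebra.Definitions.RawMonoid as RawMonoidDefs
import Algebra.Definitions.RawSemiring as RawSemiringDefs
import Algebra.Properties.Ring as RingProperties
import Algebra.Solver.Ring.NaturalCoefficients.Default as NaturalSolver
open import Data.Fin.Base using (Fin; toℕ)
open import Data.Integer.Base using (ℤ; +_; -[1+_])
open import Data.List.Base using (List; []; _∷_; map; foldr; length)
import Data.List.Membership.Setoid as SetoidMembership
import Data.List.Relation.Unary.Unique.Setoid as SetoidUnique
open import Data.Nat.Base as ℕ using (ℕ; zero; suc)
open import Data.Product.Base using (Σ; Σ-syntax; ∃; ∃-syntax; _×_; _,_; proj₁; proj₂)
open import Function.Base using (_∘_)
open import Function.Bundles using (Inverse; _⇔_)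
open import Level using (Level; _⊔_) renaming (suc to lsuc)
open import Relation.Binary.Bundles using (Setoid)
import Relation.Binary.Construct.On as On
import Relation.Binary.PropositionalEquality as ≡
import Relation.Binary.Reasoning.Setoid as SetoidReasoning
open ≡ using (_≡_)
open import Relation.Nullary.Negation using (¬_)
open import Relation.Unary using (Pred)

HasCard : ∀ {a ℓ} → Setoid a ℓ → ℕ → Set (a ⊔ ℓ)
HasCard S k = Inverse (≡.setoid (Fin k)) S

Subset : ∀ {a ℓ p} (S : Setoid a ℓ) → Pred (Setoid.Carrier S) p → Setoid (a ⊔ p) ℓ
Subset S P = On.setoid {B = Σ (Setoid.Carrier S) P} S proj₁

module _ {c ℓ : Level} (𝒢 : Group c ℓ) where
  open Group 𝒢
  open RawMonoidDefs rawMonoid using () renaming (_×_ to infixr 8 _⋆_)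

  record FiniteSubgroup (p : Level) : Set (c ⊔ ℓ ⊔ lsuc p) where
    field
      Member  : Pred Carrier p
      resp    : ∀ {x y} → x ≈ y → Member x → Member y
      ε∈      : Member ε
      ∙∈      : ∀ {x y} → Member x → Member y → Member (x ∙ y)
      ⁻¹∈     : ∀ {x} → Member x → Member (x ⁻¹)
      order   : ℕ
      finite  : HasCard (Subset setoid Member) order

  power : Carrier → ℤ → Carrier
  power x (+ n)      = n ⋆ x
  power x (-[1+ n ]) = suc n ⋆ (x ⁻¹)

  IsCyclic : ∀ {p} → FiniteSubgroup p → Set (c ⊔ ℓ ⊔ p)
  IsCyclic G = ∃[ x ] Member x × (∀ y → Member y → ∃[ k ] y ≈ power x k)
    where open FiniteSubgroup G

record FiniteField (c ℓ : Level) : Set (lsuc (c ⊔ ℓ)) where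
  field
    commutativeRing : CommutativeRing c ℓ
  open CommutativeRing commutativeRing public
  field
    1≉0     : ¬ (1# ≈ 0#)
    inverse : ∀ x → ¬ (x ≈ 0#) → ∃[ y ] x * y ≈ 1#
    q       : ℕ
    finite  : HasCard setoid q

module OverFiniteField {c ℓ : Level} (𝔽 : FiniteField c ℓ) where

  open FiniteField 𝔽
  open SetoidReasoning setoid
  open RingProperties ring using (-‿distribˡ-*; -‿distribʳ-*; -‿involutive; -‿+-comm; -0#≈0#)
  open NaturalSolver commutativeSemiring using (solve; con; _:+_; _:*_; _:=_)

  private
    *-nonzero : ∀ {x y} → ¬ (x ≈ 0#) → ¬ (y ≈ 0#) → ¬ (x * y ≈ 0#)
    *-nonzero {x} {y} x≉0 y≉0 xy≈0 = y≉0 (begin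
      y              ≈⟨ *-identityˡ y ⟨
      1# * y         ≈⟨ *-congʳ (trans (*-comm _ _) xx⁻¹≈1) ⟨
      (x⁻¹ * x) * y  ≈⟨ *-assoc x⁻¹ x y ⟩
      x⁻¹ * (x * y)  ≈⟨ *-congˡ xy≈0 ⟩
      x⁻¹ * 0#       ≈⟨ zeroʳ x⁻¹ ⟩
      0#             ∎)
      where
      x⁻¹ = proj₁ (inverse x x≉0)
      xx⁻¹≈1 = proj₂ (inverse x x≉0)

    cancel : ∀ x y z → (x + y) - (x + z) ≈ y - z
    cancel x y z = begin
      (x + y) + - (x + z)      ≈⟨ +-congˡ (-‿+-comm x z) ⟨
      (x + y) + (- x + - z)    ≈⟨ solve 4 (λ x y x′ z′ → (x :+ y) :+ (x′ :+ z′) := (x :+ x′) :+ (y :+ z′)) refl x y (- x) (- z) ⟩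
      (x + - x) + (y + - z)    ≈⟨ +-congʳ (-‿inverseʳ x) ⟩
      0# + (y + - z)           ≈⟨ +-identityˡ _ ⟩
      y - z                    ∎

    neg*neg : ∀ x y → - x * - y ≈ x * y
    neg*neg x y = begin
      - x * - y      ≈⟨ -‿distribˡ-* x (- y) ⟨
      - (x * - y)    ≈⟨ -‿cong (-‿distribʳ-* x y) ⟨
      - - (x * y)    ≈⟨ -‿involutive _ ⟩
      x * y          ∎

    expand : ∀ x y z w → (x - y) * (z - w) ≈ (x * z + y * w) - (x * w + y * z)
    expand x y z w = begin
      (x + - y) * (z + - w)
        ≈⟨ solve 4 (λ x y z w → (x :+ y) :* (z :+ w) := (x :* z :+ y :* w) :+ (x :* w :+ y :* z)) refl x (- y) z (- w) ⟩
      (x * z + - y * - w) + (x * - w + - y * z)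
        ≈⟨ +-cong (+-congˡ (neg*neg y w)) (+-cong (sym (-‿distribʳ-* x w)) (sym (-‿distribˡ-* y z))) ⟩
      (x * z + y * w) + (- (x * w) + - (y * z))
        ≈⟨ +-congˡ (-‿+-comm _ _) ⟩
      (x * z + y * w) - (x * w + y * z) ∎

  record GL₂ : Set (c ⊔ ℓ) where
    constructor mat
    field
      a b c′ d : Carrier
      det≉0    : ¬ (a * d - b * c′ ≈ 0#)

  record _∼_ (A B : GL₂) : Set (c ⊔ ℓ) where
    constructor proportional
    private
      module A = GL₂ A
      module B = GL₂ B
    field
      k   : Carrier
      k≉0 : ¬ (k ≈ 0#)
      a≈  : A.a ≈ k * B.a
      b≈  : A.b ≈ k * B.b
      c≈  : A.c′ ≈ k * B.c′
      d≈  : A.d ≈ k * B.d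

  private
    ∼-refl : ∀ {A} → A ∼ A
    ∼-refl = proportional 1# 1≉0 (1*) (1*) (1*) (1*)
      where
      1* : ∀ {x} → x ≈ 1# * x
      1* = sym (*-identityˡ _)

    ∼-sym : ∀ {A B} → A ∼ B → B ∼ A
    ∼-sym (proportional k k≉0 a≈ b≈ c≈ d≈) =
      proportional k⁻¹ k⁻¹≉0 (flip a≈) (flip b≈) (flip c≈) (flip d≈)
      where
      k⁻¹ = proj₁ (inverse k k≉0)
      kk⁻¹≈1 = proj₂ (inverse k k≉0)
      k⁻¹≉0 : ¬ (k⁻¹ ≈ 0#)
      k⁻¹≉0 e = 1≉0 (trans (sym kk⁻¹≈1) (trans (*-congˡ e) (zeroʳ k)))
      flip : ∀ {x y} → x ≈ k * y → y ≈ k⁻¹ * x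
      flip {x} {y} e = begin
        y              ≈⟨ *-identityˡ y ⟨
        1# * y         ≈⟨ *-congʳ kk⁻¹≈1 ⟨
        (k * k⁻¹) * y  ≈⟨ solve 3 (λ k l y → (k :* l) :* y := l :* (k :* y)) refl k k⁻¹ y ⟩
        k⁻¹ * (k * y)  ≈⟨ *-congˡ e ⟨
        k⁻¹ * x        ∎

    ∼-trans : ∀ {A B C} → A ∼ B → B ∼ C → A ∼ C
    ∼-trans (proportional k k≉0 a₁ b₁ c₁ d₁) (proportional l l≉0 a₂ b₂ c₂ d₂) =
      proportional (k * l) (*-nonzero k≉0 l≉0) (step a₁ a₂) (step b₁ b₂) (step c₁ c₂) (step d₁ d₂)
      where
      step : ∀ {x y z} → x ≈ k * y → y ≈ l * z → x ≈ (k * l) * z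
      step e f = trans e (trans (*-congˡ f) (sym (*-assoc k l _)))

  infixl 7 _·_

  _·_ : GL₂ → GL₂ → GL₂
  mat a b c d δ · mat e f g h ε =
    mat (a * e + b * g) (a * f + b * h) (c * e + d * g) (c * f + d * h)
        (λ z → *-nonzero δ ε (trans (sym det·) z))
    where
    det· : (a * e + b * g) * (c * f + d * h) - (a * f + b * h) * (c * e + d * g)
           ≈ (a * d - b * c) * (e * h - f * g)
    det· = begin
      (a * e + b * g) * (c * f + d * h) - (a * f + b * h) * (c * e + d * g)
        ≈⟨ +-cong
             (solve 8 (λ a b c d e f g h →
                (a :* e :+ b :* g) :* (c :* f :+ d :* h) :=
                ((a :* e :* c :* f) :+ (b :* g :* d :* h)) :+ ((a :* d) :* (e :* h) :+ (b :* c) :* (f :* g)))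
                refl a b c d e f g h)
             (-‿cong (solve 8 (λ a b c d e f g h →
                (a :* f :+ b :* h) :* (c :* e :+ d :* g) :=
                ((a :* e :* c :* f) :+ (b :* g :* d :* h)) :+ ((a :* d) :* (f :* g) :+ (b :* c) :* (e :* h)))
                refl a b c d e f g h)) ⟩
      (X + Y) - (X + Z)
        ≈⟨ cancel X Y Z ⟩
      Y - Z
        ≈⟨ expand (a * d) (b * c) (e * h) (f * g) ⟨
      (a * d - b * c) * (e * h - f * g) ∎
      where
      X = (a * e * c * f) + (b * g * d * h)
      Y = (a * d) * (e * h) + (b * c) * (f * g)
      Z = (a * d) * (f * g) + (b * c) * (e * h)

  I₂ : GL₂
  I₂ = mat 1# 0# 0# 1# (λ z → 1≉0 (trans (sym det≈1) z))
    where
    det≈1 : 1# * 1# - 0# * 0# ≈ 1#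
    det≈1 = begin
      1# * 1# - 0# * 0#  ≈⟨ +-cong (*-identityˡ 1#) (trans (-‿cong (zeroˡ 0#)) -0#≈0#) ⟩
      1# + 0#            ≈⟨ +-identityʳ 1# ⟩
      1#                 ∎

  -- The adjugate, which represents the inverse class in PGL₂.
  adj : GL₂ → GL₂
  adj (mat a b c d δ) = mat d (- b) (- c) a (λ z → δ (trans (sym same) z))
    where
    same : d * a - (- b) * (- c) ≈ a * d - b * c
    same = +-cong (*-comm d a) (-‿cong (neg*neg b c))

  private
    ·-cong : ∀ {A A′ B B′} → A ∼ A′ → B ∼ B′ → (A · B) ∼ (A′ · B′)
    ·-cong (proportional k k≉0 a₁ b₁ c₁ d₁) (proportional l l≉0 a₂ b₂ c₂ d₂) =
      proportional (k * l) (*-nonzero k≉0 l≉0)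
        (step a₁ a₂ b₁ c₂) (step a₁ b₂ b₁ d₂) (step c₁ a₂ d₁ c₂) (step c₁ b₂ d₁ d₂)
      where
      step : ∀ {x y z w x′ y′ z′ w′} → x ≈ k * x′ → y ≈ l * y′ → z ≈ k * z′ → w ≈ l * w′ →
             x * y + z * w ≈ (k * l) * (x′ * y′ + z′ * w′)
      step {x′ = x} {y} {z} {w} p q r s = trans (+-cong (*-cong p q) (*-cong r s))
        (solve 6 (λ k l x y z w →
           (k :* x) :* (l :* y) :+ (k :* z) :* (l :* w) := (k :* l) :* (x :* y :+ z :* w))
           refl k l x y z w)

    ·-assoc : ∀ A B C → ((A · B) · C) ∼ (A · (B · C))
    ·-assoc (mat a b c d _) (mat e f g h _) (mat i j k l _) =
      proportional 1# 1≉0 (entry a b i k) (entry a b j l) (entry c d i k) (entry c d j l)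
      where
      entry : ∀ x y z w → (x * e + y * g) * z + (x * f + y * h) * w
                        ≈ 1# * (x * (e * z + f * w) + y * (g * z + h * w))
      entry x y z w = trans
        (solve 8 (λ e f g h x y z w →
           (x :* e :+ y :* g) :* z :+ (x :* f :+ y :* h) :* w :=
           x :* (e :* z :+ f :* w) :+ y :* (g :* z :+ h :* w))
           refl e f g h x y z w)
        (sym (*-identityˡ _))

    ·-identityˡ : ∀ A → (I₂ · A) ∼ A
    ·-identityˡ (mat a b c d _) =
      proportional 1# 1≉0 (top a c) (top b d) (bottom a c) (bottom b d)
      where
      top : ∀ x y → 1# * x + 0# * y ≈ 1# * x
      top x y = trans (+-congˡ (zeroˡ y)) (+-identityʳ _)
      bottom : ∀ x y → 0# * x + 1# * y ≈ 1# * y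
      bottom x y = trans (+-congʳ (zeroˡ x)) (+-identityˡ _)

    ·-identityʳ : ∀ A → (A · I₂) ∼ A
    ·-identityʳ (mat a b c d _) =
      proportional 1# 1≉0 (left a b) (right a b) (left c d) (right c d)
      where
      left : ∀ x y → x * 1# + y * 0# ≈ 1# * x
      left x y = trans (+-cong (*-comm x 1#) (zeroʳ y)) (+-identityʳ _)
      right : ∀ x y → x * 0# + y * 1# ≈ 1# * y
      right x y = trans (+-cong (zeroʳ x) (*-comm y 1#)) (+-identityˡ _)

    vanish : ∀ {x y} → x ≈ - y → ∀ k → x + y ≈ k * 0#
    vanish {x} {y} e k = trans (+-congʳ e) (trans (-‿inverseˡ y) (sym (zeroʳ k)))

    ·-inverseʳ : ∀ A → (A · adj A) ∼ I₂
    ·-inverseʳ (mat a b c d δ) = proportional (a * d - b * c) δ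
      (trans (+-congˡ (sym (-‿distribʳ-* b c))) (sym (*-identityʳ _)))
      (vanish (trans (sym (-‿distribʳ-* a b)) (-‿cong (*-comm a b))) _)
      (trans (+-comm _ _) (vanish (trans (sym (-‿distribʳ-* d c)) (-‿cong (*-comm d c))) _))
      (trans (trans (+-comm _ _) (+-cong (*-comm d a) (trans (sym (-‿distribʳ-* c b)) (-‿cong (*-comm c b)))))
             (sym (*-identityʳ _)))

    ·-inverseˡ : ∀ A → (adj A · A) ∼ I₂
    ·-inverseˡ (mat a b c d δ) = proportional (a * d - b * c) δ
      (trans (+-cong (*-comm d a) (sym (-‿distribˡ-* b c))) (sym (*-identityʳ _)))
      (trans (+-comm _ _) (vanish (trans (sym (-‿distribˡ-* b d)) (-‿cong (*-comm b d))) _))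
      (vanish (trans (sym (-‿distribˡ-* c a)) (-‿cong (*-comm c a))) _)
      (trans (trans (+-comm _ _) (+-congˡ (trans (sym (-‿distribˡ-* c b)) (-‿cong (*-comm c b)))))
             (sym (*-identityʳ _)))

    adj-cong : ∀ {A B} → A ∼ B → adj A ∼ adj B
    adj-cong (proportional k k≉0 a≈ b≈ c≈ d≈) =
      proportional k k≉0 d≈ (neg b≈) (neg c≈) a≈
      where
      neg : ∀ {x y} → x ≈ k * y → - x ≈ k * - y
      neg e = trans (-‿cong e) (-‿distribʳ-* k _)

  PGL₂ : Group (c ⊔ ℓ) (c ⊔ ℓ)
  PGL₂ = record
    { Carrier = GL₂
    ; _≈_     = _∼_
    ; _∙_     = _·_
    ; ε       = I₂
    ; _⁻¹     = adj
    ; isGroup = record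
      { isMonoid = record
        { isSemigroup = record
          { isMagma = record
            { isEquivalence = record { refl = ∼-refl ; sym = ∼-sym ; trans = ∼-trans }
            ; ∙-cong = ·-cong
            }
          ; assoc = ·-assoc
          }
        ; identity = ·-identityˡ , ·-identityʳ
        }
      ; inverse = ·-inverseˡ , ·-inverseʳ
      ; ⁻¹-cong = adj-cong
      }
    }

  -- Constant coefficient first; trailing zeros are allowed, so the
  -- equality of polynomials is _≈ₚ_.
  Poly : Set c
  Poly = List Carrier

  coeff : Poly → ℕ → Carrier
  coeff []      _       = 0#
  coeff (a ∷ f) zero    = a
  coeff (a ∷ f) (suc i) = coeff f i

  infix 4 _≈ₚ_

  record _≈ₚ_ (f g : Poly) : Set ℓ where
    constructor mk≈ₚ
    field
      coeff≈ : ∀ i → coeff f i ≈ coeff g i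

  infixl 6 _+ₚ_
  infixl 7 _*ₚ_
  infixr 7 _•_

  _+ₚ_ : Poly → Poly → Poly
  []      +ₚ g       = g
  (a ∷ f) +ₚ []      = a ∷ f
  (a ∷ f) +ₚ (b ∷ g) = (a + b) ∷ (f +ₚ g)

  _•_ : Carrier → Poly → Poly
  a • f = map (a *_) f

  _*ₚ_ : Poly → Poly → Poly
  []      *ₚ g = []
  (a ∷ f) *ₚ g = a • g +ₚ (0# ∷ (f *ₚ g))

  eval : Poly → Carrier → Carrier
  eval f v = foldr (λ a e → a + v * e) 0# f

  polySetoid : Setoid c ℓ
  polySetoid = record
    { Carrier = Poly
    ; _≈_ = _≈ₚ_
    ; isEquivalence = record
      { refl  = mk≈ₚ λ i → refl
      ; sym   = λ e → mk≈ₚ λ i → sym (coeff≈ e i)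
      ; trans = λ e e′ → mk≈ₚ λ i → trans (coeff≈ e i) (coeff≈ e′ i)
      }
    }
    where open _≈ₚ_

  polyRawSemiring : RawSemiring c ℓ
  polyRawSemiring = record
    { Carrier = Poly
    ; _≈_ = _≈ₚ_
    ; _+_ = _+ₚ_
    ; _*_ = _*ₚ_
    ; 0#  = []
    ; 1#  = 1# ∷ []
    }

  open RawSemiringDefs polyRawSemiring public
    using (_^_; sum; Irreducible; Coprime)

  DegreeBelow : ℕ → Poly → Set ℓ
  DegreeBelow n f = ∀ i → n ℕ.≤ i → coeff f i ≈ 0#

  MonicOfDegree : ℕ → Poly → Set ℓ
  MonicOfDegree n f = coeff f n ≈ 1# × DegreeBelow (suc n) f

  -- For n ≥ deg f this is the polynomial hⁿ f(g/h).
  homogeneous : ℕ → Poly → (g h : Poly) → Poly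
  homogeneous n f g h =
    sum λ (i : Fin (suc n)) → coeff f (toℕ i) • (g ^ toℕ i *ₚ h ^ (n ℕ.∸ toℕ i))

  MonicIrreducible : ℕ → Poly → Set (c ⊔ ℓ)
  MonicIrreducible n f = MonicOfDegree n f × Irreducible f

  𝓘 : ℕ → Setoid (c ⊔ ℓ) ℓ
  𝓘 n = Subset polySetoid (MonicIrreducible n)

  record RatFunc : Set (c ⊔ ℓ) where
    field
      num den : Poly
      den≉0   : ¬ (den ≈ₚ [])

  -- IsComposite P R S: den P does not vanish at R, and P(R) = S.  With
  -- R = g/h and N ≥ deg (num P), deg (den P), the value P(R) is
  -- (hᴺ (num P)(g/h)) / (hᴺ (den P)(g/h)).
  IsComposite : (P R S : RatFunc) → Set ℓ
  IsComposite P R S =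
    ¬ (v ≈ₚ []) × (S.num *ₚ v ≈ₚ u *ₚ S.den)
    where
    module P = RatFunc P
    module R = RatFunc R
    module S = RatFunc S
    N = length P.num ℕ.⊔ length P.den
    u = homogeneous N P.num R.num R.den
    v = homogeneous N P.den R.num R.den

  numerator denominator : GL₂ → Poly
  numerator   (mat a b c d _) = b ∷ a ∷ []
  denominator (mat a b c d _) = d ∷ c ∷ []

  möbius : GL₂ → RatFunc
  möbius A@(mat a b c d δ) = record
    { num   = numerator A
    ; den   = denominator A
    ; den≉0 = λ e → δ (begin
        a * d - b * c    ≈⟨ +-cong (*-congˡ (coeff≈ e 0)) (-‿cong (*-congˡ (coeff≈ e 1))) ⟩
        a * 0# - b * 0#  ≈⟨ +-cong (zeroʳ a) (trans (-‿cong (zeroʳ b)) -0#≈0#) ⟩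
        0# + 0#          ≈⟨ +-identityˡ 0# ⟩
        0#               ∎)
    }
    where open _≈ₚ_

  -- v = [A] ∘ ∞ = a/c.  For c = 0 this point is ∞, not a root of any
  -- polynomial.
  _∘∞≈_ : GL₂ → Carrier → Set ℓ
  mat a b c d _ ∘∞≈ v = ¬ (c ≈ 0#) × v * c ≈ a

  -- t = [A] ∗ r, where deg r = n
  IsImage : ℕ → Poly → GL₂ → Poly → Set (c ⊔ ℓ)
  IsImage n r A t =
    ∃[ m ] MonicOfDegree m t ×
    ∃[ k ] ¬ (k ≈ 0#) × t ≈ₚ k • homogeneous n r (numerator A) (denominator A)

  module _ {p : Level} (G : FiniteSubgroup PGL₂ p) where
    open FiniteSubgroup G

    Invariant : RatFunc → Set (c ⊔ ℓ ⊔ p)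
    Invariant P = ∀ A → Member A → IsComposite P (möbius A) P

    record QuotientMap : Set (c ⊔ ℓ ⊔ p) where
      field
        Q : RatFunc
      open RatFunc Q public renaming (num to g; den to h; den≉0 to h≉0)
      field
        coprime    : Coprime g h
        monic      : MonicOfDegree order g
        deg-h<     : DegreeBelow order h
        fixedField : ∀ P → Invariant P ⇔ (∃[ T ] IsComposite T Q P)

    NoRootInOrbit∞ : Poly → Set (c ⊔ ℓ ⊔ p)
    NoRootInOrbit∞ r = ∀ A v → Member A → A ∘∞≈ v → ¬ (eval r v ≈ 0#)

    InOrbit : ℕ → Poly → Poly → Set (c ⊔ ℓ ⊔ p)
    InOrbit n r t = ∃[ A ] Member A × IsImage n r A t

    -- P = ∏ G∗r, the product over the distinct elements of the orbit
    IsOrbitProduct : ℕ → Poly → Poly → Set (c ⊔ ℓ ⊔ p)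
    IsOrbitProduct n r P =
      ∃[ ts ] Unique ts × (∀ t → t ∈ ts ⇔ InOrbit n r t) × P ≈ₚ foldr _*ₚ_ (1# ∷ []) ts
      where
      open SetoidMembership polySetoid using (_∈_)
      open SetoidUnique polySetoid using (Unique)

  module _ {p : Level} {G : FiniteSubgroup PGL₂ p} (Q : QuotientMap G) where
    open FiniteSubgroup G using (order)
    open QuotientMap Q using (g; h)

    -- F^Q, where deg F = n
    transform : ℕ → Poly → Poly
    transform n F = homogeneous n F g h

    -- F^Q = (∏ G∗r)ᵏ with k > 1, where deg F = n
    Ramified : ℕ → Poly → Set (c ⊔ ℓ ⊔ p)
    Ramified n F =
      MonicIrreducible n F ×
      ∃[ m ] ∃[ r ] MonicIrreducible m r × NoRootInOrbit∞ G r ×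
      ∃[ P ] ∃[ k ] IsOrbitProduct G m r P × 1 ℕ.< k × transform n F ≈ₚ P ^ k

    -- IsRamifiedDegree δ: d(G) = δ
    data IsRamifiedDegree : ℕ → Set (c ⊔ ℓ ⊔ p) where
      largest : ∀ {n F} → Ramified n F → (∀ {m E} → Ramified m E → m ℕ.≤ n) → IsRamifiedDegree n
      none    : (∀ {m E} → ¬ Ramified m E) → IsRamifiedDegree 0

    InC : (n : ℕ) → Setoid.Carrier (𝓘 n) → Set (c ⊔ ℓ)
    InC n (f , _) = MonicIrreducible (order ℕ.* n) (transform n f)

    C D : ℕ → Setoid (c ⊔ ℓ) ℓ
    C n = Subset (𝓘 n) (InC n)
    D n = Subset (𝓘 n) (λ f → ¬ InC n f)

{-# OPTIONS --safe #-}
module Submission where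

-- A generator σ of G acts on binary forms of degree n, and homogeneous n f g h is the
-- form f evaluated at (g, h).  For an irreducible r of degree n let
-- N r = ∏_{i<s} r∘σⁱ.  The quotient N r / N 1 is G-invariant, hence equals
-- T(Q) for some T = u/v in lowest terms.  Since the poles of both sides lie in
-- G∘∞, where h vanishes, v is constant and N r = T^Q up to a unit, with
-- deg T = n, unless r has a root in G∘∞.  Every irreducible E ∣ T satisfies
-- r ∣ E^Q, and r ∣ E^Q determines E, so T = Fʲ and N r = (F^Q)ʲ.
--
-- If σ does not fix r, then r² ∤ N r, so j = 1 and F^Q is the product of the
-- s distinct conjugates of r: F ∈ D(Q,n), and this is s-to-1.  If σ fixes r,
-- then rˢ = (F^Q)ʲ, so either F^Q = r with deg F = n/s, or F^Q = rˢ, which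
-- n > d(G) excludes.  Counting irreducibles of degree n in two ways,
-- |C(Q,n)| + |D(Q,n)| = s |D(Q,n)| + |C(Q,n/s)|.
--
-- For n = 1 a rational root in G∘∞ has to be excluded: if σ moves ∞, its fixed
-- points are the roots of a quadratic polynomial, one of whose irreducible
-- factors is ramified, so that d(G) ≥ 1.
open import Defs
open import Algebra.Bundles using (CommutativeRing; Group; Semiring)
import Algebra.Definitions.RawMagma as RawMagmaDefs
import Algebra.Definitions.RawMonoid as RawMonoidDefs
import Algebra.Definitions.RawSemiring as RawSemiringDefs
import Algebra.Properties.Group as GroupProperties
import Algebra.Properties.Monoid.Mult as MonoidMult
import Algebra.Properties.Ring as RingProperties
import Algebra.Properties.Semiring.Exp as SemiringExp
import Algebra.Solver.Ring.NaturalCoefficients.Default as NaturalSolver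
open import Data.Empty using (⊥; ⊥-elim)
open import Data.Fin.Base as Fin using (Fin; toℕ)
import Data.Fin.Properties as Finₚ
open import Data.Integer.Base as ℤ using (+_; -[1+_])
import Data.Integer.Properties as ℤₚ
open import Data.List.Base using ([]; _∷_; length)
import Data.List.Relation.Unary.All as All
import Data.List.Relation.Unary.AllPairs as AllPairs
open import Data.List.Relation.Unary.Any using (here)
open import Data.Nat.Base as ℕ using (ℕ; zero; suc; z≤n; s≤s)
import Data.Nat.Coprimality as Coprimality
import Data.Nat.Divisibility as ℕ∣
import Data.Nat.DivMod as DivMod
open import Data.Nat.GCD using (module Bézout)
open import Data.Nat.Induction using (<-rec)
open import Data.Nat.Primality using (Prime; prime⇒irreducible; prime⇒nonTrivial; prime⇒nonZero)
import Data.Nat.Properties as ℕₚ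
open import Data.Product.Base using (Σ; ∃; ∃₂; ∃-syntax; _×_; _,_; proj₁; proj₂)
open import Data.Sum.Base using (_⊎_; inj₁; inj₂)
open import Function.Base using (_∘_)
open import Function.Bundles using (Equivalence; Inverse; mk⇔)
open import Level using (Level; _⊔_)
open import Relation.Binary.Bundles using (Setoid)
open import Relation.Binary.Definitions using (Tri; tri<; tri≈; tri>)
open import Relation.Binary.PropositionalEquality as ≡ using (_≡_)
import Relation.Binary.Reasoning.Setoid as SetoidReasoning
open import Relation.Nullary using (¬_; Dec; yes; no)
open import Relation.Nullary.Decidable using (map′)
open import Relation.Unary using (Pred)

-- The algebraic closure never appears: Galois orbits of points of the projective line are replaced
-- by irreducible polynomials, and r lies over E when r ∣ E^Q. The price is the point ∞, which no
-- polynomial sees. A polynomial therefore carries a nominal degree n, and a zero at ∞ is a drop of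
-- the actual degree below n. The constant 1 of nominal degree n is the form vanishing n times at ∞,
-- which is why N 1 supplies the poles. PGL₂ acts on forms only up to scalars, so most identities
-- hold up to `≃`. Invariance of a quotient is an exact equation, however: numerator and denominator
-- must acquire the same scalar, and for this the scalars are chosen independently of the form. The
-- delicate case is s = 2 with ∞ moved and the fixed-point quadratic irreducible: it might be F^Q
-- with deg F = 1, and then it would not be ramified. Comparing its eigenvalue, det σ, with that of
-- h forces characteristic 2 and trace 0, where the quadratic is a square.

module PolynomialRing {c ℓ : Level} (𝔽 : FiniteField c ℓ) where
  open FiniteField 𝔽
  open OverFiniteField 𝔽
  open _≈ₚ_ public
  open RingProperties ring using (-‿distribˡ-*)

  _≟_ : ∀ x y → Dec (x ≈ y)
  x ≟ y with Inverse.from finite x Finₚ.≟ Inverse.from finite y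
  ... | yes e = yes (trans (sym (Inverse.strictlyInverseˡ finite x))
                    (trans (reflexive (≡.cong (Inverse.to finite) e)) (Inverse.strictlyInverseˡ finite y)))
  ... | no ne = no λ e → ne (Inverse.from-cong finite e)

  *-≉0 : ∀ {x y} → ¬ (x ≈ 0#) → ¬ (y ≈ 0#) → ¬ (x * y ≈ 0#)
  *-≉0 {x} {y} x≉0 y≉0 xy≈0 with inverse x x≉0
  ... | x⁻¹ , xx⁻¹≈1 = y≉0 (begin
      y              ≈⟨ *-identityˡ y ⟨
      1# * y         ≈⟨ *-congʳ (trans (*-comm _ _) xx⁻¹≈1) ⟨
      (x⁻¹ * x) * y  ≈⟨ *-assoc x⁻¹ x y ⟩
      x⁻¹ * (x * y)  ≈⟨ *-congˡ xy≈0 ⟩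
      x⁻¹ * 0#       ≈⟨ zeroʳ x⁻¹ ⟩
      0#             ∎)
    where open SetoidReasoning setoid

  inv-≉0 : ∀ {x y} → x * y ≈ 1# → ¬ (y ≈ 0#)
  inv-≉0 {x} e z = 1≉0 (trans (sym e) (trans (*-congˡ z) (zeroʳ x)))

  module P = Setoid polySetoid

  ∷-cong : ∀ {a b f g} → a ≈ b → f ≈ₚ g → (a ∷ f) ≈ₚ (b ∷ g)
  ∷-cong e e′ = mk≈ₚ λ { zero → e ; (suc i) → coeff≈ e′ i }

  tail : Poly → Poly
  tail []      = []
  tail (_ ∷ f) = f

  tail-coeff : ∀ f i → coeff (tail f) i ≈ coeff f (suc i)
  tail-coeff []      i = refl
  tail-coeff (_ ∷ f) i = refl

  tail-cong : ∀ {f g} → f ≈ₚ g → tail f ≈ₚ tail g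
  tail-cong {f} {g} e = mk≈ₚ λ i → trans (tail-coeff f i) (trans (coeff≈ e (suc i)) (sym (tail-coeff g i)))

  uncons : ∀ f → f ≈ₚ coeff f 0 ∷ tail f
  uncons []      = mk≈ₚ λ { zero → refl ; (suc _) → refl }
  uncons (_ ∷ _) = P.refl

  ∷≈[] : ∀ {a f} → a ≈ 0# → f ≈ₚ [] → a ∷ f ≈ₚ []
  ∷≈[] e e′ = mk≈ₚ λ { zero → e ; (suc i) → coeff≈ e′ i }

  coeff-+ : ∀ f g i → coeff (f +ₚ g) i ≈ coeff f i + coeff g i
  coeff-+ []      g       i       = sym (+-identityˡ _)
  coeff-+ (a ∷ f) []      i       = sym (+-identityʳ _)
  coeff-+ (a ∷ f) (b ∷ g) zero    = refl
  coeff-+ (a ∷ f) (b ∷ g) (suc i) = coeff-+ f g i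

  coeff-• : ∀ k f i → coeff (k • f) i ≈ k * coeff f i
  coeff-• k []      i       = sym (zeroʳ k)
  coeff-• k (a ∷ f) zero    = refl
  coeff-• k (a ∷ f) (suc i) = coeff-• k f i

  +ₚ-cong : ∀ {f f′ g g′} → f ≈ₚ f′ → g ≈ₚ g′ → f +ₚ g ≈ₚ f′ +ₚ g′
  +ₚ-cong {f} {f′} {g} {g′} e e′ = mk≈ₚ λ i → trans (coeff-+ f g i)
    (trans (+-cong (coeff≈ e i) (coeff≈ e′ i)) (sym (coeff-+ f′ g′ i)))

  +ₚ-congˡ : ∀ f {g g′} → g ≈ₚ g′ → f +ₚ g ≈ₚ f +ₚ g′
  +ₚ-congˡ f e = +ₚ-cong {f} P.refl e

  +ₚ-congʳ : ∀ g {f f′} → f ≈ₚ f′ → f +ₚ g ≈ₚ f′ +ₚ g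
  +ₚ-congʳ g e = +ₚ-cong {g = g} e P.refl

  +ₚ-comm : ∀ f g → f +ₚ g ≈ₚ g +ₚ f
  +ₚ-comm f g = mk≈ₚ λ i → trans (coeff-+ f g i) (trans (+-comm _ _) (sym (coeff-+ g f i)))

  +ₚ-assoc : ∀ f g h → (f +ₚ g) +ₚ h ≈ₚ f +ₚ (g +ₚ h)
  +ₚ-assoc f g h = mk≈ₚ λ i → trans (coeff-+ (f +ₚ g) h i) (trans (+-congʳ (coeff-+ f g i))
    (trans (+-assoc _ _ _) (sym (trans (coeff-+ f (g +ₚ h) i) (+-congˡ (coeff-+ g h i))))))

  +ₚ-identityʳ : ∀ f → f +ₚ [] ≈ₚ f
  +ₚ-identityʳ f = +ₚ-comm f []

  •-cong : ∀ {k l f g} → k ≈ l → f ≈ₚ g → k • f ≈ₚ l • g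
  •-cong {k} {l} {f} {g} e e′ = mk≈ₚ λ i → trans (coeff-• k f i)
    (trans (*-cong e (coeff≈ e′ i)) (sym (coeff-• l g i)))

  •-distribˡ : ∀ k f g → k • (f +ₚ g) ≈ₚ k • f +ₚ k • g
  •-distribˡ k f g = mk≈ₚ λ i → trans (coeff-• k (f +ₚ g) i) (trans (*-congˡ (coeff-+ f g i))
    (trans (distribˡ k _ _) (sym (trans (coeff-+ (k • f) (k • g) i) (+-cong (coeff-• k f i) (coeff-• k g i))))))

  •-distribʳ : ∀ f k l → (k + l) • f ≈ₚ k • f +ₚ l • f
  •-distribʳ f k l = mk≈ₚ λ i → trans (coeff-• (k + l) f i) (trans (distribʳ _ k l)
    (sym (trans (coeff-+ (k • f) (l • f) i) (+-cong (coeff-• k f i) (coeff-• l f i)))))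

  •-assoc : ∀ k l f → (k * l) • f ≈ₚ k • l • f
  •-assoc k l f = mk≈ₚ λ i → trans (coeff-• (k * l) f i) (trans (*-assoc k l _)
    (sym (trans (coeff-• k (l • f) i) (*-congˡ (coeff-• l f i)))))

  •-identity : ∀ f → 1# • f ≈ₚ f
  •-identity f = mk≈ₚ λ i → trans (coeff-• 1# f i) (*-identityˡ _)

  •-zero : ∀ {k} f → k ≈ 0# → k • f ≈ₚ []
  •-zero {k} f e = mk≈ₚ λ i → trans (coeff-• k f i) (trans (*-congʳ e) (zeroˡ _))

  0∷-+ : ∀ f g → 0# ∷ (f +ₚ g) ≈ₚ (0# ∷ f) +ₚ (0# ∷ g)
  0∷-+ f g = ∷-cong (sym (+-identityˡ 0#)) P.refl

  0∷-• : ∀ k f → k • (0# ∷ f) ≈ₚ 0# ∷ k • f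
  0∷-• k f = ∷-cong (zeroʳ k) P.refl

  +ₚ-swap : ∀ f g h k → (f +ₚ g) +ₚ (h +ₚ k) ≈ₚ (f +ₚ h) +ₚ (g +ₚ k)
  +ₚ-swap f g h k = P.trans (+ₚ-assoc f g (h +ₚ k)) (P.trans
    (+ₚ-congˡ f (P.trans (P.sym (+ₚ-assoc g h k)) (P.trans (+ₚ-congʳ k (+ₚ-comm g h)) (+ₚ-assoc h g k))))
    (P.sym (+ₚ-assoc f h (g +ₚ k))))

  *ₚ-congˡ : ∀ f {g g′} → g ≈ₚ g′ → f *ₚ g ≈ₚ f *ₚ g′
  *ₚ-congˡ []      e = P.refl
  *ₚ-congˡ (a ∷ f) e = +ₚ-cong (•-cong refl e) (∷-cong refl (*ₚ-congˡ f e))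

  *ₚ-zeroʳ : ∀ f → f *ₚ [] ≈ₚ []
  *ₚ-zeroʳ []      = P.refl
  *ₚ-zeroʳ (a ∷ f) = ∷≈[] refl (*ₚ-zeroʳ f)

  *ₚ-∷ : ∀ f b g → f *ₚ (b ∷ g) ≈ₚ b • f +ₚ (0# ∷ f *ₚ g)
  *ₚ-∷ []      b g = P.sym (∷≈[] refl P.refl)
  *ₚ-∷ (a ∷ f) b g = ∷-cong (+-congʳ (*-comm a b)) (begin
      a • g +ₚ f *ₚ (b ∷ g)                 ≈⟨ +ₚ-congˡ (a • g) (*ₚ-∷ f b g) ⟩
      a • g +ₚ (b • f +ₚ (0# ∷ f *ₚ g))     ≈⟨ +ₚ-assoc (a • g) (b • f) _ ⟨
      (a • g +ₚ b • f) +ₚ (0# ∷ f *ₚ g)     ≈⟨ +ₚ-congʳ _ (+ₚ-comm (a • g) (b • f)) ⟩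
      (b • f +ₚ a • g) +ₚ (0# ∷ f *ₚ g)     ≈⟨ +ₚ-assoc (b • f) (a • g) _ ⟩
      b • f +ₚ (a • g +ₚ (0# ∷ f *ₚ g))     ∎)
    where open SetoidReasoning polySetoid

  *ₚ-comm : ∀ f g → f *ₚ g ≈ₚ g *ₚ f
  *ₚ-comm []      g = P.sym (*ₚ-zeroʳ g)
  *ₚ-comm (a ∷ f) g = P.trans (+ₚ-congˡ (a • g) (∷-cong refl (*ₚ-comm f g))) (P.sym (*ₚ-∷ g a f))

  *ₚ-cong : ∀ {f f′ g g′} → f ≈ₚ f′ → g ≈ₚ g′ → f *ₚ g ≈ₚ f′ *ₚ g′
  *ₚ-cong {f} {f′} {g} {g′} e e′ = P.trans (*ₚ-congˡ f e′)
    (P.trans (*ₚ-comm f g′) (P.trans (*ₚ-congˡ g′ e) (*ₚ-comm g′ f′)))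

  *ₚ-congʳ : ∀ g {f f′} → f ≈ₚ f′ → f *ₚ g ≈ₚ f′ *ₚ g
  *ₚ-congʳ g e = *ₚ-cong {g = g} e P.refl

  *ₚ-distribʳ : ∀ h f g → (f +ₚ g) *ₚ h ≈ₚ f *ₚ h +ₚ g *ₚ h
  *ₚ-distribʳ h []      g       = P.refl
  *ₚ-distribʳ h (a ∷ f) []      = P.sym (+ₚ-identityʳ ((a ∷ f) *ₚ h))
  *ₚ-distribʳ h (a ∷ f) (b ∷ g) = P.trans
    (+ₚ-cong (•-distribʳ h a b) (P.trans (∷-cong refl (*ₚ-distribʳ h f g)) (0∷-+ (f *ₚ h) (g *ₚ h))))
    (+ₚ-swap (a • h) (b • h) (0# ∷ f *ₚ h) (0# ∷ g *ₚ h))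

  •-*ₚ : ∀ k f g → (k • f) *ₚ g ≈ₚ k • (f *ₚ g)
  •-*ₚ k []      g = P.refl
  •-*ₚ k (a ∷ f) g = P.trans (+ₚ-cong (•-assoc k a g) (P.trans (∷-cong refl (•-*ₚ k f g)) (P.sym (0∷-• k (f *ₚ g)))))
    (P.sym (•-distribˡ k (a • g) (0# ∷ f *ₚ g)))

  0∷-*ₚ : ∀ f g → (0# ∷ f) *ₚ g ≈ₚ 0# ∷ f *ₚ g
  0∷-*ₚ f g = +ₚ-congʳ (0# ∷ f *ₚ g) (•-zero g refl)

  *ₚ-assoc : ∀ f g h → (f *ₚ g) *ₚ h ≈ₚ f *ₚ (g *ₚ h)
  *ₚ-assoc []      g h = P.refl
  *ₚ-assoc (a ∷ f) g h = P.trans (*ₚ-distribʳ h (a • g) (0# ∷ f *ₚ g))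
    (+ₚ-cong (•-*ₚ a g h) (P.trans (0∷-*ₚ (f *ₚ g) h) (∷-cong refl (*ₚ-assoc f g h))))

  -ₚ_ : Poly → Poly
  -ₚ f = (- 1#) • f

  *ₚ-identityˡ : ∀ f → (1# ∷ []) *ₚ f ≈ₚ f
  *ₚ-identityˡ f = P.trans (+ₚ-cong {g′ = []} (•-identity f) (∷≈[] refl P.refl)) (+ₚ-identityʳ f)

  -ₚ-inverseʳ : ∀ f → f +ₚ (-ₚ f) ≈ₚ []
  -ₚ-inverseʳ f = mk≈ₚ λ i → trans (coeff-+ f (-ₚ f) i) (trans (+-congˡ (trans (coeff-• (- 1#) f i)
    (trans (sym (-‿distribˡ-* 1# _)) (-‿cong (*-identityˡ _))))) (-‿inverseʳ _))

  *ₚ-identityʳ : ∀ f → f *ₚ (1# ∷ []) ≈ₚ f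
  *ₚ-identityʳ f = P.trans (*ₚ-comm f (1# ∷ [])) (*ₚ-identityˡ f)

  *ₚ-distribˡ : ∀ f g h → f *ₚ (g +ₚ h) ≈ₚ f *ₚ g +ₚ f *ₚ h
  *ₚ-distribˡ f g h = P.trans (*ₚ-comm f (g +ₚ h)) (P.trans (*ₚ-distribʳ f g h) (+ₚ-cong (*ₚ-comm g f) (*ₚ-comm h f)))

  polyRing : CommutativeRing c ℓ
  polyRing = record
    { Carrier = Poly ; _≈_ = _≈ₚ_ ; _+_ = _+ₚ_ ; _*_ = _*ₚ_ ; -_ = -ₚ_ ; 0# = [] ; 1# = 1# ∷ []
    ; isCommutativeRing = record
      { isRing = record
        { +-isAbelianGroup = record
          { isGroup = record
            { isMonoid = record
              { isSemigroup = record
                { isMagma = record { isEquivalence = P.isEquivalence ; ∙-cong = +ₚ-cong }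
                ; assoc = +ₚ-assoc }
              ; identity = (λ f → P.refl) , +ₚ-identityʳ }
            ; inverse = (λ f → P.trans (+ₚ-comm (-ₚ f) f) (-ₚ-inverseʳ f)) , -ₚ-inverseʳ
            ; ⁻¹-cong = •-cong refl }
          ; comm = +ₚ-comm }
        ; *-cong = *ₚ-cong
        ; *-assoc = *ₚ-assoc
        ; *-identity = *ₚ-identityˡ , *ₚ-identityʳ
        ; distrib = *ₚ-distribˡ , *ₚ-distribʳ
        }
      ; *-comm = *ₚ-comm
      }
    }

  module R = CommutativeRing polyRing

  _≟[] : ∀ f → Dec (f ≈ₚ [])
  [] ≟[] = yes P.refl
  (a ∷ f) ≟[] with a ≟ 0# | f ≟[]
  ... | yes e | yes e′ = yes (∷≈[] e e′)
  ... | no ne | _      = no λ e → ne (coeff≈ e 0)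
  ... | _     | no ne  = no λ e → ne (tail-cong e)

  _≟ₚ_ : ∀ f g → Dec (f ≈ₚ g)
  [] ≟ₚ g with g ≟[]
  ... | yes e = yes (P.sym e)
  ... | no ne = no (ne ∘ P.sym)
  (a ∷ f) ≟ₚ [] = (a ∷ f) ≟[]
  (a ∷ f) ≟ₚ (b ∷ g) with a ≟ b | f ≟ₚ g
  ... | yes e | yes e′ = yes (∷-cong e e′)
  ... | no ne | _      = no λ e → ne (coeff≈ e 0)
  ... | _     | no ne  = no λ e → ne (tail-cong e)

-- Degrees, division with remainder, Bézout identities and irreducible polynomials.

module Euclid {c ℓ : Level} (𝔽 : FiniteField c ℓ) where
  open FiniteField 𝔽
  open OverFiniteField 𝔽
  open PolynomialRing 𝔽
  open RawSemiringDefs polyRawSemiring public using (_∣_)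
  open RawMagmaDefs using (_,_)
  open RingProperties ring using (-‿distribˡ-*)
  open NaturalSolver R.commutativeSemiring using (solve; _:+_; _:*_; _:=_)

  1ₚ : Poly
  1ₚ = 1# ∷ []

  -- A record around `DegreeBelow`, which unfolds to a function type: the bound and the polynomial
  -- can then be inferred from a proof. `Monic` repackages `MonicOfDegree` in the same way.
  record Below (n : ℕ) (f : Poly) : Set ℓ where
    constructor mkBelow
    field
      vanish : DegreeBelow n f
  open Below public

  below-cong : ∀ {n f g} → f ≈ₚ g → Below n f → Below n g
  below-cong e b = mkBelow λ i n≤i → trans (sym (coeff≈ e i)) (vanish b i n≤i)

  below-mono : ∀ {m n f} → m ℕ.≤ n → Below m f → Below n f
  below-mono m≤n b = mkBelow λ i n≤i → vanish b i (ℕₚ.≤-trans m≤n n≤i)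

  below-0 : ∀ {f} → Below 0 f → f ≈ₚ []
  below-0 b = mk≈ₚ λ i → vanish b i z≤n

  below-[] : ∀ {n} → Below n []
  below-[] = mkBelow λ i _ → refl

  below-+ : ∀ {n f g} → Below n f → Below n g → Below n (f +ₚ g)
  below-+ {f = f} {g} b b′ = mkBelow λ i n≤i →
    trans (coeff-+ f g i) (trans (+-cong (vanish b i n≤i) (vanish b′ i n≤i)) (+-identityˡ 0#))

  below-• : ∀ {n f} k → Below n f → Below n (k • f)
  below-• {f = f} k b = mkBelow λ i n≤i → trans (coeff-• k f i) (trans (*-congˡ (vanish b i n≤i)) (zeroʳ k))

  below-∷ : ∀ {n f} a → Below n f → Below (suc n) (a ∷ f)
  below-∷ a b = mkBelow λ { (suc i) (s≤s n≤i) → vanish b i n≤i }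

  below-tail : ∀ {n f} → Below (suc n) f → Below n (tail f)
  below-tail {f = f} b = mkBelow λ i n≤i → trans (tail-coeff f i) (vanish b (suc i) (s≤s n≤i))

  below-length : ∀ f → Below (length f) f
  below-length []      = below-[]
  below-length (a ∷ f) = below-∷ a (below-length f)

  *ₚ-const : ∀ a {f} g → f ≈ₚ [] → (a ∷ f) *ₚ g ≈ₚ a • g
  *ₚ-const a {f} g e = P.trans (+ₚ-congˡ (a • g) (∷≈[] {f = f *ₚ g} refl (*ₚ-congʳ g e))) (+ₚ-identityʳ (a • g))

  •-as-* : ∀ k f → k • f ≈ₚ (k ∷ []) *ₚ f
  •-as-* k f = P.sym (*ₚ-const k f P.refl)

  *ₚ-• : ∀ k f g → f *ₚ (k • g) ≈ₚ k • (f *ₚ g)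
  *ₚ-• k f g = P.trans (*ₚ-comm f (k • g)) (P.trans (•-*ₚ k g f) (•-cong refl (*ₚ-comm g f)))

  coeff-*-top : ∀ m {n} f g → Below (suc m) f → Below (suc n) g →
                coeff (f *ₚ g) (m ℕ.+ n) ≈ coeff f m * coeff g n
  coeff-*-top m       []      g b b′ = sym (zeroˡ _)
  coeff-*-top zero    {n} (a ∷ f) g b b′ = trans (coeff≈ (*ₚ-const a {f} g (below-0 (below-tail b))) n) (coeff-• a g n)
  coeff-*-top (suc m) {n} (a ∷ f) g b b′ = trans (coeff-+ (a • g) (0# ∷ f *ₚ g) (suc m ℕ.+ n))
    (trans (+-cong (trans (coeff-• a g _) (trans (*-congˡ (vanish b′ _ (s≤s (ℕₚ.m≤n+m n m)))) (zeroʳ a)))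
                   (coeff-*-top m f g (below-tail b) b′))
           (+-identityˡ _))

  below-* : ∀ {m n f g} → Below (suc m) f → Below (suc n) g → Below (suc (m ℕ.+ n)) (f *ₚ g)
  below-* {m}     {n} {[]}    {g} b b′ = below-[]
  below-* {zero}  {n} {a ∷ f} {g} b b′ =
    below-cong (P.sym (*ₚ-const a {f} g (below-0 (below-tail b)))) (below-• a b′)
  below-* {suc m} {n} {a ∷ f} {g} b b′ = below-+ {f = a • g} {0# ∷ f *ₚ g}
    (below-mono (s≤s (ℕₚ.m≤n+m n (suc m))) (below-• a b′))
    (below-∷ 0# (below-* {m} {n} {f} {g} (below-tail b) b′))

  record Deg (n : ℕ) (f : Poly) : Set ℓ where
    constructor mkDeg
    field
      lead≉0 : ¬ (coeff f n ≈ 0#)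
      below  : Below (suc n) f
  open Deg public

  record Monic (n : ℕ) (f : Poly) : Set ℓ where
    constructor mkMonic
    field
      lead≈1 : coeff f n ≈ 1#
      monic-below : Below (suc n) f
  open Monic public

  toMonic : ∀ {n f} → MonicOfDegree n f → Monic n f
  toMonic (t , b) = mkMonic t (mkBelow b)

  fromMonic : ∀ {n f} → Monic n f → MonicOfDegree n f
  fromMonic (mkMonic t b) = t , vanish b

  deg-cong : ∀ {n f g} → f ≈ₚ g → Deg n f → Deg n g
  deg-cong {n} e (mkDeg t b) = mkDeg (λ z → t (trans (coeff≈ e n) z)) (below-cong e b)

  monic⇒deg : ∀ {n f} → Monic n f → Deg n f
  monic⇒deg (mkMonic t b) = mkDeg (λ z → 1≉0 (trans (sym t) z)) b

  monic-cong : ∀ {n f g} → f ≈ₚ g → Monic n f → Monic n g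
  monic-cong {n} e (mkMonic t b) = mkMonic (trans (sym (coeff≈ e n)) t) (below-cong e b)

  deg⇒≉0 : ∀ {n f} → Deg n f → ¬ (f ≈ₚ [])
  deg⇒≉0 {n} d e = lead≉0 d (coeff≈ e n)

  deg-below : ∀ {m n f} → Deg m f → Below n f → m ℕ.< n
  deg-below {m} {n} d b with m ℕₚ.<? n
  ... | yes p = p
  ... | no ¬p = ⊥-elim (lead≉0 d (vanish b m (ℕₚ.≮⇒≥ ¬p)))

  deg-unique : ∀ {m n f} → Deg m f → Deg n f → m ≡ n
  deg-unique d d′ = ℕₚ.≤-antisym (ℕₚ.≤-pred (deg-below d (below d′))) (ℕₚ.≤-pred (deg-below d′ (below d)))

  deg? : ∀ f → f ≈ₚ [] ⊎ ∃[ n ] Deg n f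
  deg? []      = inj₁ P.refl
  deg? (a ∷ f) with deg? f
  ... | inj₂ (n , mkDeg t b) = inj₂ (suc n , mkDeg t (below-∷ a b))
  ... | inj₁ e with a ≟ 0#
  ...   | yes z = inj₁ (∷≈[] z e)
  ...   | no nz = inj₂ (0 , mkDeg nz (below-∷ a (below-cong (P.sym e) below-[])))

  deg-* : ∀ {m n f g} → Deg m f → Deg n g → Deg (m ℕ.+ n) (f *ₚ g)
  deg-* {m} {n} {f} {g} (mkDeg t b) (mkDeg t′ b′) =
    mkDeg (λ z → *-≉0 t t′ (trans (sym (coeff-*-top m f g b b′)) z)) (below-* b b′)

  monic-* : ∀ {m n f g} → Monic m f → Monic n g → Monic (m ℕ.+ n) (f *ₚ g)
  monic-* {m} {n} {f} {g} (mkMonic t b) (mkMonic t′ b′) =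
    mkMonic (trans (coeff-*-top m f g b b′) (trans (*-cong t t′) (*-identityˡ 1#))) (below-* b b′)

  monic-1 : Monic 0 1ₚ
  monic-1 = mkMonic refl (below-∷ 1# below-[])

  deg-1 : Deg 0 1ₚ
  deg-1 = monic⇒deg monic-1

  deg-• : ∀ {k n f} → ¬ (k ≈ 0#) → Deg n f → Deg n (k • f)
  deg-• {k} {n} {f} k≉0 (mkDeg t b) = mkDeg (λ z → *-≉0 k≉0 t (trans (sym (coeff-• k f n)) z)) (below-• k b)

  ≉0⇒deg : ∀ {f} → ¬ (f ≈ₚ []) → ∃[ n ] Deg n f
  ≉0⇒deg {f} nz with deg? f
  ... | inj₁ e = ⊥-elim (nz e)
  ... | inj₂ d = d

  *ₚ-≉0 : ∀ {f g} → ¬ (f ≈ₚ []) → ¬ (g ≈ₚ []) → ¬ (f *ₚ g ≈ₚ [])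
  *ₚ-≉0 nf ng with ≉0⇒deg nf | ≉0⇒deg ng
  ... | _ , d | _ , d′ = deg⇒≉0 (deg-* d d′)

  ^-≉0 : ∀ {f} k → ¬ (f ≈ₚ []) → ¬ (f ^ k ≈ₚ [])
  ^-≉0 zero    nz = deg⇒≉0 deg-1
  ^-≉0 (suc k) nz = *ₚ-≉0 nz (^-≉0 k nz)

  ≈-from-diff : ∀ g h → g +ₚ (-ₚ h) ≈ₚ [] → g ≈ₚ h
  ≈-from-diff g h e = begin
      g                    ≈⟨ +ₚ-identityʳ g ⟨
      g +ₚ []              ≈⟨ +ₚ-congˡ g (R.-‿inverseˡ h) ⟨
      g +ₚ ((-ₚ h) +ₚ h)   ≈⟨ +ₚ-assoc g (-ₚ h) h ⟨
      (g +ₚ (-ₚ h)) +ₚ h   ≈⟨ +ₚ-congʳ h e ⟩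
      h                    ∎
    where open SetoidReasoning polySetoid

  *ₚ-cancelˡ : ∀ f {g h} → ¬ (f ≈ₚ []) → f *ₚ g ≈ₚ f *ₚ h → g ≈ₚ h
  *ₚ-cancelˡ f {g} {h} nf e with (g +ₚ (-ₚ h)) ≟[]
  ... | yes z = ≈-from-diff g h z
  ... | no nz = ⊥-elim (*ₚ-≉0 nf nz (begin
      f *ₚ (g +ₚ (-ₚ h))         ≈⟨ *ₚ-distribˡ f g (-ₚ h) ⟩
      f *ₚ g +ₚ f *ₚ (-ₚ h)      ≈⟨ +ₚ-cong e (*ₚ-• (- 1#) f h) ⟩
      f *ₚ h +ₚ (-ₚ (f *ₚ h))    ≈⟨ -ₚ-inverseʳ (f *ₚ h) ⟩
      []                         ∎))
    where open SetoidReasoning polySetoid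

  *ₚ-cancelʳ : ∀ f {g h} → ¬ (f ≈ₚ []) → g *ₚ f ≈ₚ h *ₚ f → g ≈ₚ h
  *ₚ-cancelʳ f {g} {h} nf e = *ₚ-cancelˡ f nf (P.trans (*ₚ-comm f g) (P.trans e (*ₚ-comm h f)))

  ∣-refl : ∀ {f} → f ∣ f
  ∣-refl {f} = 1ₚ , *ₚ-identityˡ f

  ∣-trans : ∀ {f g h} → f ∣ g → g ∣ h → f ∣ h
  ∣-trans {f} (q , e) (q′ , e′) = q′ *ₚ q , P.trans (*ₚ-assoc q′ q f) (P.trans (*ₚ-congˡ q′ e) e′)

  ∣-respʳ : ∀ {f g h} → g ≈ₚ h → f ∣ g → f ∣ h
  ∣-respʳ e (q , e′) = q , P.trans e′ e

  ∣-respˡ : ∀ {f g h} → f ≈ₚ g → f ∣ h → g ∣ h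
  ∣-respˡ e (q , e′) = q , P.trans (*ₚ-congˡ q (P.sym e)) e′

  ∣-*ˡ : ∀ {f g} h → f ∣ g → f ∣ h *ₚ g
  ∣-*ˡ {f} h (q , e) = h *ₚ q , P.trans (*ₚ-assoc h q f) (*ₚ-congˡ h e)

  ∣-*ʳ : ∀ {f g} h → f ∣ g → f ∣ g *ₚ h
  ∣-*ʳ {g = g} h d = ∣-respʳ (*ₚ-comm h g) (∣-*ˡ h d)

  ∣-+ : ∀ {f g h} → f ∣ g → f ∣ h → f ∣ g +ₚ h
  ∣-+ {f} (q , e) (q′ , e′) = q +ₚ q′ , P.trans (*ₚ-distribʳ f q q′) (+ₚ-cong e e′)

  ∣-• : ∀ {f g} k → f ∣ g → f ∣ k • g
  ∣-• {f} k (q , e) = k • q , P.trans (•-*ₚ k q f) (•-cong refl e)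

  ∣-≉0 : ∀ {f g} → f ∣ g → ¬ (g ≈ₚ []) → ¬ (f ≈ₚ [])
  ∣-≉0 (q , e) nz z = nz (P.trans (P.sym e) (P.trans (*ₚ-congˡ q z) (*ₚ-zeroʳ q)))

  ∣⇒deg-≤ : ∀ {m n f g} → Deg m f → Deg n g → f ∣ g → m ℕ.≤ n
  ∣⇒deg-≤ {m} {n} {f} {g} d d′ (q , e) with deg? q
  ... | inj₁ z = ⊥-elim (deg⇒≉0 d′ (P.trans (P.sym e) (*ₚ-congʳ f z)))
  ... | inj₂ (k , dk) with deg-unique (deg-cong e (deg-* dk d)) d′
  ...   | ≡.refl = ℕₚ.m≤n+m m k

  below-1⇒deg-0 : ∀ {f} → ¬ (f ≈ₚ []) → Below 1 f → Deg 0 f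
  below-1⇒deg-0 nz b with ≉0⇒deg nz
  ... | m , d with deg-below d b
  ...   | s≤s z≤n = d

  deg-0⇒const : ∀ {f} → Deg 0 f → f ≈ₚ coeff f 0 ∷ []
  deg-0⇒const {f} (mkDeg _ b) = P.trans (uncons f) (∷-cong refl (below-0 (below-tail b)))

  deg-0⇒∣1 : ∀ {f} → Deg 0 f → f ∣ 1ₚ
  deg-0⇒∣1 {f} d with inverse (coeff f 0) (lead≉0 d)
  ... | y , e = y ∷ [] , P.trans (*ₚ-congˡ (y ∷ []) (deg-0⇒const d))
    (P.trans (P.sym (•-as-* y (coeff f 0 ∷ []))) (∷-cong (trans (*-comm _ _) e) P.refl))

  ∣1⇒deg-0 : ∀ {f} → f ∣ 1ₚ → Deg 0 f
  ∣1⇒deg-0 {f} d with ≉0⇒deg (∣-≉0 d (deg⇒≉0 deg-1))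
  ... | m , dm with ∣⇒deg-≤ dm deg-1 d
  ...   | z≤n = dm

  infix 4 _≃_

  -- Association by a nonzero constant: what remains of equality when matrices matter only up to
  -- scalars.
  _≃_ : Poly → Poly → Set (c ⊔ ℓ)
  f ≃ g = ∃[ k ] ¬ (k ≈ 0#) × f ≈ₚ k • g

  ≈⇒≃ : ∀ {f g} → f ≈ₚ g → f ≃ g
  ≈⇒≃ {g = g} e = 1# , 1≉0 , P.trans e (P.sym (•-identity g))

  ≃-refl : ∀ {f} → f ≃ f
  ≃-refl = ≈⇒≃ P.refl

  ≃-trans : ∀ {f g h} → f ≃ g → g ≃ h → f ≃ h
  ≃-trans {h = h} (k , nk , e) (l , nl , e′) = k * l , *-≉0 nk nl ,
    P.trans e (P.trans (•-cong refl e′) (P.sym (•-assoc k l h)))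

  •-flip : ∀ {k f g} → ¬ (k ≈ 0#) → f ≈ₚ k • g → ∃[ l ] ¬ (l ≈ 0#) × l * k ≈ 1# × g ≈ₚ l • f
  •-flip {k} {f} {g} nk e with inverse k nk
  ... | l , kl≈1 = l , inv-≉0 kl≈1 , trans (*-comm l k) kl≈1 , (begin
      g              ≈⟨ •-identity g ⟨
      1# • g         ≈⟨ •-cong (trans (*-comm l k) kl≈1) P.refl ⟨
      (l * k) • g    ≈⟨ •-assoc l k g ⟩
      l • k • g      ≈⟨ •-cong refl e ⟨
      l • f          ∎)
    where open SetoidReasoning polySetoid

  ≃-sym : ∀ {f g} → f ≃ g → g ≃ f
  ≃-sym (k , nk , e) with •-flip nk e
  ... | l , nl , _ , e′ = l , nl , e′

  ≃-* : ∀ {f f′ g g′} → f ≃ f′ → g ≃ g′ → f *ₚ g ≃ f′ *ₚ g′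
  ≃-* {f} {f′} {g} {g′} (k , nk , e) (l , nl , e′) = k * l , *-≉0 nk nl , (begin
      f *ₚ g                   ≈⟨ *ₚ-cong e e′ ⟩
      (k • f′) *ₚ (l • g′)     ≈⟨ •-*ₚ k f′ (l • g′) ⟩
      k • (f′ *ₚ (l • g′))     ≈⟨ •-cong refl (*ₚ-• l f′ g′) ⟩
      k • l • (f′ *ₚ g′)       ≈⟨ •-assoc k l _ ⟨
      (k * l) • (f′ *ₚ g′)     ∎)
    where open SetoidReasoning polySetoid

  ≃⇒∣ : ∀ {f g} → f ≃ g → f ∣ g
  ≃⇒∣ {f} {g} e with ≃-sym e
  ... | k , _ , e′ = ∣-respʳ (P.sym e′) (∣-• k ∣-refl)

  ≃-deg : ∀ {n f g} → f ≃ g → Deg n f → Deg n g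
  ≃-deg e d with ≃-sym e
  ... | k , nk , e′ = deg-cong (P.sym e′) (deg-• nk d)

  ≃-monic : ∀ {m n f g} → Monic m f → Monic n g → f ≃ g → f ≈ₚ g
  ≃-monic {m} {n} {f} {g} M@(mkMonic t _) M′@(mkMonic t′ _) e@(k , _ , e′)
    with deg-unique (≃-deg e (monic⇒deg M)) (monic⇒deg M′)
  ... | ≡.refl = P.trans e′ (P.trans (•-cong k≈1 P.refl) (•-identity g))
    where
    k≈1 : k ≈ 1#
    k≈1 = trans (sym (*-identityʳ k)) (trans (*-congˡ (sym t′)) (trans (sym (coeff-• k g n)) (trans (sym (coeff≈ e′ n)) t)))

  normalise : ∀ {n f} → Deg n f → ∃[ g ] Monic n g × f ≃ g
  normalise {n} {f} (mkDeg t b) with inverse (coeff f n) t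
  ... | y , e = y • f , mkMonic (trans (coeff-• y f n) (trans (*-comm _ _) e)) (below-• y b) ,
    ≃-sym (y , inv-≉0 e , P.refl)

  deg-0⇒≃1 : ∀ {f} → Deg 0 f → f ≃ 1ₚ
  deg-0⇒≃1 {f} d = coeff f 0 , lead≉0 d , P.trans (deg-0⇒const d) (∷-cong (sym (*-identityʳ _)) P.refl)

  ≃-*-const : ∀ {f} q → Deg 0 q → q *ₚ f ≃ f
  ≃-*-const {f} q d = ≃-trans (≃-* (deg-0⇒≃1 d) ≃-refl) (≈⇒≃ (*ₚ-identityˡ f))

  cofactor : ∀ {m n f u} → Deg m f → Deg n u → f ∣ u → ∃₂ λ k w → n ≡ k ℕ.+ m × Deg k w × w *ₚ f ≈ₚ u
  cofactor {f = f} df du (w , e) with deg? w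
  ... | inj₁ z = ⊥-elim (deg⇒≉0 du (P.trans (P.sym e) (*ₚ-congʳ f z)))
  ... | inj₂ (k , dw) = k , w , deg-unique du (deg-cong e (deg-* dw df)) , dw , e

  divMod : ∀ f {n g} → Deg n g → ∃₂ λ q r → f ≈ₚ q *ₚ g +ₚ r × Below n r
  divMod []      d = [] , [] , P.refl , below-[]
  divMod (a ∷ f) {n} {g} d@(mkDeg t b) with divMod f d | inverse (coeff g n) t
  ... | q , r , e , br | y , ye = u ∷ q , (a ∷ r) +ₚ (-ₚ (u • g)) , eq , rem-below
    where
    open SetoidReasoning polySetoid
    -- The dividend is a + x f with f = q g + r. As r is below n, only coefficient n of a + x r
    -- exceeds the bound, and `u` is the multiple of g that cancels it (`y` inverts the leading
    -- coefficient of g).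
    u = coeff (a ∷ r) n * y
    eq : a ∷ f ≈ₚ (u • g +ₚ (0# ∷ q *ₚ g)) +ₚ ((a ∷ r) +ₚ (-ₚ (u • g)))
    eq = begin
      a ∷ f                           ≈⟨ ∷-cong (sym (+-identityˡ a)) e ⟩
      (0# ∷ q *ₚ g) +ₚ (a ∷ r)        ≈⟨ +ₚ-congʳ (a ∷ r) (+ₚ-identityʳ (0# ∷ q *ₚ g)) ⟨
      ((0# ∷ q *ₚ g) +ₚ []) +ₚ (a ∷ r)
        ≈⟨ +ₚ-congʳ (a ∷ r) (+ₚ-congˡ (0# ∷ q *ₚ g) (-ₚ-inverseʳ (u • g))) ⟨
      ((0# ∷ q *ₚ g) +ₚ (u • g +ₚ (-ₚ (u • g)))) +ₚ (a ∷ r)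
        ≈⟨ solve 4 (λ x z w v → (x :+ (z :+ w)) :+ v := (z :+ x) :+ (v :+ w)) P.refl (0# ∷ q *ₚ g) (u • g) (-ₚ (u • g)) (a ∷ r) ⟩
      (u • g +ₚ (0# ∷ q *ₚ g)) +ₚ ((a ∷ r) +ₚ (-ₚ (u • g))) ∎
    top : coeff ((a ∷ r) +ₚ (-ₚ (u • g))) n ≈ 0#
    top = trans (coeff-+ (a ∷ r) (-ₚ (u • g)) n) (trans (+-congˡ
      (trans (coeff-• (- 1#) (u • g) n) (trans (*-congˡ (trans (coeff-• u g n)
        (trans (*-assoc _ y _) (trans (*-congˡ (trans (*-comm _ _) ye)) (*-identityʳ _)))))
        (trans (sym (-‿distribˡ-* 1# _)) (-‿cong (*-identityˡ _))))))
      (-‿inverseʳ _))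
    rem-below : Below n ((a ∷ r) +ₚ (-ₚ (u • g)))
    rem-below = mkBelow go
      where
      go : DegreeBelow n ((a ∷ r) +ₚ (-ₚ (u • g)))
      go i n≤i with ℕₚ.m≤n⇒m<n∨m≡n n≤i
      ... | inj₁ n<i    = vanish (below-+ {f = a ∷ r} {g = -ₚ (u • g)} (below-∷ a br) (below-• (- 1#) (below-• u b))) i n<i
      ... | inj₂ ≡.refl = top

  move : ∀ {f} g {r} → f ≈ₚ g +ₚ r → r ≈ₚ f +ₚ (-ₚ g)
  move {f} g {r} e = begin
      r                      ≈⟨ +ₚ-congʳ r (-ₚ-inverseʳ g) ⟨
      (g +ₚ (-ₚ g)) +ₚ r     ≈⟨ solve 3 (λ x y z → (x :+ y) :+ z := (x :+ z) :+ y) P.refl g (-ₚ g) r ⟩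
      (g +ₚ r) +ₚ (-ₚ g)     ≈⟨ +ₚ-congʳ (-ₚ g) e ⟨
      f +ₚ (-ₚ g)            ∎
    where open SetoidReasoning polySetoid

  ∣-cancel-+ : ∀ {d f} g {r} → f ≈ₚ g +ₚ r → d ∣ f → d ∣ g → d ∣ r
  ∣-cancel-+ g e d∣f d∣g = ∣-respʳ (P.sym (move g e)) (∣-+ d∣f (∣-• (- 1#) d∣g))

  _∣?_ : ∀ {n} f → Deg n f → ∀ g → Dec (f ∣ g)
  (f ∣? d) g with divMod g d
  ... | q , r , e , b with r ≟[]
  ...   | yes z = yes (q , P.sym (P.trans e (P.trans (+ₚ-congˡ (q *ₚ f) z) (+ₚ-identityʳ _))))
  ...   | no nz = no λ f∣g → nope (∣-cancel-+ (q *ₚ f) e f∣g (∣-*ˡ q ∣-refl))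
    where
    nope : ¬ (f ∣ r)
    nope f∣r with ≉0⇒deg nz
    ... | m , dm = ℕₚ.<⇒≱ (deg-below dm b) (∣⇒deg-≤ d dm f∣r)

  bézout : ∀ f g → ∃[ d ] (d ∣ f) × (d ∣ g) × ∃₂ λ u v → d ≈ₚ u *ₚ f +ₚ v *ₚ g
  bézout f g = go (length g) f g (below-length g)
    where
    open SetoidReasoning polySetoid
    -- `k` bounds the degree of the second argument and makes the Euclidean recursion structural.
    go : ∀ k f g → Below k g → ∃[ d ] (d ∣ f) × (d ∣ g) × ∃₂ λ u v → d ≈ₚ u *ₚ f +ₚ v *ₚ g
    go k f g b with deg? g
    go k f g b | inj₁ z = f , ∣-refl , ([] , P.sym z) , 1ₚ , [] ,
      P.sym (P.trans (+ₚ-identityʳ (1ₚ *ₚ f)) (*ₚ-identityˡ f))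
    go zero f g b | inj₂ (n , d) with deg-below d b
    ... | ()
    go (suc k) f g b | inj₂ (n , d) with divMod f d
    ... | q , r , e , br with go k g r (below-mono (ℕₚ.≤-pred (deg-below d b)) br)
    ...   | x , x∣g , x∣r , u , v , ex =
      x , ∣-respʳ (P.sym e) (∣-+ (∣-*ˡ q x∣g) x∣r) , x∣g , v , u +ₚ (-ₚ (v *ₚ q)) , (begin
        x                                          ≈⟨ ex ⟩
        u *ₚ g +ₚ v *ₚ r                           ≈⟨ +ₚ-congˡ (u *ₚ g) (*ₚ-congˡ v (move (q *ₚ g) e)) ⟩
        u *ₚ g +ₚ v *ₚ (f +ₚ (-ₚ (q *ₚ g)))        ≈⟨ +ₚ-congˡ (u *ₚ g) (*ₚ-congˡ v (+ₚ-congˡ f (•-as-* (- 1#) (q *ₚ g)))) ⟩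
        u *ₚ g +ₚ v *ₚ (f +ₚ (- 1# ∷ []) *ₚ (q *ₚ g))
          ≈⟨ solve 6 (λ u g v f m q → u :* g :+ v :* (f :+ m :* (q :* g)) := v :* f :+ (u :+ m :* (v :* q)) :* g) P.refl u g v f (- 1# ∷ []) q ⟩
        v *ₚ f +ₚ (u +ₚ (- 1# ∷ []) *ₚ (v *ₚ q)) *ₚ g
          ≈⟨ +ₚ-congˡ (v *ₚ f) (*ₚ-congʳ g (+ₚ-congˡ u (•-as-* (- 1#) (v *ₚ q)))) ⟨
        v *ₚ f +ₚ (u +ₚ (-ₚ (v *ₚ q))) *ₚ g        ∎)

  bézout-unit : ∀ {d} f g u v → d ∣ 1ₚ → d ≈ₚ u *ₚ f +ₚ v *ₚ g → ∃₂ λ u v → u *ₚ f +ₚ v *ₚ g ≈ₚ 1ₚ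
  bézout-unit {d} f g u v (w , e) e′ = w *ₚ u , w *ₚ v , (begin
      (w *ₚ u) *ₚ f +ₚ (w *ₚ v) *ₚ g
        ≈⟨ solve 5 (λ w u f v g → (w :* u) :* f :+ (w :* v) :* g := w :* (u :* f :+ v :* g)) P.refl w u f v g ⟩
      w *ₚ (u *ₚ f +ₚ v *ₚ g)   ≈⟨ *ₚ-congˡ w e′ ⟨
      w *ₚ d                    ≈⟨ e ⟩
      1ₚ                        ∎)
    where open SetoidReasoning polySetoid

  bézout-∣ : ∀ {u v} f g h → u *ₚ f +ₚ v *ₚ g ≈ₚ 1ₚ → f ∣ g *ₚ h → f ∣ h
  bézout-∣ {u} {v} f g h e (q , eq) = u *ₚ h +ₚ v *ₚ q , (begin
      (u *ₚ h +ₚ v *ₚ q) *ₚ f           ≈⟨ solve 5 (λ u h v q f → (u :* h :+ v :* q) :* f := u :* f :* h :+ v :* (q :* f)) P.refl u h v q f ⟩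
      u *ₚ f *ₚ h +ₚ v *ₚ (q *ₚ f)      ≈⟨ +ₚ-congˡ (u *ₚ f *ₚ h) (*ₚ-congˡ v eq) ⟩
      u *ₚ f *ₚ h +ₚ v *ₚ (g *ₚ h)      ≈⟨ solve 5 (λ u f h v g → u :* f :* h :+ v :* (g :* h) := (u :* f :+ v :* g) :* h) P.refl u f h v g ⟩
      (u *ₚ f +ₚ v *ₚ g) *ₚ h           ≈⟨ *ₚ-congʳ h e ⟩
      1ₚ *ₚ h                           ≈⟨ *ₚ-identityˡ h ⟩
      h                                 ∎)
    where open SetoidReasoning polySetoid

  bézout-coprime : ∀ f g → Coprime f g → ∃₂ λ u v → u *ₚ f +ₚ v *ₚ g ≈ₚ 1ₚ
  bézout-coprime f g cop with bézout f g
  ... | d , d∣f , d∣g , u , v , e = bézout-unit f g u v (cop {d} d∣f d∣g) e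

  coprime-∣ : ∀ f g h → Coprime f g → f ∣ g *ₚ h → f ∣ h
  coprime-∣ f g h cop f∣gh = let u , v , e = bézout-coprime f g cop in bézout-∣ {u} {v} f g h e f∣gh

  irr-deg : ∀ {f} → Irreducible f → ∃[ n ] Deg (suc n) f
  irr-deg {f} irr with deg? f
  ... | inj₂ (suc n , d) = n , d
  ... | inj₂ (zero , d)  = ⊥-elim (Irreducible.p∤1 irr (deg-0⇒∣1 d))
  -- The zero polynomial is excluded because 0 = 0 · 0 would make 0 a divisor of 1.
  ... | inj₁ z with Irreducible.split-∣1 irr {[]} {[]} z
  ...   | inj₁ d = ⊥-elim (deg⇒≉0 (∣1⇒deg-0 d) P.refl)
  ...   | inj₂ d = ⊥-elim (deg⇒≉0 (∣1⇒deg-0 d) P.refl)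

  irr-≉0 : ∀ {f} → Irreducible f → ¬ (f ≈ₚ [])
  irr-≉0 irr = deg⇒≉0 (proj₂ (irr-deg irr))

  irr-deg>0 : ∀ {f n} → Irreducible f → Deg n f → 0 ℕ.< n
  irr-deg>0 irr d with irr-deg irr
  ... | n , d′ with deg-unique d d′
  ...   | ≡.refl = s≤s z≤n

  irr-cong : ∀ {f g} → f ≈ₚ g → Irreducible f → Irreducible g
  irr-cong e irr = record
    { p∤1      = λ d → Irreducible.p∤1 irr (∣-respˡ (P.sym e) d)
    ; split-∣1 = λ e′ → Irreducible.split-∣1 irr (P.trans e e′)
    }

  irr-≃ : ∀ {f g} → f ≃ g → Irreducible f → Irreducible g
  irr-≃ {f} {g} e@(k , nk , e′) irr = record
    { p∤1      = λ d → Irreducible.p∤1 irr (∣-trans (≃⇒∣ e) d)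
    ; split-∣1 = split
    }
    where
    split : ∀ {x y} → g ≈ₚ x *ₚ y → x ∣ 1ₚ ⊎ y ∣ 1ₚ
    split {x} {y} eq with Irreducible.split-∣1 irr {k • x} {y} (P.trans e′ (P.trans (•-cong refl eq) (P.sym (•-*ₚ k x y))))
    ... | inj₁ d = inj₁ (∣-trans (∣-• k ∣-refl) d)
    ... | inj₂ d = inj₂ d

  irr-∤1 : ∀ {f} → Irreducible f → ¬ (f ∣ 1ₚ)
  irr-∤1 irr = Irreducible.p∤1 irr

  irr-coprime : ∀ {r} → Irreducible r → ∀ f → r ∣ f ⊎ ∃₂ λ u v → u *ₚ r +ₚ v *ₚ f ≈ₚ 1ₚ
  irr-coprime {r} irr f with bézout r f
  ... | d , (w , e) , d∣f , u , v , eq with Irreducible.split-∣1 irr {w} {d} (P.sym e)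
  ...   | inj₂ d∣1 = inj₂ (bézout-unit r f u v d∣1 eq)
  ...   | inj₁ w∣1 = inj₁ (∣-trans (∣-respˡ e (≃⇒∣ (≃-*-const w (∣1⇒deg-0 w∣1)))) d∣f)

  euclid : ∀ {r} f g → Irreducible r → r ∣ f *ₚ g → r ∣ f ⊎ r ∣ g
  euclid {r} f g irr d with irr-coprime irr f
  ... | inj₁ r∣f = inj₁ r∣f
  ... | inj₂ (u , v , e) = inj₂ (bézout-∣ {u} {v} r f g e d)

  euclid-^ : ∀ {r} f j → Irreducible r → r ∣ f ^ j → r ∣ f
  euclid-^ f zero    irr d = ⊥-elim (irr-∤1 irr d)
  euclid-^ f (suc j) irr d with euclid f (f ^ j) irr d
  ... | inj₁ d′ = d′
  ... | inj₂ d′ = euclid-^ f j irr d′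

  irr-∣-irr : ∀ {r t} → Irreducible r → Irreducible t → r ∣ t → r ≃ t
  irr-∣-irr {r} {t} irr irt (q , e) with Irreducible.split-∣1 irt {q} {r} (P.sym e)
  ... | inj₁ q∣1 = ≃-trans (≃-sym (≃-*-const q (∣1⇒deg-0 q∣1))) (≈⇒≃ e)
  ... | inj₂ r∣1 = ⊥-elim (irr-∤1 irr r∣1)

  irr-∣-linear : ∀ {e f} → Irreducible e → Below 2 f → ¬ (f ≈ₚ []) → e ∣ f → e ≃ f × Deg 1 e
  irr-∣-linear {e} {f} irr b nz e∣f with irr-deg irr | ≉0⇒deg nz
  ... | k , de | m , df with cofactor de df e∣f
  ...   | j , w , ≡.refl , dw , eq with ℕₚ.≤-trans (ℕₚ.≤-reflexive (≡.sym (ℕₚ.+-suc j k))) (ℕₚ.≤-pred (deg-below df b))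
  irr-∣-linear {e} {f} irr b nz e∣f | zero , de | _ , df | zero , w , ≡.refl , dw , eq | s≤s z≤n =
    ≃-trans (≃-sym (≃-*-const w dw)) (≈⇒≃ eq) , de

  ≃-cancelˡ : ∀ f {g h} → ¬ (f ≈ₚ []) → f *ₚ g ≃ f *ₚ h → g ≃ h
  ≃-cancelˡ f {h = h} nf (k , nk , e) = k , nk , *ₚ-cancelˡ f nf (P.trans e (P.sym (*ₚ-• k f h)))

-- Finite setoids: cardinalities, pigeonhole and decidable partitions.

record Enumeration {a ℓ} (S : Setoid a ℓ) (k : ℕ) : Set (a ⊔ ℓ) where
  open Setoid S
  field
    at         : Fin k → Carrier
    injective  : ∀ {i j} → at i ≈ at j → i ≡ j
    surjective : ∀ x → ∃[ i ] at i ≈ x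

enumeration⇒card : ∀ {a ℓ} {S : Setoid a ℓ} {k} → Enumeration S k → HasCard S k
enumeration⇒card {S = S} E = record
  { to        = at
  ; from      = index
  ; to-cong   = λ { ≡.refl → refl }
  ; from-cong = index-cong
  ; inverse   = (λ { {x} ≡.refl → proj₂ (surjective x) })
              , (λ {i} y≈i → ≡.trans (index-cong y≈i) (injective (proj₂ (surjective (at i)))))
  }
  where
  open Setoid S
  open Enumeration E
  index : Carrier → Fin _
  index x = proj₁ (surjective x)
  index-cong : ∀ {x y} → x ≈ y → index x ≡ index y
  index-cong {x} {y} e = injective (trans (proj₂ (surjective x)) (trans e (sym (proj₂ (surjective y)))))

card⇒enumeration : ∀ {a ℓ} {S : Setoid a ℓ} {k} → HasCard S k → Enumeration S k
card⇒enumeration {S = S} I = record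
  { at         = to
  ; injective  = λ {i} {j} e → ≡.trans (≡.sym (strictlyInverseʳ i)) (≡.trans (from-cong e) (strictlyInverseʳ j))
  ; surjective = λ x → from x , strictlyInverseˡ x
  }
  where open Inverse I

injection⇒≤ : ∀ {a ℓ} {S : Setoid a ℓ} {m n} → Enumeration S n → (f : Fin m → Setoid.Carrier S) →
              (∀ {i j} → Setoid._≈_ S (f i) (f j) → i ≡ j) → m ℕ.≤ n
injection⇒≤ {S = S} E f inj = Finₚ.injective⇒≤ {f = λ i → proj₁ (surjective (f i))}
  λ {i} {j} e → inj (trans (sym (proj₂ (surjective (f i)))) (trans (reflexive (≡.cong at e)) (proj₂ (surjective (f j)))))
  where
  open Setoid S
  open Enumeration E

card-unique : ∀ {a ℓ} {S : Setoid a ℓ} {m n} → Enumeration S m → Enumeration S n → m ≡ n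
card-unique E F = ℕₚ.≤-antisym (injection⇒≤ F (at E) (injective E)) (injection⇒≤ E (at F) (injective F))
  where open Enumeration

private
  record Listing {p k} (P : Fin k → Set p) (a : ℕ) : Set p where
    field
      at   : Fin a → Fin k
      sat  : ∀ i → P (at i)
      inj  : ∀ {i j} → at i ≡ at j → i ≡ j
      surj : ∀ j → P j → ∃[ i ] at i ≡ j

  skip : ∀ {p k a} {P : Fin (suc k) → Set p} → ¬ P Fin.zero → Listing (P ∘ Fin.suc) a → Listing P a
  skip ¬p L = record
    { at = Fin.suc ∘ at ; sat = sat ; inj = inj ∘ Finₚ.suc-injective
    ; surj = λ { Fin.zero p → ⊥-elim (¬p p) ; (Fin.suc j) p → let i , e = surj j p in i , ≡.cong Fin.suc e } }
    where open Listing L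

  keep : ∀ {p k a} {P : Fin (suc k) → Set p} → P Fin.zero → Listing (P ∘ Fin.suc) a → Listing P (suc a)
  keep p L = record
    { at   = λ { Fin.zero → Fin.zero ; (Fin.suc i) → Fin.suc (at i) }
    ; sat  = λ { Fin.zero → p ; (Fin.suc i) → sat i }
    ; inj  = λ { {Fin.zero} {Fin.zero} _ → ≡.refl ; {Fin.zero} {Fin.suc _} () ; {Fin.suc _} {Fin.zero} ()
               ; {Fin.suc i} {Fin.suc j} e → ≡.cong Fin.suc (inj (Finₚ.suc-injective e)) }
    ; surj = λ { Fin.zero _ → Fin.zero , ≡.refl ; (Fin.suc j) p → let i , e = surj j p in Fin.suc i , ≡.cong Fin.suc e } }
    where open Listing L

  partitionFin : ∀ {p} k (P : Fin k → Set p) → (∀ i → Dec (P i)) →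
                 ∃₂ λ a b → a ℕ.+ b ≡ k × Listing P a × Listing (λ i → ¬ P i) b
  partitionFin zero P P? = 0 , 0 , ≡.refl ,
    record { at = λ () ; sat = λ () ; inj = λ { {()} } ; surj = λ () } ,
    record { at = λ () ; sat = λ () ; inj = λ { {()} } ; surj = λ () }
  partitionFin (suc k) P P? with partitionFin k (P ∘ Fin.suc) (P? ∘ Fin.suc) | P? Fin.zero
  ... | a , b , e , L , M | yes p = suc a , b , ≡.cong suc e , keep p L , skip (λ ¬p → ¬p p) M
  ... | a , b , e , L , M | no ¬p = a , suc b , ≡.trans (ℕₚ.+-suc a b) (≡.cong suc e) , skip ¬p L , keep ¬p M

partition : ∀ {a ℓ p} {S : Setoid a ℓ} {k} → Enumeration S k → let open Setoid S in
            (P : Pred Carrier p) → (∀ {x y} → x ≈ y → P x → P y) → (∀ x → Dec (P x)) →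
            ∃₂ λ m n → m ℕ.+ n ≡ k × Enumeration (Subset S P) m × Enumeration (Subset S (λ x → ¬ P x)) n
partition {S = S} {k} E P resp P? with partitionFin k (P ∘ Enumeration.at E) (P? ∘ Enumeration.at E)
... | m , n , e , L , M = m , n , e , enumerate L resp , enumerate M (λ e ¬p p → ¬p (resp (sym e) p))
  where
  open Setoid S
  open Enumeration E
  enumerate : ∀ {q a} {Q : Pred Carrier q} → Listing (Q ∘ at) a → (∀ {x y} → x ≈ y → Q x → Q y) → Enumeration (Subset S Q) a
  enumerate L resp = record
    { at         = λ i → at (Listing.at L i) , Listing.sat L i
    ; injective  = λ e → Listing.inj L (injective e)
    ; surjective = λ { (x , qx) → let j , e = surjective x
                                      i , e′ = Listing.surj L j (resp (sym e) qx)
                                  in i , trans (reflexive (≡.cong at e′)) e }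
    }

-- Enumeration of monic polynomials, decidable irreducibility and factorisation.

module Factorisation {c ℓ : Level} (𝔽 : FiniteField c ℓ) where
  open FiniteField 𝔽
  open OverFiniteField 𝔽
  open PolynomialRing 𝔽
  open Euclid 𝔽
  open RawMagmaDefs using (_,_)

  private
    module 𝔽q = Enumeration (card⇒enumeration finite)

  monics : ∀ n → Fin (q ℕ.^ n) → Poly
  monics zero    _ = 1ₚ
  monics (suc n) i = let j , k = Fin.remQuot (q ℕ.^ n) i in 𝔽q.at j ∷ monics n k

  monics-monic : ∀ n i → Monic n (monics n i)
  monics-monic zero    i = monic-1
  monics-monic (suc n) i with monics-monic n (proj₂ (Fin.remQuot {q} (q ℕ.^ n) i))
  ... | mkMonic t b = mkMonic t (below-∷ _ b)

  monics-injective : ∀ n {i j} → monics n i ≈ₚ monics n j → i ≡ j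
  monics-injective zero    {Fin.zero} {Fin.zero} e = ≡.refl
  monics-injective (suc n) {i} {j} e = ≡.trans (≡.sym (Finₚ.combine-remQuot {q} (q ℕ.^ n) i))
    (≡.trans (≡.cong₂ Fin.combine (𝔽q.injective (coeff≈ e 0)) (monics-injective n (tail-cong e)))
             (Finₚ.combine-remQuot {q} (q ℕ.^ n) j))

  monics-surjective : ∀ n {f} → Monic n f → ∃[ i ] monics n i ≈ₚ f
  monics-surjective zero {f} M = Fin.zero , ≃-monic monic-1 M (≃-sym (deg-0⇒≃1 (monic⇒deg M)))
  monics-surjective (suc n) {f} (mkMonic t b)
    with 𝔽q.surjective (coeff f 0)
       | monics-surjective n {tail f} (mkMonic (trans (tail-coeff f n) t) (below-tail b))
  ... | j , ej | k , ek = Fin.combine j k , P.trans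
    (≡.subst (λ jk → 𝔽q.at (proj₁ jk) ∷ monics n (proj₂ jk) ≈ₚ coeff f 0 ∷ tail f)
             (≡.sym (Finₚ.remQuot-combine j k)) (∷-cong ej ek))
    (P.sym (uncons f))

  ProperFactor : ℕ → Poly → Set (c ⊔ ℓ)
  ProperFactor n f = ∃[ m ] m ℕ.< n × 0 ℕ.< m × ∃[ g ] Monic m g × (g ∣ f)

  -- An exhaustive search through the finitely many monic polynomials of smaller degree;
  -- irreducibility becomes decidable through it.
  properFactor? : ∀ n f → Dec (ProperFactor n f)
  properFactor? n f with ℕₚ.anyUpTo? {P = λ m → 0 ℕ.< m × ∃[ i ] (monics m i ∣ f)} dec n
    where
    dec : ∀ m → Dec (0 ℕ.< m × ∃[ i ] (monics m i ∣ f))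
    dec m with 0 ℕₚ.<? m | Finₚ.any? (λ i → (monics m i ∣? monic⇒deg (monics-monic m i)) f)
    ... | yes p | yes e = yes (p , e)
    ... | no ¬p | _     = no (¬p ∘ proj₁)
    ... | _     | no ¬e = no (¬e ∘ proj₂)
  ... | yes (m , m<n , 0<m , i , d) = yes (m , m<n , 0<m , monics m i , monics-monic m i , d)
  ... | no ¬p = no λ { (m , m<n , 0<m , g , M , d) → let i , e = monics-surjective m M in
                       ¬p (m , m<n , 0<m , i , ∣-respˡ (P.sym e) d) }

  no-properFactor⇒irr : ∀ {n f} → Deg (suc n) f → ¬ ProperFactor (suc n) f → Irreducible f
  no-properFactor⇒irr {n} {f} d ¬p = record
    { p∤1      = λ f∣1 → ℕₚ.1+n≢0 (deg-unique d (∣1⇒deg-0 f∣1))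
    ; split-∣1 = split
    }
    where
    split : ∀ {x y} → f ≈ₚ x *ₚ y → x ∣ 1ₚ ⊎ y ∣ 1ₚ
    split {x} {y} e with deg? x | deg? y
    ... | inj₁ z | _ = ⊥-elim (deg⇒≉0 d (P.trans e (*ₚ-congʳ y z)))
    ... | _ | inj₁ z = ⊥-elim (deg⇒≉0 d (P.trans e (P.trans (*ₚ-congˡ x z) (*ₚ-zeroʳ x))))
    ... | inj₂ (zero , dx) | _ = inj₁ (deg-0⇒∣1 dx)
    ... | _ | inj₂ (zero , dy) = inj₂ (deg-0⇒∣1 dy)
    ... | inj₂ (suc i , dx) | inj₂ (suc j , dy) with normalise dx
    ...   | g , M , x≃g = ⊥-elim (¬p (suc i ,
      ≡.subst (suc i ℕ.<_) (deg-unique (deg-* dx dy) (deg-cong e d)) (ℕₚ.m<m+n (suc i) (s≤s z≤n)) ,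
      s≤s z≤n , g , M , ∣-trans (≃⇒∣ (≃-sym x≃g)) (∣-respʳ (P.sym e) (∣-*ʳ y ∣-refl))))

  properFactor⇒¬irr : ∀ {n f} → Deg n f → ProperFactor n f → ¬ Irreducible f
  properFactor⇒¬irr {n} d (m , m<n , 0<m , g , M , w , e) irr with Irreducible.split-∣1 irr {w} {g} (P.sym e)
  ... | inj₂ g∣1 = ℕₚ.<⇒≢ 0<m (deg-unique (∣1⇒deg-0 g∣1) (monic⇒deg M))
  ... | inj₁ w∣1 = ℕₚ.<⇒≢ m<n (deg-unique (deg-* (∣1⇒deg-0 w∣1) (monic⇒deg M)) (deg-cong (P.sym e) d))

  irreducible? : ∀ {n f} → Deg n f → Dec (Irreducible f)
  irreducible? {zero}  d = no λ irr → irr-∤1 irr (deg-0⇒∣1 d)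
  irreducible? {suc n} {f} d with properFactor? (suc n) f
  ... | yes p = no (properFactor⇒¬irr d p)
  ... | no ¬p = yes (no-properFactor⇒irr d ¬p)

  irreducibleFactor : ∀ {n f} → Deg (suc n) f → ∃₂ λ m e → Monic m e × Irreducible e × (e ∣ f)
  irreducibleFactor {n} {f} = <-rec (λ n → ∀ {f} → Deg (suc n) f → ∃₂ λ m e → Monic m e × Irreducible e × (e ∣ f)) step n
    where
    step : ∀ n → (∀ {m} → m ℕ.< n → ∀ {f} → Deg (suc m) f → ∃₂ λ m e → Monic m e × Irreducible e × (e ∣ f)) →
           ∀ {f} → Deg (suc n) f → ∃₂ λ m e → Monic m e × Irreducible e × (e ∣ f)
    step n rec {f} d with properFactor? (suc n) f
    ... | no ¬p with normalise d
    ...   | g , M , f≃g = suc n , g , M , irr-≃ f≃g (no-properFactor⇒irr d ¬p) , ≃⇒∣ (≃-sym f≃g)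
    step n rec {f} d | yes (suc m , s≤s m<n , _ , g , M , g∣f) with rec m<n (monic⇒deg M)
    ... | k , e , M′ , irr , e∣g = k , e , M′ , irr , ∣-trans e∣g g∣f

  no-common-factor⇒coprime : ∀ {f g} → ¬ (f ≈ₚ []) → (∀ e → Irreducible e → e ∣ f → ¬ (e ∣ g)) → Coprime f g
  no-common-factor⇒coprime nf no-common {z} z∣f z∣g with ≉0⇒deg (∣-≉0 z∣f nf)
  ... | zero  , d = deg-0⇒∣1 d
  ... | suc n , d with irreducibleFactor d
  ...   | m , e , M , irr , e∣z = ⊥-elim (no-common e irr (∣-trans e∣z z∣f) (∣-trans e∣z z∣g))

  no-factor⇒deg-0 : ∀ {f} → ¬ (f ≈ₚ []) → (∀ e → Irreducible e → ¬ (e ∣ f)) → Deg 0 f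
  no-factor⇒deg-0 nf no-factor with ≉0⇒deg nf
  ... | zero  , d = d
  ... | suc n , d with irreducibleFactor d
  ...   | m , e , M , irr , e∣f = ⊥-elim (no-factor e irr e∣f)

  monic-cofactor : ∀ {m n e g f} → Monic m e → Monic n f → g *ₚ e ≈ₚ f → ∃[ k ] n ≡ k ℕ.+ m × Monic k g
  monic-cofactor {m} {n} {e} {g} {f} Me Mf eq with ≉0⇒deg (∣-≉0 (∣-respʳ eq (∣-*ʳ e ∣-refl)) (deg⇒≉0 (monic⇒deg Mf)))
  ... | k , d = k , n≡k+m , mkMonic lead≈1′ (below d)
    where
    n≡k+m : n ≡ k ℕ.+ m
    n≡k+m = ≡.sym (deg-unique (deg-cong eq (deg-* d (monic⇒deg Me))) (monic⇒deg Mf))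
    lead≈1′ : coeff g k ≈ 1#
    lead≈1′ = trans (sym (*-identityʳ _)) (trans (*-congˡ (sym (lead≈1 Me)))
      (trans (sym (coeff-*-top k g e (below d) (monic-below Me)))
      (trans (coeff≈ eq (k ℕ.+ m)) (trans (reflexive (≡.cong (coeff f) (≡.sym n≡k+m))) (lead≈1 Mf)))))

  -- Strong induction on the degree: an irreducible factor of f must be e, and the cofactor inherits
  -- the hypothesis. This is the one instance of unique factorisation that the argument calls for.
  power-of-irreducible : ∀ {m n e f} → Monic m e → Irreducible e → Monic n f →
    (∀ {k g} → Monic k g → Irreducible g → g ∣ f → g ≈ₚ e) → ∃[ j ] n ≡ j ℕ.* m × f ≈ₚ e ^ j
  power-of-irreducible {m} {n} {e} {f} Me irr = <-rec
    (λ n → ∀ {f} → Monic n f → (∀ {k g} → Monic k g → Irreducible g → g ∣ f → g ≈ₚ e) → ∃[ j ] n ≡ j ℕ.* m × f ≈ₚ e ^ j)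
    step n
    where
    step : ∀ n → (∀ {k} → k ℕ.< n → ∀ {f} → Monic k f →
             (∀ {k g} → Monic k g → Irreducible g → g ∣ f → g ≈ₚ e) → ∃[ j ] k ≡ j ℕ.* m × f ≈ₚ e ^ j) →
           ∀ {f} → Monic n f → (∀ {k g} → Monic k g → Irreducible g → g ∣ f → g ≈ₚ e) → ∃[ j ] n ≡ j ℕ.* m × f ≈ₚ e ^ j
    step zero    rec {f} Mf _ = 0 , ≡.refl , ≃-monic Mf monic-1 (deg-0⇒≃1 (monic⇒deg Mf))
    step (suc n) rec {f} Mf only with irreducibleFactor (monic⇒deg Mf)
    ... | k , g , Mg , irg , g∣f with ∣-respˡ (only Mg irg g∣f) g∣f
    ...   | w , eq with monic-cofactor Me Mf eq
    ...     | k′ , n≡ , Mw with rec (≡.subst (k′ ℕ.<_) (≡.sym n≡) (ℕₚ.m<m+n k′ (irr-deg>0 irr (monic⇒deg Me)))) Mw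
                                    (λ M i d → only M i (∣-trans d (∣-respʳ eq (∣-*ʳ e ∣-refl))))
    ...       | j , k′≡ , w≈ = suc j , ≡.trans n≡ (≡.trans (ℕₚ.+-comm k′ m) (≡.cong (m ℕ.+_) k′≡)) ,
      P.trans (P.sym eq) (P.trans (*ₚ-comm w e) (*ₚ-congˡ e w≈))

-- Forms: substitution of a pair of polynomials at a fixed nominal degree.

module Homogeneous {c ℓ : Level} (𝔽 : FiniteField c ℓ) where
  open FiniteField 𝔽
  open OverFiniteField 𝔽
  open PolynomialRing 𝔽
  open Euclid 𝔽
  open RawMagmaDefs using (_,_)
  open RawSemiringDefs (Semiring.rawSemiring semiring) using () renaming (_^_ to _^ᶠ_)
  open SemiringExp R.semiring using (^-congˡ)
  open NaturalSolver R.commutativeSemiring using (solve; _:+_; _:*_; _:=_)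

  sum-* : ∀ n g (s t : Fin n → Poly) → (∀ i → s i ≈ₚ g *ₚ t i) → sum s ≈ₚ g *ₚ sum t
  sum-* zero    g s t e = P.sym (*ₚ-zeroʳ g)
  sum-* (suc n) g s t e = P.trans (+ₚ-cong (e Fin.zero) (sum-* n g (s ∘ Fin.suc) (t ∘ Fin.suc) (e ∘ Fin.suc)))
    (P.sym (*ₚ-distribˡ g (t Fin.zero) (sum (t ∘ Fin.suc))))

  hom-zero : ∀ f g h → homogeneous 0 f g h ≈ₚ coeff f 0 • 1ₚ
  hom-zero f g h = P.trans (+ₚ-identityʳ _) (•-cong refl (*ₚ-identityˡ 1ₚ))

  -- Horner's rule in homogeneous form. Together with `hom-zero` it replaces the sum over `Fin` by a
  -- recursion on the nominal degree.
  hom-suc : ∀ n f g h → homogeneous (suc n) f g h ≈ₚ coeff f 0 • h ^ suc n +ₚ g *ₚ homogeneous n (tail f) g h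
  hom-suc n f g h = +ₚ-cong (•-cong refl (*ₚ-identityˡ (h ^ suc n)))
    (sum-* (suc n) g (λ i → coeff f (suc (toℕ i)) • (g ^ suc (toℕ i) *ₚ h ^ (n ℕ.∸ toℕ i)))
             (λ i → coeff (tail f) (toℕ i) • (g ^ toℕ i *ₚ h ^ (n ℕ.∸ toℕ i)))
      λ i → P.trans (•-cong (sym (tail-coeff f (toℕ i))) (*ₚ-assoc g (g ^ toℕ i) _))
                    (P.sym (*ₚ-• (coeff (tail f) (toℕ i)) g _)))

  hom-cong : ∀ n {f f′ g g′ h h′} → f ≈ₚ f′ → g ≈ₚ g′ → h ≈ₚ h′ → homogeneous n f g h ≈ₚ homogeneous n f′ g′ h′
  hom-cong zero {f} {f′} {g} {g′} {h} {h′} e _ _ =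
    P.trans (hom-zero f g h) (P.trans (•-cong (coeff≈ e 0) P.refl) (P.sym (hom-zero f′ g′ h′)))
  hom-cong (suc n) {f} {f′} {g} {g′} {h} {h′} e e₁ e₂ = P.trans (hom-suc n f g h) (P.trans
    (+ₚ-cong (•-cong (coeff≈ e 0) (^-congˡ (suc n) e₂)) (*ₚ-cong e₁ (hom-cong n (tail-cong e) e₁ e₂)))
    (P.sym (hom-suc n f′ g′ h′)))

  hom-congᶠ : ∀ n {f f′} g h → f ≈ₚ f′ → homogeneous n f g h ≈ₚ homogeneous n f′ g h
  hom-congᶠ n g h e = hom-cong n {g = g} {h = h} e P.refl P.refl

  tail-+ : ∀ f g → tail (f +ₚ g) ≈ₚ tail f +ₚ tail g
  tail-+ []      g       = P.refl
  tail-+ (a ∷ f) []      = P.sym (+ₚ-identityʳ f)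
  tail-+ (a ∷ f) (b ∷ g) = P.refl

  tail-• : ∀ k f → tail (k • f) ≈ₚ k • tail f
  tail-• k []      = P.refl
  tail-• k (a ∷ f) = P.refl

  hom-+ : ∀ n f f′ g h → homogeneous n (f +ₚ f′) g h ≈ₚ homogeneous n f g h +ₚ homogeneous n f′ g h
  hom-+ zero f f′ g h = begin
      homogeneous 0 (f +ₚ f′) g h                    ≈⟨ hom-zero (f +ₚ f′) g h ⟩
      coeff (f +ₚ f′) 0 • 1ₚ                         ≈⟨ •-cong (coeff-+ f f′ 0) P.refl ⟩
      (coeff f 0 + coeff f′ 0) • 1ₚ                  ≈⟨ •-distribʳ 1ₚ (coeff f 0) (coeff f′ 0) ⟩
      coeff f 0 • 1ₚ +ₚ coeff f′ 0 • 1ₚ              ≈⟨ +ₚ-cong (hom-zero f g h) (hom-zero f′ g h) ⟨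
      homogeneous 0 f g h +ₚ homogeneous 0 f′ g h    ∎
    where open SetoidReasoning polySetoid
  hom-+ (suc n) f f′ g h = begin
      homogeneous (suc n) (f +ₚ f′) g h
        ≈⟨ hom-suc n (f +ₚ f′) g h ⟩
      coeff (f +ₚ f′) 0 • H +ₚ g *ₚ homogeneous n (tail (f +ₚ f′)) g h
        ≈⟨ +ₚ-cong (P.trans (•-cong (coeff-+ f f′ 0) P.refl) (•-distribʳ H (coeff f 0) (coeff f′ 0)))
                   (*ₚ-congˡ g (P.trans (hom-congᶠ n g h (tail-+ f f′)) (hom-+ n (tail f) (tail f′) g h))) ⟩
      (coeff f 0 • H +ₚ coeff f′ 0 • H) +ₚ g *ₚ (homogeneous n (tail f) g h +ₚ homogeneous n (tail f′) g h)
        ≈⟨ solve 5 (λ x y g z w → (x :+ y) :+ g :* (z :+ w) := (x :+ g :* z) :+ (y :+ g :* w)) P.refl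
             (coeff f 0 • H) (coeff f′ 0 • H) g (homogeneous n (tail f) g h) (homogeneous n (tail f′) g h) ⟩
      (coeff f 0 • H +ₚ g *ₚ homogeneous n (tail f) g h) +ₚ (coeff f′ 0 • H +ₚ g *ₚ homogeneous n (tail f′) g h)
        ≈⟨ +ₚ-cong (hom-suc n f g h) (hom-suc n f′ g h) ⟨
      homogeneous (suc n) f g h +ₚ homogeneous (suc n) f′ g h ∎
    where
    open SetoidReasoning polySetoid
    H = h ^ suc n

  hom-• : ∀ n k f g h → homogeneous n (k • f) g h ≈ₚ k • homogeneous n f g h
  hom-• zero k f g h = P.trans (hom-zero (k • f) g h) (P.trans (•-cong (coeff-• k f 0) P.refl)
    (P.trans (•-assoc k (coeff f 0) 1ₚ) (P.sym (•-cong refl (hom-zero f g h)))))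
  hom-• (suc n) k f g h = begin
      homogeneous (suc n) (k • f) g h
        ≈⟨ hom-suc n (k • f) g h ⟩
      coeff (k • f) 0 • H +ₚ g *ₚ homogeneous n (tail (k • f)) g h
        ≈⟨ +ₚ-cong (P.trans (•-cong (coeff-• k f 0) P.refl) (•-assoc k (coeff f 0) H))
                   (P.trans (*ₚ-congˡ g (P.trans (hom-congᶠ n g h (tail-• k f)) (hom-• n k (tail f) g h)))
                            (*ₚ-• k g (homogeneous n (tail f) g h))) ⟩
      k • (coeff f 0 • H) +ₚ k • (g *ₚ homogeneous n (tail f) g h)
        ≈⟨ •-distribˡ k (coeff f 0 • H) _ ⟨
      k • (coeff f 0 • H +ₚ g *ₚ homogeneous n (tail f) g h)
        ≈⟨ •-cong refl (hom-suc n f g h) ⟨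
      k • homogeneous (suc n) f g h ∎
    where
    open SetoidReasoning polySetoid
    H = h ^ suc n

  hom-[] : ∀ n g h → homogeneous n [] g h ≈ₚ []
  hom-[] n g h = P.trans (hom-• n 0# [] g h) (•-zero (homogeneous n [] g h) refl)

  hom-const : ∀ n a g h → homogeneous n (a ∷ []) g h ≈ₚ a • h ^ n
  hom-const zero    a g h = hom-zero (a ∷ []) g h
  hom-const (suc n) a g h = P.trans (hom-suc n (a ∷ []) g h)
    (P.trans (+ₚ-congˡ (a • h ^ suc n) (P.trans (*ₚ-congˡ g (hom-[] n g h)) (*ₚ-zeroʳ g)))
             (+ₚ-identityʳ (a • h ^ suc n)))

  hom-1 : ∀ n g h → homogeneous n 1ₚ g h ≈ₚ h ^ n
  hom-1 n g h = P.trans (hom-const n 1# g h) (•-identity (h ^ n))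

  hom-0∷ : ∀ n f g h → homogeneous (suc n) (0# ∷ f) g h ≈ₚ g *ₚ homogeneous n f g h
  hom-0∷ n f g h = P.trans (hom-suc n (0# ∷ f) g h) (+ₚ-congʳ (g *ₚ homogeneous n f g h) (•-zero (h ^ suc n) refl))

  -- Taken as a form of degree n + 1, a polynomial of degree at most n has the second variable as an
  -- extra factor, and the substitution sends that variable to h.
  hom-raise : ∀ n f g h → Below (suc n) f → homogeneous (suc n) f g h ≈ₚ h *ₚ homogeneous n f g h
  hom-raise zero f g h b = begin
      homogeneous 1 f g h              ≈⟨ hom-congᶠ 1 g h (P.trans (uncons f) (∷-cong refl (below-0 (below-tail b)))) ⟩
      homogeneous 1 (coeff f 0 ∷ []) g h ≈⟨ hom-const 1 (coeff f 0) g h ⟩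
      coeff f 0 • (h *ₚ 1ₚ)            ≈⟨ *ₚ-• (coeff f 0) h 1ₚ ⟨
      h *ₚ (coeff f 0 • 1ₚ)            ≈⟨ *ₚ-congˡ h (hom-zero f g h) ⟨
      h *ₚ homogeneous 0 f g h         ∎
    where open SetoidReasoning polySetoid
  hom-raise (suc n) f g h b = begin
      homogeneous (suc (suc n)) f g h
        ≈⟨ hom-suc (suc n) f g h ⟩
      coeff f 0 • (h *ₚ H) +ₚ g *ₚ homogeneous (suc n) (tail f) g h
        ≈⟨ +ₚ-cong (P.sym (*ₚ-• (coeff f 0) h H)) (*ₚ-congˡ g (hom-raise n (tail f) g h (below-tail b))) ⟩
      h *ₚ (coeff f 0 • H) +ₚ g *ₚ (h *ₚ homogeneous n (tail f) g h)
        ≈⟨ solve 4 (λ h x g y → h :* x :+ g :* (h :* y) := h :* (x :+ g :* y)) P.refl h (coeff f 0 • H) g (homogeneous n (tail f) g h) ⟩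
      h *ₚ (coeff f 0 • H +ₚ g *ₚ homogeneous n (tail f) g h)
        ≈⟨ *ₚ-congˡ h (hom-suc n f g h) ⟨
      h *ₚ homogeneous (suc n) f g h ∎
    where
    open SetoidReasoning polySetoid
    H = h ^ suc n

  hom-raise^ : ∀ k {n} f g h → Below (suc n) f → homogeneous (k ℕ.+ n) f g h ≈ₚ h ^ k *ₚ homogeneous n f g h
  hom-raise^ zero    {n} f g h b = P.sym (*ₚ-identityˡ (homogeneous n f g h))
  hom-raise^ (suc k) {n} f g h b = P.trans (hom-raise (k ℕ.+ n) f g h (below-mono (s≤s (ℕₚ.m≤n+m n k)) b))
    (P.trans (*ₚ-congˡ h (hom-raise^ k f g h b)) (P.sym (*ₚ-assoc h (h ^ k) (homogeneous n f g h))))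

  hom-* : ∀ m {n} f u g h → Below (suc m) f → Below (suc n) u →
          homogeneous (m ℕ.+ n) (f *ₚ u) g h ≈ₚ homogeneous m f g h *ₚ homogeneous n u g h
  hom-* zero {n} f u g h b b′ = begin
      homogeneous n (f *ₚ u) g h
        ≈⟨ hom-congᶠ n g h (P.trans (*ₚ-congʳ u (uncons f)) (*ₚ-const (coeff f 0) {tail f} u (below-0 (below-tail b)))) ⟩
      homogeneous n (coeff f 0 • u) g h             ≈⟨ hom-• n (coeff f 0) u g h ⟩
      coeff f 0 • U                                 ≈⟨ •-cong refl (*ₚ-identityˡ U) ⟨
      coeff f 0 • (1ₚ *ₚ U)                         ≈⟨ •-*ₚ (coeff f 0) 1ₚ U ⟨
      (coeff f 0 • 1ₚ) *ₚ U                         ≈⟨ *ₚ-congʳ U (hom-zero f g h) ⟨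
      homogeneous 0 f g h *ₚ U                      ∎
    where
    open SetoidReasoning polySetoid
    U = homogeneous n u g h
  hom-* (suc m) {n} f u g h b b′ = begin
      homogeneous (suc (m ℕ.+ n)) (f *ₚ u) g h
        ≈⟨ hom-congᶠ (suc (m ℕ.+ n)) g h (*ₚ-congʳ u (uncons f)) ⟩
      homogeneous (suc (m ℕ.+ n)) (a • u +ₚ (0# ∷ tail f *ₚ u)) g h
        ≈⟨ hom-+ (suc (m ℕ.+ n)) (a • u) (0# ∷ tail f *ₚ u) g h ⟩
      homogeneous (suc (m ℕ.+ n)) (a • u) g h +ₚ homogeneous (suc (m ℕ.+ n)) (0# ∷ tail f *ₚ u) g h
        ≈⟨ +ₚ-cong (P.trans (hom-• (suc (m ℕ.+ n)) a u g h) (•-cong refl (hom-raise^ (suc m) u g h b′)))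
                   (P.trans (hom-0∷ (m ℕ.+ n) (tail f *ₚ u) g h)
                            (*ₚ-congˡ g (hom-* m (tail f) u g h (below-tail b) b′))) ⟩
      a • (H *ₚ U) +ₚ g *ₚ (F *ₚ U)
        ≈⟨ +ₚ-congʳ _ (•-*ₚ a H U) ⟨
      (a • H) *ₚ U +ₚ g *ₚ (F *ₚ U)
        ≈⟨ solve 4 (λ x u g f → x :* u :+ g :* (f :* u) := (x :+ g :* f) :* u) P.refl (a • H) U g F ⟩
      (a • H +ₚ g *ₚ F) *ₚ U
        ≈⟨ *ₚ-congʳ U (hom-suc m f g h) ⟨
      homogeneous (suc m) f g h *ₚ U ∎
    where
    open SetoidReasoning polySetoid
    a = coeff f 0
    H = h ^ suc m
    U = homogeneous n u g h
    F = homogeneous m (tail f) g h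

  below-^ : ∀ {m f} j → Below (suc m) f → Below (suc (j ℕ.* m)) (f ^ j)
  below-^ zero    b = below deg-1
  below-^ (suc j) b = below-* b (below-^ j b)

  hom-^ : ∀ j {m} f g h → Below (suc m) f → homogeneous (j ℕ.* m) (f ^ j) g h ≈ₚ homogeneous m f g h ^ j
  hom-^ zero    f g h b = P.trans (hom-zero 1ₚ g h) (•-identity 1ₚ)
  hom-^ (suc j) {m} f g h b = P.trans (hom-* m f (f ^ j) g h b (below-^ j b))
    (*ₚ-congˡ (homogeneous m f g h) (hom-^ j f g h b))

  hom-below : ∀ n {s} f g h → Below (suc s) g → Below (suc s) h → Below (suc (n ℕ.* s)) (homogeneous n f g h)
  hom-below zero    f g h b b′ = below-cong (P.sym (hom-zero f g h)) (below-• (coeff f 0) (below deg-1))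
  hom-below (suc n) f g h b b′ = below-cong (P.sym (hom-suc n f g h))
    (below-+ (below-• (coeff f 0) (below-^ (suc n) b′)) (below-* b (hom-below n (tail f) g h b b′)))

  -- Associativity of substitution. With s = 1 it makes matrices act on forms; with the numerator
  -- and denominator of Q it shows how a matrix acts on F^Q.
  hom-comp : ∀ n {s} f g h a b → Below (suc s) g → Below (suc s) h →
             homogeneous (n ℕ.* s) (homogeneous n f g h) a b ≈ₚ homogeneous n f (homogeneous s g a b) (homogeneous s h a b)
  hom-comp zero {s} f g h a b _ _ = begin
      homogeneous 0 (homogeneous 0 f g h) a b    ≈⟨ hom-congᶠ 0 a b (hom-zero f g h) ⟩
      homogeneous 0 (coeff f 0 • 1ₚ) a b         ≈⟨ hom-• 0 (coeff f 0) 1ₚ a b ⟩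
      coeff f 0 • homogeneous 0 1ₚ a b           ≈⟨ •-cong refl (hom-1 0 a b) ⟩
      coeff f 0 • 1ₚ                             ≈⟨ hom-zero f (homogeneous s g a b) (homogeneous s h a b) ⟨
      homogeneous 0 f (homogeneous s g a b) (homogeneous s h a b) ∎
    where open SetoidReasoning polySetoid
  hom-comp (suc n) {s} f g h a b bg bh = begin
      homogeneous N (homogeneous (suc n) f g h) a b
        ≈⟨ hom-congᶠ N a b (hom-suc n f g h) ⟩
      homogeneous N (k • h ^ suc n +ₚ g *ₚ F) a b
        ≈⟨ hom-+ N (k • h ^ suc n) (g *ₚ F) a b ⟩
      homogeneous N (k • h ^ suc n) a b +ₚ homogeneous N (g *ₚ F) a b
        ≈⟨ +ₚ-cong (P.trans (hom-• N k (h ^ suc n) a b) (•-cong refl (hom-^ (suc n) h a b bh)))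
                   (P.trans (hom-* s g F a b bg (hom-below n (tail f) g h bg bh))
                            (*ₚ-congˡ (homogeneous s g a b) (hom-comp n (tail f) g h a b bg bh))) ⟩
      k • homogeneous s h a b ^ suc n +ₚ homogeneous s g a b *ₚ homogeneous n (tail f) (homogeneous s g a b) (homogeneous s h a b)
        ≈⟨ hom-suc n f (homogeneous s g a b) (homogeneous s h a b) ⟨
      homogeneous (suc n) f (homogeneous s g a b) (homogeneous s h a b) ∎
    where
    open SetoidReasoning polySetoid
    N = suc n ℕ.* s
    k = coeff f 0
    F = homogeneous n (tail f) g h

  •-^ : ∀ n k f → (k • f) ^ n ≈ₚ (k ^ᶠ n) • f ^ n
  •-^ zero    k f = P.sym (•-identity 1ₚ)
  •-^ (suc n) k f = begin
      (k • f) *ₚ (k • f) ^ n              ≈⟨ *ₚ-congˡ (k • f) (•-^ n k f) ⟩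
      (k • f) *ₚ ((k ^ᶠ n) • f ^ n)       ≈⟨ •-*ₚ k f _ ⟩
      k • (f *ₚ ((k ^ᶠ n) • f ^ n))       ≈⟨ •-cong refl (*ₚ-• (k ^ᶠ n) f (f ^ n)) ⟩
      k • (k ^ᶠ n) • f ^ suc n            ≈⟨ •-assoc k (k ^ᶠ n) (f ^ suc n) ⟨
      (k * k ^ᶠ n) • f ^ suc n            ∎
    where open SetoidReasoning polySetoid

  ^ᶠ-≉0 : ∀ n {k} → ¬ (k ≈ 0#) → ¬ (k ^ᶠ n ≈ 0#)
  ^ᶠ-≉0 zero    nk = 1≉0
  ^ᶠ-≉0 (suc n) nk = *-≉0 nk (^ᶠ-≉0 n nk)

  hom-scale : ∀ n k f g h → homogeneous n f (k • g) (k • h) ≈ₚ (k ^ᶠ n) • homogeneous n f g h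
  hom-scale zero k f g h = P.trans (hom-zero f (k • g) (k • h)) (P.trans (P.sym (hom-zero f g h)) (P.sym (•-identity (homogeneous 0 f g h))))
  hom-scale (suc n) k f g h = begin
      homogeneous (suc n) f (k • g) (k • h)
        ≈⟨ hom-suc n f (k • g) (k • h) ⟩
      a • (k • h) ^ suc n +ₚ (k • g) *ₚ homogeneous n (tail f) (k • g) (k • h)
        ≈⟨ +ₚ-cong (P.trans (•-cong refl (•-^ (suc n) k h)) (P.trans (P.sym (•-assoc a κ _)) (P.trans (•-cong (*-comm a κ) P.refl) (•-assoc κ a (h ^ suc n)))))
                   (P.trans (*ₚ-congˡ (k • g) (hom-scale n k (tail f) g h))
                   (P.trans (•-*ₚ k g _) (P.trans (•-cong refl (*ₚ-• (k ^ᶠ n) g F)) (P.sym (•-assoc k (k ^ᶠ n) (g *ₚ F)))))) ⟩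
      κ • (a • h ^ suc n) +ₚ κ • (g *ₚ F)
        ≈⟨ •-distribˡ κ (a • h ^ suc n) (g *ₚ F) ⟨
      κ • (a • h ^ suc n +ₚ g *ₚ F)
        ≈⟨ •-cong refl (hom-suc n f g h) ⟨
      κ • homogeneous (suc n) f g h ∎
    where
    open SetoidReasoning polySetoid
    a = coeff f 0
    κ = k ^ᶠ suc n
    F = homogeneous n (tail f) g h

  1^ : ∀ n → 1ₚ ^ n ≈ₚ 1ₚ
  1^ zero    = P.refl
  1^ (suc n) = P.trans (*ₚ-identityˡ (1ₚ ^ n)) (1^ n)

  hom-identity : ∀ n f → Below (suc n) f → homogeneous n f (0# ∷ 1# ∷ []) 1ₚ ≈ₚ f
  hom-identity zero f b = P.trans (hom-zero f (0# ∷ 1# ∷ []) 1ₚ)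
    (P.trans (∷-cong (*-identityʳ _) (P.sym (below-0 (below-tail b)))) (P.sym (uncons f)))
  hom-identity (suc n) f b = begin
      homogeneous (suc n) f X 1ₚ
        ≈⟨ hom-suc n f X 1ₚ ⟩
      coeff f 0 • 1ₚ ^ suc n +ₚ X *ₚ homogeneous n (tail f) X 1ₚ
        ≈⟨ +ₚ-cong (•-cong refl (1^ (suc n))) (*ₚ-congˡ X (hom-identity n (tail f) (below-tail b))) ⟩
      coeff f 0 • 1ₚ +ₚ X *ₚ tail f
        ≈⟨ +ₚ-congˡ (coeff f 0 • 1ₚ) (P.trans (0∷-*ₚ 1ₚ (tail f)) (∷-cong refl (*ₚ-identityˡ (tail f)))) ⟩
      coeff f 0 * 1# + 0# ∷ tail f
        ≈⟨ ∷-cong (trans (+-identityʳ _) (*-identityʳ _)) P.refl ⟩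
      coeff f 0 ∷ tail f
        ≈⟨ uncons f ⟨
      f ∎
    where
    open SetoidReasoning polySetoid
    X = 0# ∷ 1# ∷ []

  monic-+-below : ∀ {n f g} → Below n f → Monic n g → Monic n (f +ₚ g)
  monic-+-below {n} {f} {g} b (mkMonic t b′) = mkMonic
    (trans (coeff-+ f g n) (trans (+-cong (vanish b n ℕₚ.≤-refl) t) (+-identityˡ 1#)))
    (below-+ (below-mono (ℕₚ.n≤1+n n) b) b′)

  -- The degree of h is smaller than that of g, so gⁿ alone supplies the leading term.
  hom-monic : ∀ n {s} {f g h} → Monic n f → Monic (suc s) g → Below (suc s) h → Monic (n ℕ.* suc s) (homogeneous n f g h)
  hom-monic zero {f = f} {g} {h} Mf Mg bh = monic-cong
    (P.sym (P.trans (hom-zero f g h) (P.trans (•-cong (lead≈1 Mf) P.refl) (•-identity 1ₚ)))) monic-1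
  hom-monic (suc n) {s} {f} {g} {h} Mf Mg bh = monic-cong (P.sym (hom-suc n f g h)) (monic-+-below
    (below-• (coeff f 0) (below-mono (s≤s (ℕₚ.+-monoʳ-≤ s (ℕₚ.*-monoʳ-≤ n (ℕₚ.n≤1+n s)))) (below-^ (suc n) bh)))
    (monic-* Mg (hom-monic n (mkMonic (trans (tail-coeff f n) (lead≈1 Mf)) (below-tail (monic-below Mf))) Mg bh)))

  hom-≃ : ∀ n {f f′} g h → f ≃ f′ → homogeneous n f g h ≃ homogeneous n f′ g h
  hom-≃ n {f′ = f′} g h (k , nk , e) = k , nk , P.trans (hom-congᶠ n g h e) (hom-• n k f′ g h)

  hom-deg : ∀ n {s} {f g h} → Deg n f → Monic (suc s) g → Below (suc s) h → Deg (n ℕ.* suc s) (homogeneous n f g h)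
  hom-deg n {g = g} {h} d Mg bh with normalise d
  ... | f′ , M , e = ≃-deg (hom-≃ n g h (≃-sym e)) (monic⇒deg (hom-monic n M Mg bh))

  hom-∣ : ∀ {r} t f x g h k → Below (suc t) f → r ∣ homogeneous t f g h →
          r ∣ homogeneous (k ℕ.+ (length x ℕ.+ t)) (x *ₚ f) g h
  hom-∣ t f x g h k b d = ∣-respʳ (P.sym (hom-raise^ k (x *ₚ f) g h (below-* bx b)))
    (∣-*ˡ (h ^ k) (∣-respʳ (P.sym (hom-* (length x) x f g h bx b)) (∣-*ˡ (homogeneous (length x) x g h) d)))
    where
    bx : Below (suc (length x)) x
    bx = below-mono (ℕₚ.n≤1+n _) (below-length x)

  -- Coprime polynomials have no common zero away from ∞: homogenising the Bézout identity turns its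
  -- right-hand side 1 into a power of h.
  hom-coprime-∣ : ∀ {r t₁ t₂ f₁ f₂} u v g h → u *ₚ f₁ +ₚ v *ₚ f₂ ≈ₚ 1ₚ → Below (suc t₁) f₁ → Below (suc t₂) f₂ →
                  r ∣ homogeneous t₁ f₁ g h → r ∣ homogeneous t₂ f₂ g h → ∃[ M ] r ∣ h ^ M
  hom-coprime-∣ {r} {t₁} {t₂} {f₁} {f₂} u v g h e b₁ b₂ d₁ d₂ = M₂ ℕ.+ M₁ ,
    ∣-respʳ (P.trans (P.sym (hom-+ (M₂ ℕ.+ M₁) (u *ₚ f₁) (v *ₚ f₂) g h)) (P.trans (hom-congᶠ (M₂ ℕ.+ M₁) g h e) (hom-1 (M₂ ℕ.+ M₁) g h)))
      (∣-+ (hom-∣ t₁ f₁ u g h M₂ b₁ d₁)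
           (≡.subst (λ M → r ∣ homogeneous M (v *ₚ f₂) g h) (ℕₚ.+-comm M₁ M₂) (hom-∣ t₂ f₂ v g h M₁ b₂ d₂)))
    where
    -- `M₁` and `M₂` bound the degrees of u f₁ and v f₂; at the common nominal degree `M₂` + `M₁`
    -- the two products can be added.
    M₁ = length u ℕ.+ t₁
    M₂ = length v ℕ.+ t₂

  eval-uncons : ∀ f v → eval f v ≈ coeff f 0 + v * eval (tail f) v
  eval-uncons []      v = sym (trans (+-identityˡ _) (zeroʳ v))
  eval-uncons (a ∷ f) v = refl

  coeff-^-linear : ∀ n a b → coeff ((b ∷ a ∷ []) ^ n) n ≈ a ^ᶠ n
  coeff-^-linear zero    a b = refl
  coeff-^-linear (suc n) a b = trans
    (coeff-*-top 1 (b ∷ a ∷ []) ((b ∷ a ∷ []) ^ n) (below-∷ b (below-∷ a below-[]))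
      (≡.subst (λ k → Below (suc k) ((b ∷ a ∷ []) ^ n)) (ℕₚ.*-identityʳ n) (below-^ n (below-∷ b (below-∷ a below-[])))))
    (*-congˡ (coeff-^-linear n a b))

  hom-linear-below : ∀ n f a b c d → Below (suc n) (homogeneous n f (b ∷ a ∷ []) (d ∷ c ∷ []))
  hom-linear-below n f a b c d = ≡.subst (λ k → Below (suc k) (homogeneous n f (b ∷ a ∷ []) (d ∷ c ∷ []))) (ℕₚ.*-identityʳ n)
    (hom-below n f (b ∷ a ∷ []) (d ∷ c ∷ []) (below-∷ b (below-∷ a below-[])) (below-∷ d (below-∷ c below-[])))

  -- v = a/c is the image of ∞ under (a b; c d).
  hom-linear-lead : ∀ n f {a b c d v} → Below (suc n) f → v * c ≈ a →
                    coeff (homogeneous n f (b ∷ a ∷ []) (d ∷ c ∷ [])) n ≈ c ^ᶠ n * eval f v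
  hom-linear-lead zero f {a} {b} {c} {d} {v} bf e = trans (coeff≈ (hom-zero f (b ∷ a ∷ []) (d ∷ c ∷ [])) 0)
    (trans (*-comm _ _) (*-congˡ (sym (trans (eval-uncons f v) (trans (+-congˡ (trans (*-congˡ (eval-0 (below-0 (below-tail bf)))) (zeroʳ v))) (+-identityʳ _))))))
    where
    eval-0 : ∀ {f} → f ≈ₚ [] → eval f v ≈ 0#
    eval-0 {[]}    e = refl
    eval-0 {x ∷ f} e = trans (+-cong (coeff≈ e 0) (trans (*-congˡ (eval-0 {f} (tail-cong e))) (zeroʳ v))) (+-identityˡ 0#)
  hom-linear-lead (suc n) f {a} {b} {c} {d} {v} bf e = begin
      coeff (homogeneous (suc n) f g h) (suc n)
        ≈⟨ coeff≈ (hom-suc n f g h) (suc n) ⟩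
      coeff (coeff f 0 • h ^ suc n +ₚ g *ₚ F) (suc n)
        ≈⟨ coeff-+ (coeff f 0 • h ^ suc n) (g *ₚ F) (suc n) ⟩
      coeff (coeff f 0 • h ^ suc n) (suc n) + coeff (g *ₚ F) (suc n)
        ≈⟨ +-cong (trans (coeff-• (coeff f 0) (h ^ suc n) (suc n)) (*-congˡ (coeff-^-linear (suc n) c d)))
                  (trans (coeff-*-top 1 g F (below-∷ b (below-∷ a below-[])) (hom-linear-below n (tail f) a b c d))
                         (*-cong (sym e) (hom-linear-lead n (tail f) (below-tail bf) e))) ⟩
      coeff f 0 * (c * c ^ᶠ n) + (v * c) * (c ^ᶠ n * eval (tail f) v)
        ≈⟨ F.solve 5 (λ x c p v y → x F.:* (c F.:* p) F.:+ (v F.:* c) F.:* (p F.:* y) F.:= (c F.:* p) F.:* (x F.:+ v F.:* y)) refl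
             (coeff f 0) c (c ^ᶠ n) v (eval (tail f) v) ⟩
      (c * c ^ᶠ n) * (coeff f 0 + v * eval (tail f) v)
        ≈⟨ *-congˡ (eval-uncons f v) ⟨
      (c * c ^ᶠ n) * eval f v ∎
    where
    open SetoidReasoning setoid
    module F = NaturalSolver commutativeSemiring
    g = b ∷ a ∷ []
    h = d ∷ c ∷ []
    F = homogeneous n (tail f) g h

  -- Both sides are the value of f at nominal degree M + N.
  hom-change-degree : ∀ {M N} f g h → Below (suc M) f → Below (suc N) f →
                      h ^ M *ₚ homogeneous N f g h ≈ₚ h ^ N *ₚ homogeneous M f g h
  hom-change-degree {M} {N} f g h bM bN = P.trans (P.sym (hom-raise^ M f g h bN))
    (P.trans (P.reflexive (≡.cong (λ k → homogeneous k f g h) (ℕₚ.+-comm M N))) (hom-raise^ N f g h bM))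

-- Powers of a generator of a finite cyclic group.

module CyclicSubgroup {c ℓ p : Level} (𝒢 : Group c ℓ) (G : FiniteSubgroup 𝒢 p) where
  open Group 𝒢
  open FiniteSubgroup G
  open GroupProperties 𝒢 using (∙-cancelˡ; inverseʳ-unique)
  open MonoidMult monoid using (×-congʳ; ×-homo-+; ×-assocˡ) renaming (_×_ to infixr 8 _⋆_)

  private
    members = card⇒enumeration finite

  ⋆-∈ : ∀ {x} n → Member x → Member (n ⋆ x)
  ⋆-∈ zero    x∈ = ε∈
  ⋆-∈ (suc n) x∈ = ∙∈ x∈ (⋆-∈ n x∈)

  ⋆-ε : ∀ n → n ⋆ ε ≈ ε
  ⋆-ε zero    = refl
  ⋆-ε (suc n) = trans (identityˡ _) (⋆-ε n)

  private
    period : ∀ {x} → Member x → ∃[ k ] k ℕ.< order × suc k ⋆ x ≈ ε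
    period {x} x∈ with Finₚ.pigeonhole (ℕₚ.n<1+n order) index
      where
      index : Fin (suc order) → Fin order
      index i = proj₁ (Enumeration.surjective members (toℕ i ⋆ x , ⋆-∈ (toℕ i) x∈))
    ... | i , j , i<j , e with ℕₚ.m≤n⇒∃[o]m+o≡n i<j
    ...   | k , i+k≡j = k , k<order , ∙-cancelˡ (toℕ i ⋆ x) (suc k ⋆ x) ε (begin
          toℕ i ⋆ x ∙ suc k ⋆ x     ≈⟨ ×-homo-+ x (toℕ i) (suc k) ⟨
          (toℕ i ℕ.+ suc k) ⋆ x     ≡⟨ ≡.cong (_⋆ x) (≡.trans (ℕₚ.+-suc (toℕ i) k) i+k≡j) ⟩
          toℕ j ⋆ x                 ≈⟨ at-index j ⟨
          at (index j)              ≡⟨ ≡.cong at e ⟨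
          at (index i)              ≈⟨ at-index i ⟩
          toℕ i ⋆ x                 ≈⟨ identityʳ _ ⟨
          toℕ i ⋆ x ∙ ε             ∎)
      where
      open SetoidReasoning setoid
      at : Fin order → Carrier
      at = proj₁ ∘ Enumeration.at members
      index : Fin (suc order) → Fin order
      index i = proj₁ (Enumeration.surjective members (toℕ i ⋆ x , ⋆-∈ (toℕ i) x∈))
      at-index : ∀ i → at (index i) ≈ toℕ i ⋆ x
      at-index i = proj₂ (Enumeration.surjective members (toℕ i ⋆ x , ⋆-∈ (toℕ i) x∈))
      k<order : k ℕ.< order
      k<order = ℕₚ.≤-pred (ℕₚ.≤-trans (s≤s (ℕₚ.≤-trans (s≤s (ℕₚ.m≤n+m k (toℕ i))) (ℕₚ.≤-reflexive i+k≡j))) (Finₚ.toℕ<n j))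

    reduce : ∀ {x} k → suc k ⋆ x ≈ ε → ∀ n → n ⋆ x ≈ (n DivMod.% suc k) ⋆ x
    reduce {x} k e n = begin
        n ⋆ x                                    ≡⟨ ≡.cong (_⋆ x) (DivMod.m≡m%n+[m/n]*n n (suc k)) ⟩
        (r ℕ.+ n DivMod./ suc k ℕ.* suc k) ⋆ x   ≈⟨ ×-homo-+ x r _ ⟩
        r ⋆ x ∙ (n DivMod./ suc k ℕ.* suc k) ⋆ x ≈⟨ ∙-congˡ (×-assocˡ x (n DivMod./ suc k) (suc k)) ⟨
        r ⋆ x ∙ (n DivMod./ suc k) ⋆ suc k ⋆ x   ≈⟨ ∙-congˡ (trans (×-congʳ (n DivMod./ suc k) e) (⋆-ε (n DivMod./ suc k))) ⟩
        r ⋆ x ∙ ε                                ≈⟨ identityʳ _ ⟩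
        r ⋆ x                                    ∎
      where
      open SetoidReasoning setoid
      r = n DivMod.% suc k

    natural : ∀ {x} k → suc k ⋆ x ≈ ε → ∀ m → ∃[ n ] power 𝒢 x m ≈ n ⋆ x
    natural k e (+ n)      = n , refl
    natural {x} k e (-[1+ n ]) = suc n ℕ.* k ,
      trans (×-congʳ (suc n) (sym (inverseʳ-unique x (k ⋆ x) e))) (×-assocˡ x (suc n) k)

  -- Two of the first `order` + 1 powers of x coincide, which gives a period suc k ≤ `order`.
  -- Conversely every exponent, negative ones included since the inverse of x is its k-th power,
  -- reduces modulo suc k, so the members inject into `Fin (suc k)`. Hence suc k = `order`.
  generator-power : ∀ {x} → Member x → (∀ y → Member y → ∃[ k ] y ≈ power 𝒢 x k) →
                    order ⋆ x ≈ ε × (∀ y → Member y → ∃[ i ] i ℕ.< order × y ≈ i ⋆ x)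
  generator-power {x} x∈ gen with period x∈
  ... | k , k<order , e = trans (reflexive (≡.cong (_⋆ x) order≡)) e ,
                          λ y y∈ → let i , i<k , y≈ = cover y y∈ in i , ≡.subst (i ℕ.<_) (≡.sym order≡) i<k , y≈
    where
    cover : ∀ y → Member y → ∃[ i ] i ℕ.< suc k × y ≈ i ⋆ x
    cover y y∈ with gen y y∈
    ... | m , y≈ with natural k e m
    ...   | n , m≈ = n DivMod.% suc k , DivMod.m%n<n n (suc k) , trans y≈ (trans m≈ (reduce k e n))

    exponent : Fin order → Fin (suc k)
    exponent j = let y , y∈ = Enumeration.at members j in Fin.fromℕ< (proj₁ (proj₂ (cover y y∈)))

    exponent-injective : ∀ {i j} → exponent i ≡ exponent j → i ≡ j
    exponent-injective {i} {j} eq = Enumeration.injective members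
      (trans (recover i) (trans (reflexive (≡.cong (λ t → toℕ t ⋆ x) eq)) (sym (recover j))))
      where
      recover : ∀ i → proj₁ (Enumeration.at members i) ≈ toℕ (exponent i) ⋆ x
      recover i = let y , y∈ = Enumeration.at members i
                      m , m<k , y≈ = cover y y∈
                  in trans y≈ (reflexive (≡.cong (_⋆ x) (≡.sym (Finₚ.toℕ-fromℕ< m<k))))

    order≡ : order ≡ suc k
    order≡ = ℕₚ.≤-antisym (Finₚ.injective⇒≤ {f = exponent} exponent-injective) k<order

-- The action of matrices on binary forms.

module Action {c ℓ : Level} (𝔽 : FiniteField c ℓ) where
  open FiniteField 𝔽
  open OverFiniteField 𝔽
  open PolynomialRing 𝔽
  open Euclid 𝔽
  open Factorisation 𝔽
  open Homogeneous 𝔽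
  open RawMagmaDefs using (_,_)
  open RawSemiringDefs (Semiring.rawSemiring semiring) using () renaming (_^_ to _^ᶠ_)
  module PGL = Group PGL₂

  act : ℕ → Poly → GL₂ → Poly
  act n f A = homogeneous n f (numerator A) (denominator A)

  below-linear : ∀ a b → Below 2 (b ∷ a ∷ [])
  below-linear a b = below-∷ b (below-∷ a below-[])

  denominator-≉0 : ∀ A → ¬ (denominator A ≈ₚ [])
  denominator-≉0 A = RatFunc.den≉0 (möbius A)

  act-cong : ∀ n {f g} A → f ≈ₚ g → act n f A ≈ₚ act n g A
  act-cong n A e = hom-congᶠ n (numerator A) (denominator A) e

  act-≃ : ∀ n {f g} A → f ≃ g → act n f A ≃ act n g A
  act-≃ n A e = hom-≃ n (numerator A) (denominator A) e

  act-below : ∀ n f A → Below (suc n) (act n f A)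
  act-below n f (mat a b c d _) = hom-linear-below n f a b c d

  act-* : ∀ m {n} f g A → Below (suc m) f → Below (suc n) g → act (m ℕ.+ n) (f *ₚ g) A ≈ₚ act m f A *ₚ act n g A
  act-* m f g A = hom-* m f g (numerator A) (denominator A)

  hom-linear : ∀ b a g h → homogeneous 1 (b ∷ a ∷ []) g h ≈ₚ b • h +ₚ a • g
  hom-linear b a g h = P.trans (hom-suc 0 (b ∷ a ∷ []) g h) (+ₚ-cong (•-cong refl (*ₚ-identityʳ h))
    (P.trans (*ₚ-congˡ g (hom-zero (a ∷ []) g h)) (P.trans (*ₚ-• a g 1ₚ) (•-cong refl (*ₚ-identityʳ g)))))

  -- On matrices the right action is exact; scalars enter only when a matrix is replaced by a
  -- proportional one.
  act-comp : ∀ n f A B → act n (act n f A) B ≈ₚ act n f (A · B)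
  act-comp n f A@(mat a b c d _) B@(mat e f′ g h _) =
    P.trans (P.reflexive (≡.cong (λ k → homogeneous k (act n f A) (numerator B) (denominator B)) (≡.sym (ℕₚ.*-identityʳ n))))
    (P.trans (hom-comp n {1} f (numerator A) (denominator A) (numerator B) (denominator B) (below-linear a b) (below-linear c d))
    (hom-cong n {f = f} P.refl (P.trans (hom-linear b a (numerator B) (denominator B)) (∷-cong (+-comm _ _) (∷-cong (+-comm _ _) P.refl)))
                       (P.trans (hom-linear d c (numerator B) (denominator B)) (∷-cong (+-comm _ _) (∷-cong (+-comm _ _) P.refl)))))

  act-∼ : ∀ n f {A B} → (e : A ∼ B) → act n f A ≈ₚ (_∼_.k e ^ᶠ n) • act n f B
  act-∼ n f {A} {B} (proportional k k≉0 a≈ b≈ c≈ d≈) = P.trans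
    (hom-cong n {f = f} P.refl (∷-cong b≈ (∷-cong a≈ P.refl)) (∷-cong d≈ (∷-cong c≈ P.refl)))
    (hom-scale n k f (numerator B) (denominator B))

  act-∼-≃ : ∀ n f {A B} → A ∼ B → act n f A ≃ act n f B
  act-∼-≃ n f e = _∼_.k e ^ᶠ n , ^ᶠ-≉0 n (_∼_.k≉0 e) , act-∼ n f e

  act-I : ∀ n f → Below (suc n) f → act n f I₂ ≈ₚ f
  act-I n f b = P.trans (hom-cong n {f = f} {g = 0# ∷ 1# ∷ []} P.refl P.refl (∷-cong refl (∷≈[] refl P.refl))) (hom-identity n f b)

  act-adj : ∀ n f A → Below (suc n) f → act n (act n f A) (adj A) ≃ f
  act-adj n f A b = ≃-trans (≈⇒≃ (act-comp n f A (adj A)))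
    (≃-trans (act-∼-≃ n f (PGL.inverseʳ A)) (≈⇒≃ (act-I n f b)))

  act-≉0 : ∀ n {f} A → Below (suc n) f → ¬ (f ≈ₚ []) → ¬ (act n f A ≈ₚ [])
  act-≉0 n {f} A b nz z with act-adj n f A b
  ... | k , nk , e with •-flip nk e
  ...   | l , _ , _ , e′ = nz (P.trans e′ (P.trans (•-cong refl (P.trans (act-cong n (adj A) z) (hom-[] n (numerator (adj A)) (denominator (adj A))))) P.refl))

  -- The second factor has degree at most j. If the first is constant, the product has degree at
  -- most j, and i + j ≤ j forces i = 0.
  act-unit : ∀ {i j x y n} A → Deg (i ℕ.+ j) (act i x A *ₚ act j y A) → n ≡ i ℕ.+ j → act i x A ∣ 1ₚ → i ≡ 0
  act-unit {i} {j} {x} {y} A d n≡ u with ≉0⇒deg (∣-≉0 (∣-*ˡ (act i x A) ∣-refl) (deg⇒≉0 d))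
  ... | k , dk with deg-unique (deg-* (∣1⇒deg-0 u) dk) d
  ...   | k≡i+j = ℕₚ.n≤0⇒n≡0 (ℕₚ.+-cancelʳ-≤ j i 0
    (ℕₚ.≤-trans (ℕₚ.≤-reflexive (≡.sym k≡i+j)) (ℕₚ.≤-pred (deg-below dk (act-below j y A)))))

  -- A factorisation of the image is carried back by the adjugate. The hypothesis that the degree
  -- does not drop matters: a linear form whose zero goes to ∞ becomes a constant.
  act-irreducible : ∀ {n r} A → Irreducible r → Deg n r → Deg n (act n r A) → Irreducible (act n r A)
  act-irreducible {n} {r} A irr d dA = record
    { p∤1      = λ u → ℕₚ.<⇒≢ (irr-deg>0 irr d) (deg-unique (∣1⇒deg-0 u) dA)
    ; split-∣1 = split
    }
    where
    split : ∀ {x y} → act n r A ≈ₚ x *ₚ y → x ∣ 1ₚ ⊎ y ∣ 1ₚ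
    split {x} {y} e with deg? x | deg? y
    ... | inj₁ z | _ = ⊥-elim (deg⇒≉0 dA (P.trans e (*ₚ-congʳ y z)))
    ... | _ | inj₁ z = ⊥-elim (deg⇒≉0 dA (P.trans e (P.trans (*ₚ-congˡ x z) (*ₚ-zeroʳ x))))
    ... | inj₂ (i , dx) | inj₂ (j , dy) with deg-unique dA (deg-cong (P.sym e) (deg-* dx dy))
    ...   | ≡.refl with act-adj n r A (below d)
    ...     | r≃ = go (Irreducible.split-∣1 (irr-≃ r≃xy irr) P.refl)
      where
      x′ = act i x (adj A)
      y′ = act j y (adj A)
      r≃xy : r ≃ x′ *ₚ y′
      r≃xy = ≃-trans (≃-sym r≃) (≈⇒≃ (P.trans (act-cong (i ℕ.+ j) (adj A) e) (act-* i x y (adj A) (below dx) (below dy))))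
      go : x′ ∣ 1ₚ ⊎ y′ ∣ 1ₚ → x ∣ 1ₚ ⊎ y ∣ 1ₚ
      go (inj₁ u) = inj₁ (deg-0⇒∣1 (≡.subst (λ k → Deg k x) (act-unit {i} {j} {x} {y} {n} (adj A) (≃-deg r≃xy d) ≡.refl u) dx))
      go (inj₂ u) = inj₂ (deg-0⇒∣1 (≡.subst (λ k → Deg k y) (act-unit {j} {i} {y} {x} {n} (adj A)
        (≡.subst (λ k → Deg k (y′ *ₚ x′)) (ℕₚ.+-comm i j) (deg-cong (*ₚ-comm x′ y′) (≃-deg r≃xy d))) (ℕₚ.+-comm i j) u) dy))

-- Iterates of one matrix and products over them.

module Iteration {c ℓ : Level} (𝔽 : FiniteField c ℓ) where
  open FiniteField 𝔽
  open OverFiniteField 𝔽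
  open PolynomialRing 𝔽
  open Euclid 𝔽
  open Homogeneous 𝔽
  open Action 𝔽
  open RawMagmaDefs using (_,_)

  pow : GL₂ → ℕ → GL₂
  pow σ zero    = I₂
  pow σ (suc i) = pow σ i · σ

  iter : GL₂ → ℕ → Poly → ℕ → Poly
  iter σ n f zero    = f
  iter σ n f (suc i) = act n (iter σ n f i) σ

  module _ (σ : GL₂) where
    iter-below : ∀ n {f} i → Below (suc n) f → Below (suc n) (iter σ n f i)
    iter-below n zero    b = b
    iter-below n (suc i) b = act-below n (iter σ n _ i) σ

    iter-act : ∀ n f i → Below (suc n) f → iter σ n f i ≈ₚ act n f (pow σ i)
    iter-act n f zero    b = P.sym (act-I n f b)
    iter-act n f (suc i) b = P.trans (act-cong n σ (iter-act n f i b)) (act-comp n f (pow σ i) σ)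

    iter-cong : ∀ n {f f′} i → f ≈ₚ f′ → iter σ n f i ≈ₚ iter σ n f′ i
    iter-cong n zero    e = e
    iter-cong n (suc i) e = act-cong n σ (iter-cong n i e)

    iter-≃ : ∀ n {f f′} i → f ≃ f′ → iter σ n f i ≃ iter σ n f′ i
    iter-≃ n zero    e = e
    iter-≃ n (suc i) e = act-≃ n σ (iter-≃ n i e)

    iter-+ : ∀ n f i j → iter σ n (iter σ n f i) j ≡ iter σ n f (j ℕ.+ i)
    iter-+ n f i zero    = ≡.refl
    iter-+ n f i (suc j) = ≡.cong (λ f → act n f σ) (iter-+ n f i j)

    iter-* : ∀ m {n} f u i → Below (suc m) f → Below (suc n) u →
             iter σ (m ℕ.+ n) (f *ₚ u) i ≈ₚ iter σ m f i *ₚ iter σ n u i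
    iter-* m f u zero    b b′ = P.refl
    iter-* m {n} f u (suc i) b b′ = P.trans (act-cong (m ℕ.+ n) σ (iter-* m f u i b b′))
      (act-* m (iter σ m f i) (iter σ n u i) σ (iter-below m i b) (iter-below n i b′))

    iter-≉0 : ∀ n {f} i → Below (suc n) f → ¬ (f ≈ₚ []) → ¬ (iter σ n f i ≈ₚ [])
    iter-≉0 n zero    b nz = nz
    iter-≉0 n (suc i) b nz = act-≉0 n σ (iter-below n i b) (iter-≉0 n i b nz)

    iter-∣ : ∀ {n N f u} i → Deg n f → Deg N u → f ∣ u → iter σ n f i ∣ iter σ N u i
    iter-∣ {f = f} {u} i df du d with cofactor df du d
    ... | k , w , ≡.refl , dw , e = iter σ k w i ,
      P.trans (P.sym (iter-* k w f i (below dw) (below df))) (iter-cong _ i e)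

  prod : ℕ → (ℕ → Poly) → Poly
  prod zero    a = 1ₚ
  prod (suc k) a = a 0 *ₚ prod k (a ∘ suc)

  prod-last : ∀ k a → prod (suc k) a ≈ₚ prod k a *ₚ a k
  prod-last zero    a = *ₚ-comm (a 0) 1ₚ
  prod-last (suc k) a = P.trans (*ₚ-congˡ (a 0) (prod-last k (a ∘ suc))) (P.sym (*ₚ-assoc (a 0) (prod k (a ∘ suc)) (a (suc k))))

  prod-below : ∀ k {n a} → (∀ i → Below (suc n) (a i)) → Below (suc (k ℕ.* n)) (prod k a)
  prod-below zero    b = below deg-1
  prod-below (suc k) b = below-* (b 0) (prod-below k (b ∘ suc))

  prod-deg : ∀ k {n a} → (∀ i → Deg n (a i)) → Deg (k ℕ.* n) (prod k a)
  prod-deg zero    d = deg-1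
  prod-deg (suc k) d = deg-* (d 0) (prod-deg k (d ∘ suc))

  prod-≉0 : ∀ k {a} → (∀ i → ¬ (a i ≈ₚ [])) → ¬ (prod k a ≈ₚ [])
  prod-≉0 zero    nz = deg⇒≉0 deg-1
  prod-≉0 (suc k) nz = *ₚ-≉0 (nz 0) (prod-≉0 k (nz ∘ suc))

  act-prod : ∀ k {n a} A → (∀ i → Below (suc n) (a i)) → act (k ℕ.* n) (prod k a) A ≈ₚ prod k (λ i → act n (a i) A)
  act-prod zero    A b = P.trans (hom-1 0 (numerator A) (denominator A)) P.refl
  act-prod (suc k) {n} {a} A b = P.trans (act-* n (a 0) (prod k (a ∘ suc)) A (b 0) (prod-below k (b ∘ suc)))
    (*ₚ-congˡ (act n (a 0) A) (act-prod k A (b ∘ suc)))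

  ∣-prod : ∀ {k a i} → i ℕ.< k → a i ∣ prod k a
  ∣-prod {suc k} {a} {zero}  _         = ∣-*ʳ (prod k (a ∘ suc)) ∣-refl
  ∣-prod {suc k} {a} {suc i} (s≤s i<k) = ∣-*ˡ (a 0) (∣-prod {k} {a ∘ suc} {i} i<k)

  euclid-prod : ∀ {r} k a → Irreducible r → r ∣ prod k a → ∃[ i ] i ℕ.< k × (r ∣ a i)
  euclid-prod zero    a irr d = ⊥-elim (irr-∤1 irr d)
  euclid-prod (suc k) a irr d with euclid (a 0) (prod k (a ∘ suc)) irr d
  ... | inj₁ d′ = 0 , s≤s z≤n , d′
  ... | inj₂ d′ with euclid-prod k (a ∘ suc) irr d′
  ...   | i , i<k , d″ = suc i , s≤s i<k , d″

-- The data of the subgroup and the quotient map on which the argument rests.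

module Setting {c ℓ : Level} (𝔽 : FiniteField c ℓ) where
  open FiniteField 𝔽
  open OverFiniteField 𝔽
  open Euclid 𝔽
  open Action 𝔽
  open Iteration 𝔽

  -- The s-th power of σ is a scalar matrix, whose effect `κ n` depends on the degree alone, so two
  -- forms of equal degree return with the same factor. `descend` is one half of the fixed-field
  -- condition: a quotient of eigenforms with a common eigenvalue is a function of Q. The other
  -- half, invariance of Q itself, appears as the common eigenvalue `μ` of g and h.
  record CyclicQuotient : Set (c ⊔ ℓ) where
    field
      s′       : ℕ
      σ        : GL₂
      κ        : ℕ → Carrier
      κ≉0      : ∀ n → ¬ (κ n ≈ 0#)
      period   : ∀ n f → Below (suc n) f → iter σ n f (suc s′) ≈ₚ κ n • f
      g h      : Poly
      g-monic  : Monic (suc s′) g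
      h-below  : Below (suc s′) h
      coprime  : Coprime g h
      μ        : Carrier
      μ≉0      : ¬ (μ ≈ 0#)
      g-σ      : act (suc s′) g σ ≈ₚ μ • g
      h-σ      : act (suc s′) h σ ≈ₚ μ • h
      descend  : ∀ n κ num den → Below (suc n) num → Below (suc n) den → ¬ (den ≈ₚ []) → ¬ (κ ≈ 0#) →
                 act n num σ ≈ₚ κ • num → act n den σ ≈ₚ κ • den →
                 ∃[ N ] ∃₂ λ u v → Below (suc N) u × Below (suc N) v × ¬ (homogeneous N v g h ≈ₚ []) ×
                 num *ₚ homogeneous N v g h ≈ₚ homogeneous N u g h *ₚ den

-- Norms, transforms under Q and poles.

module Norm {c ℓ : Level} (𝔽 : FiniteField c ℓ) (𝒬 : Setting.CyclicQuotient 𝔽) where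
  open FiniteField 𝔽
  open OverFiniteField 𝔽
  open PolynomialRing 𝔽
  open Euclid 𝔽
  open Homogeneous 𝔽
  open Action 𝔽
  open Iteration 𝔽
  open Setting 𝔽
  open CyclicQuotient 𝒬
  open RawMagmaDefs using (_,_)
  open RawSemiringDefs (Semiring.rawSemiring semiring) using () renaming (_^_ to _^ᶠ_)

  s : ℕ
  s = suc s′

  it : ℕ → Poly → ℕ → Poly
  it = iter σ

  it-≃0 : ∀ n {f} i → act n f σ ≃ f → it n f i ≃ f
  it-≃0 n zero    e = ≃-refl
  it-≃0 n (suc i) e = ≃-trans (act-≃ n σ (it-≃0 n i e)) e

  it-period-≃ : ∀ n f → Below (suc n) f → it n f s ≃ f
  it-period-≃ n f b = κ n , κ≉0 n , period n f b

  norm : ℕ → Poly → Poly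
  norm n f = prod s (it n f)

  norm-below : ∀ n f → Below (suc n) f → Below (suc (s ℕ.* n)) (norm n f)
  norm-below n f b = prod-below s (λ i → iter-below σ n i b)

  norm-≉0 : ∀ n f → Below (suc n) f → ¬ (f ≈ₚ []) → ¬ (norm n f ≈ₚ [])
  norm-≉0 n f b nz = prod-≉0 s (λ i → iter-≉0 σ n i b nz)

  -- The action shifts the factors cyclically and the last one returns to `κ n • f`. As the
  -- eigenvalue does not involve f, the quotient of the norms of r and of 1 is invariant exactly.
  norm-σ : ∀ n f → Below (suc n) f → act (s ℕ.* n) (norm n f) σ ≈ₚ κ n • norm n f
  norm-σ n f b = begin
      act (s ℕ.* n) (norm n f) σ          ≈⟨ act-prod s {n} {it n f} σ (λ i → iter-below σ n i b) ⟩
      prod s (it n f ∘ suc)               ≈⟨ prod-last s′ (it n f ∘ suc) ⟩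
      p *ₚ it n f s                       ≈⟨ *ₚ-congˡ p (period n f b) ⟩
      p *ₚ (κ n • f)                      ≈⟨ *ₚ-• (κ n) p f ⟩
      κ n • (p *ₚ f)                      ≈⟨ •-cong refl (*ₚ-comm p f) ⟩
      κ n • (f *ₚ p)                      ∎
    where
    open SetoidReasoning polySetoid
    p = prod s′ (it n f ∘ suc)

  _^Q[_] : Poly → ℕ → Poly
  F ^Q[ n ] = homogeneous n F g h

  Q-monic : ∀ {n F} → Monic n F → Monic (n ℕ.* s) (F ^Q[ n ])
  Q-monic {n} M = hom-monic n M g-monic h-below

  Q-deg : ∀ {n F} → Deg n F → Deg (n ℕ.* s) (F ^Q[ n ])
  Q-deg {n} d = hom-deg n d g-monic h-below

  -- The exact eigenvalue is kept because comparing it with the determinant settles the quadratic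
  -- case of order 2.
  Q-σ-exact : ∀ n F → act (n ℕ.* s) (F ^Q[ n ]) σ ≈ₚ (μ ^ᶠ n) • F ^Q[ n ]
  Q-σ-exact n F = P.trans
    (hom-comp n F g h (numerator σ) (denominator σ) (monic-below g-monic) (below-mono (ℕₚ.n≤1+n s) h-below))
    (P.trans (hom-cong n {f = F} P.refl g-σ h-σ) (hom-scale n μ F g h))

  Q-σ : ∀ n F → act (n ℕ.* s) (F ^Q[ n ]) σ ≃ F ^Q[ n ]
  Q-σ n F = μ ^ᶠ n , ^ᶠ-≉0 n μ≉0 , Q-σ-exact n F

  Q-∣ : ∀ {m n F T} → Deg m F → Deg n T → F ∣ T → F ^Q[ m ] ∣ T ^Q[ n ]
  Q-∣ {m} {F = F} dF dT d with cofactor dF dT d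
  ... | k , w , ≡.refl , dw , e = w ^Q[ k ] ,
    P.trans (P.sym (hom-* k w F g h (below dw) (below dF))) (hom-congᶠ (k ℕ.+ m) g h e)

  -- Modulo h only a multiple of gⁿ remains of F^Q, and g is coprime to h. The Horner recursion
  -- expresses this: a common irreducible divisor would have to divide g or the transform of the
  -- tail.
  Q-coprime-h : ∀ {n F e} → Deg n F → Irreducible e → e ∣ F ^Q[ n ] → ¬ (e ∣ h)
  Q-coprime-h {n} {F} {e} d irr e∣F e∣h with normalise d
  ... | F′ , M , F≃F′ = go n M (∣-trans e∣F (≃⇒∣ (hom-≃ n g h F≃F′)))
    where
    go : ∀ n {F} → Monic n F → ¬ (e ∣ F ^Q[ n ])
    go zero    {F} M d = irr-∤1 irr (∣-respʳ (P.trans (hom-zero F g h) (P.trans (•-cong (lead≈1 M) P.refl) (•-identity 1ₚ))) d)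
    go (suc n) {F} M d with euclid g (tail F ^Q[ n ]) irr
                              (∣-cancel-+ (coeff F 0 • h ^ suc n) (hom-suc n F g h) d (∣-• (coeff F 0) (∣-*ʳ (h ^ n) e∣h)))
    ... | inj₁ e∣g = irr-∤1 irr (coprime {e} e∣g e∣h)
    ... | inj₂ d′  = go n (mkMonic (trans (tail-coeff F n) (lead≈1 M)) (below-tail (monic-below M))) d′

  -- Distinct monic irreducibles E and F are coprime, so by `hom-coprime-∣` a common factor of their
  -- transforms divides a power of h, against `Q-coprime-h`.
  Q-unique : ∀ {r m n E F} → Irreducible r → Monic m E → Irreducible E → Monic n F → Irreducible F →
             r ∣ E ^Q[ m ] → r ∣ F ^Q[ n ] → E ≈ₚ F
  Q-unique {r} {m} {n} {E} {F} irr ME irE MF irF r∣E r∣F with irr-coprime irE F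
  ... | inj₁ E∣F = ≃-monic ME MF (irr-∣-irr irE irF E∣F)
  ... | inj₂ (u , v , e) with hom-coprime-∣ {r} {m} {n} {E} {F} u v g h e (monic-below ME) (monic-below MF) r∣E r∣F
  ...   | M , d = ⊥-elim (Q-coprime-h (monic⇒deg MF) irr r∣F (euclid-^ h M irr d))

  den-pow : ∀ n i → it n 1ₚ i ≈ₚ denominator (pow σ i) ^ n
  den-pow n i = P.trans (iter-act σ n 1ₚ i (below-mono (s≤s z≤n) (below deg-1)))
    (hom-1 n (numerator (pow σ i)) (denominator (pow σ i)))

  -- The degree of h is below s, so as a form of degree s it vanishes at ∞. Being an eigenform it
  -- vanishes on the whole orbit of ∞, and the denominators of the powers of σ are the linear forms
  -- with those zeros.
  den-∣-h : ∀ i → denominator (pow σ i) ∣ h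
  den-∣-h i = ∣-trans (∣-respʳ (P.sym eq) (∣-*ʳ (act s′ h (pow σ i)) ∣-refl)) (≃⇒∣ (it-≃0 s i (μ , μ≉0 , h-σ)))
    where
    eq : it s h i ≈ₚ denominator (pow σ i) *ₚ act s′ h (pow σ i)
    eq = P.trans (iter-act σ s h i (below-mono (ℕₚ.n≤1+n s) h-below))
                 (hom-raise s′ h (numerator (pow σ i)) (denominator (pow σ i)) h-below)

  pole-∣-h : ∀ {e} n i → Irreducible e → e ∣ it n 1ₚ i → e ∣ h
  pole-∣-h n i irr d = ∣-trans (euclid-^ (denominator (pow σ i)) n irr (∣-respʳ (den-pow n i) d)) (den-∣-h i)

  -- Equivalently, r has no root in G∘∞: a root [A]∘∞ makes the degree of a translate drop.
  Good : ℕ → Poly → Set ℓ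
  Good n r = ∀ i → Deg n (it n r i)

  below-1 : ∀ n → Below (suc n) 1ₚ
  below-1 n = below-mono (s≤s z≤n) (below deg-1)

  pole-linear : ∀ {e} n i → Irreducible e → e ∣ it n 1ₚ i → it 1 1ₚ i ≃ e × Deg 1 e
  pole-linear n i irr d =
    let e≃Δ , d1 = irr-∣-linear irr (below-linear (GL₂.c′ (pow σ i)) (GL₂.d (pow σ i))) (denominator-≉0 (pow σ i))
                     (euclid-^ (denominator (pow σ i)) n irr (∣-respʳ (den-pow n i) d))
    in ≃-trans (≈⇒≃ (P.trans (den-pow 1 i) (*ₚ-identityʳ (denominator (pow σ i))))) (≃-sym e≃Δ) , d1

  it-return : ∀ n f i → Below (suc n) f → i ℕ.≤ s → it n (it n f i) (s ℕ.∸ i) ≃ f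
  it-return n f i b i≤s = ≡.subst (_≃ f) (≡.sym (≡.trans (iter-+ σ n f i (s ℕ.∸ i)) (≡.cong (it n f) (ℕₚ.m∸n+n≡m i≤s))))
    (it-period-≃ n f b)

  -- The zero of e is carried to ∞ in t steps. If e divided a translate of r, the translate t steps
  -- later would vanish at ∞ too, that is, lose degree.
  linear-factor-drops : ∀ {n r} e t j → Deg 1 e → it 1 e t ∣ 1ₚ → Good n r → ¬ (e ∣ it n r j)
  linear-factor-drops {n} {r} e t j d1 unit good d = go (cofactor d1 (good j) d)
    where
    go : ¬ (∃₂ λ k w → n ≡ k ℕ.+ 1 × Deg k w × w *ₚ e ≈ₚ it n r j)
    go (m , w , ≡.refl , dw , eq) = ℕₚ.<-irrefl (ℕₚ.+-comm m 1) (deg-below deg′ (below-cong (P.sym eq′) product-below))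
      where
      v = it (m ℕ.+ 1) (it (m ℕ.+ 1) r j) t
      deg′ : Deg (m ℕ.+ 1) v
      deg′ = ≡.subst (Deg (m ℕ.+ 1)) (≡.sym (iter-+ σ (m ℕ.+ 1) r j t)) (good (t ℕ.+ j))
      eq′ : v ≈ₚ it m w t *ₚ it 1 e t
      eq′ = P.trans (iter-cong σ (m ℕ.+ 1) t (P.sym eq)) (iter-* σ m w e t (below dw) (below d1))
      product-below : Below (suc m) (it m w t *ₚ it 1 e t)
      product-below = ≡.subst (λ k → Below (suc k) (it m w t *ₚ it 1 e t)) (ℕₚ.+-identityʳ m)
        (below-* (iter-below σ m t (below dw)) (below (∣1⇒deg-0 unit)))

  -- A pole on the i-th translate of 1 reaches ∞ after the remaining s - i steps, because s steps
  -- return 1 to a constant.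
  pole-coprime : ∀ {n r e} i j → Good n r → Irreducible e → i ℕ.≤ s → e ∣ it n 1ₚ i → ¬ (e ∣ it n r j)
  pole-coprime {n} {r} {e} i j good irr i≤s d =
    let one , d1 = pole-linear n i irr d
    in linear-factor-drops e (s ℕ.∸ i) j d1
         (≃⇒∣ (≃-trans (iter-≃ σ 1 (s ℕ.∸ i) (≃-sym one)) (it-return 1 1ₚ i (below-1 1) i≤s))) good

-- The norm of a good polynomial is a transform.

module NormIsTransform {c ℓ : Level} (𝔽 : FiniteField c ℓ) (𝒬 : Setting.CyclicQuotient 𝔽) where
  open FiniteField 𝔽
  open OverFiniteField 𝔽
  open PolynomialRing 𝔽
  open Euclid 𝔽
  open Factorisation 𝔽
  open Homogeneous 𝔽
  open Action 𝔽
  open Iteration 𝔽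
  open Setting 𝔽
  open CyclicQuotient 𝒬
  open Norm 𝔽 𝒬
  open RawMagmaDefs using (_,_)
  open SemiringExp R.semiring using (^-homo-*)
  open NaturalSolver R.commutativeSemiring using (solve; _:+_; _:*_; _:=_)

  h≉0 : ¬ (h ≈ₚ [])
  h≉0 z = ℕₚ.1+n≢0 (deg-unique (monic⇒deg g-monic) (∣1⇒deg-0 (coprime ∣-refl ([] , P.sym z))))

  Q-≉0 : ∀ {n F} → Deg n F → ¬ (F ^Q[ n ] ≈ₚ [])
  Q-≉0 d = deg⇒≉0 (Q-deg d)

  -- Cancelling the gcd of u and v lowers the nominal degree by the degree of the gcd, whose
  -- transform `z` splits off both values. Coprimality is recorded as a Bézout identity, the form in
  -- which it survives substitution.
  record LowestTerms (N : ℕ) (u v : Poly) : Set (c ⊔ ℓ) where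
    field
      N₀ a b      : ℕ
      u₀ v₀ x y z : Poly
      u₀-deg      : Deg a u₀
      v₀-deg      : Deg b v₀
      a≤N₀        : a ℕ.≤ N₀
      b≤N₀        : b ℕ.≤ N₀
      bezout      : x *ₚ u₀ +ₚ y *ₚ v₀ ≈ₚ 1ₚ
      z≉0         : ¬ (z ≈ₚ [])
      u-split     : u ^Q[ N ] ≈ₚ u₀ ^Q[ N₀ ] *ₚ z
      v-split     : v ^Q[ N ] ≈ₚ v₀ ^Q[ N₀ ] *ₚ z

  lowestTerms : ∀ {N m n u v} → Deg m u → Deg n v → m ℕ.≤ N → n ℕ.≤ N → LowestTerms N u v
  lowestTerms {N} {m} {n} {u} {v} du dv m≤N n≤N with bézout u v
  ... | d , d∣u , d∣v , x , y , e with ≉0⇒deg (∣-≉0 d∣u (deg⇒≉0 du))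
  ...   | δ , dd with cofactor dd du d∣u | cofactor dd dv d∣v
  ...     | a , u₀ , ≡.refl , du₀ , eu | b , v₀ , ≡.refl , dv₀ , ev = record
    { N₀ = N ℕ.∸ δ ; a = a ; b = b ; u₀ = u₀ ; v₀ = v₀ ; x = x ; y = y ; z = d ^Q[ δ ]
    ; u₀-deg = du₀ ; v₀-deg = dv₀ ; a≤N₀ = a≤ ; b≤N₀ = b≤
    ; bezout = *ₚ-cancelʳ d (deg⇒≉0 dd) (begin
        (x *ₚ u₀ +ₚ y *ₚ v₀) *ₚ d
          ≈⟨ solve 5 (λ x u y v d → (x :* u :+ y :* v) :* d := x :* (u :* d) :+ y :* (v :* d)) P.refl x u₀ y v₀ d ⟩
        x *ₚ (u₀ *ₚ d) +ₚ y *ₚ (v₀ *ₚ d)     ≈⟨ +ₚ-cong (*ₚ-congˡ x eu) (*ₚ-congˡ y ev) ⟩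
        x *ₚ u +ₚ y *ₚ v                     ≈⟨ e ⟨
        d                                    ≈⟨ *ₚ-identityˡ d ⟨
        1ₚ *ₚ d                              ∎)
    ; z≉0 = Q-≉0 dd
    ; u-split = split a≤ du₀ eu
    ; v-split = split b≤ dv₀ ev
    }
    where
    open SetoidReasoning polySetoid
    a≤ : a ℕ.≤ N ℕ.∸ δ
    a≤ = ℕₚ.m+n≤o⇒m≤o∸n a m≤N
    b≤ : b ℕ.≤ N ℕ.∸ δ
    b≤ = ℕₚ.m+n≤o⇒m≤o∸n b n≤N
    δ≤N : δ ℕ.≤ N
    δ≤N = ℕₚ.≤-trans (ℕₚ.m≤n+m δ a) m≤N
    split : ∀ {k w w₀} → k ℕ.≤ N ℕ.∸ δ → Deg k w₀ → w₀ *ₚ d ≈ₚ w → w ^Q[ N ] ≈ₚ w₀ ^Q[ N ℕ.∸ δ ] *ₚ d ^Q[ δ ]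
    split {k} {w} {w₀} k≤ dw₀ ew = begin
      w ^Q[ N ]                    ≡⟨ ≡.cong (w ^Q[_]) (ℕₚ.m∸n+n≡m δ≤N) ⟨
      w ^Q[ N ℕ.∸ δ ℕ.+ δ ]        ≈⟨ hom-congᶠ (N ℕ.∸ δ ℕ.+ δ) g h ew ⟨
      (w₀ *ₚ d) ^Q[ N ℕ.∸ δ ℕ.+ δ ] ≈⟨ hom-* (N ℕ.∸ δ) w₀ d g h (below-mono (s≤s k≤) (below dw₀)) (below dd) ⟩
      w₀ ^Q[ N ℕ.∸ δ ] *ₚ d ^Q[ δ ] ∎

  Q-raise : ∀ {n F} N → Deg n F → n ℕ.≤ N → F ^Q[ N ] ≈ₚ h ^ (N ℕ.∸ n) *ₚ F ^Q[ n ]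
  Q-raise {n} {F} N d n≤N = P.trans (P.reflexive (≡.cong (F ^Q[_]) (≡.sym (ℕₚ.m∸n+n≡m n≤N)))) (hom-raise^ (N ℕ.∸ n) F g h (below d))

  module Reduced {num den : Poly} (num≉0 : ¬ (num ≈ₚ [])) (den≉0 : ¬ (den ≈ₚ [])) (poles : ∀ e → Irreducible e → e ∣ den → e ∣ h) (nd-coprime : ∀ e → Irreducible e → e ∣ den → ¬ (e ∣ num)) {N u v} (L : LowestTerms N u v) (eq : num *ₚ v ^Q[ N ] ≈ₚ u ^Q[ N ] *ₚ den) where
    open LowestTerms L

    reduced-eq : num *ₚ v₀ ^Q[ N₀ ] ≈ₚ u₀ ^Q[ N₀ ] *ₚ den
    reduced-eq = *ₚ-cancelʳ z z≉0 (begin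
        num *ₚ V *ₚ z        ≈⟨ *ₚ-assoc num V z ⟩
        num *ₚ (V *ₚ z)      ≈⟨ *ₚ-congˡ num v-split ⟨
        num *ₚ v ^Q[ N ]     ≈⟨ eq ⟩
        u ^Q[ N ] *ₚ den     ≈⟨ *ₚ-congʳ den u-split ⟩
        U *ₚ z *ₚ den        ≈⟨ solve 3 (λ U z d → U :* z :* d := U :* d :* z) P.refl U z den ⟩
        U *ₚ den *ₚ z        ∎)
      where
      open SetoidReasoning polySetoid
      U = u₀ ^Q[ N₀ ]
      V = v₀ ^Q[ N₀ ]

    -- An irreducible factor of the transform of v₀ divides that of u₀ or `den`. In the first case
    -- coprimality of u₀ and v₀, in the second the location of the poles makes it divide h, which no
    -- factor of a transform does.
    no-pole : ∀ e → Irreducible e → ¬ (e ∣ v₀ ^Q[ b ])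
    no-pole e irr e∣V = go (euclid (u₀ ^Q[ N₀ ]) den irr (∣-respʳ reduced-eq (∣-*ˡ num e∣V′)))
      where
      e∣V′ : e ∣ v₀ ^Q[ N₀ ]
      e∣V′ = ∣-respʳ (P.sym (Q-raise N₀ v₀-deg b≤N₀)) (∣-*ˡ (h ^ (N₀ ℕ.∸ b)) e∣V)
      go : ¬ (e ∣ u₀ ^Q[ N₀ ] ⊎ e ∣ den)
      go (inj₂ e∣den) = Q-coprime-h v₀-deg irr e∣V (poles e irr e∣den)
      go (inj₁ e∣U) = let M , e∣h^M = hom-coprime-∣ {e} {N₀} {N₀} {u₀} {v₀} x y g h bezout
                                        (below-mono (s≤s a≤N₀) (below u₀-deg)) (below-mono (s≤s b≤N₀) (below v₀-deg)) e∣U e∣V′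
                      in Q-coprime-h v₀-deg irr e∣V (euclid-^ h M irr e∣h^M)

    b≡0 : b ≡ 0
    b≡0 = ℕₚ.m*n≡0⇒m≡0 b s (deg-unique (Q-deg v₀-deg) (no-factor⇒deg-0 (Q-≉0 v₀-deg) no-pole))

    U : Poly
    U = u₀ ^Q[ a ]

    -- Now v₀ is constant, so its value is h to the power `N₀` up to a scalar, while the value of u₀
    -- at nominal degree `N₀` contains h to the power `N₀` - a; the common power cancels.
    num≃ : h ^ a *ₚ num ≃ U *ₚ den
    num≃ = ≃-cancelˡ (h ^ (N₀ ℕ.∸ a)) (^-≉0 (N₀ ℕ.∸ a) h≉0) (≃-trans (≈⇒≃ left) (≃-trans (≃-* (≃-refl {num}) (≃-sym v₀≃)) (≈⇒≃ right)))
      where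
      open SetoidReasoning polySetoid
      k = N₀ ℕ.∸ a
      v₀≃ : v₀ ^Q[ N₀ ] ≃ h ^ N₀
      v₀≃ = ≃-trans (hom-≃ N₀ g h (deg-0⇒≃1 (≡.subst (λ b → Deg b v₀) b≡0 v₀-deg))) (≈⇒≃ (hom-1 N₀ g h))
      left : h ^ k *ₚ (h ^ a *ₚ num) ≈ₚ num *ₚ h ^ N₀
      left = begin
        h ^ k *ₚ (h ^ a *ₚ num)    ≈⟨ *ₚ-assoc (h ^ k) (h ^ a) num ⟨
        h ^ k *ₚ h ^ a *ₚ num      ≈⟨ *ₚ-congʳ num (^-homo-* h k a) ⟨
        h ^ (k ℕ.+ a) *ₚ num       ≡⟨ ≡.cong (λ j → h ^ j *ₚ num) (ℕₚ.m∸n+n≡m a≤N₀) ⟩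
        h ^ N₀ *ₚ num              ≈⟨ *ₚ-comm (h ^ N₀) num ⟩
        num *ₚ h ^ N₀              ∎
      right : num *ₚ v₀ ^Q[ N₀ ] ≈ₚ h ^ k *ₚ (U *ₚ den)
      right = begin
        num *ₚ v₀ ^Q[ N₀ ]         ≈⟨ reduced-eq ⟩
        u₀ ^Q[ N₀ ] *ₚ den         ≈⟨ *ₚ-congʳ den (Q-raise N₀ u₀-deg a≤N₀) ⟩
        h ^ k *ₚ U *ₚ den          ≈⟨ *ₚ-assoc (h ^ k) U den ⟩
        h ^ k *ₚ (U *ₚ den)        ∎

    U∣num : U ∣ num
    U∣num = coprime-∣ U (h ^ a) num
      (no-common-factor⇒coprime (Q-≉0 u₀-deg) (λ e irr e∣U e∣h → Q-coprime-h u₀-deg irr e∣U (euclid-^ h a irr e∣h)))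
      (∣-trans (∣-*ʳ den ∣-refl) (≃⇒∣ (≃-sym num≃)))

    -- The cofactor w of U in `num` satisfies w hᵃ ≃ `den`, so an irreducible factor of w would
    -- divide both `num` and `den`. Hence w is constant.
    num≃U : num ≃ U
    num≃U = go U∣num
      where
      go : U ∣ num → num ≃ U
      go (w , e) = ≃-trans (≈⇒≃ (P.sym e)) (≃-*-const w (no-factor⇒deg-0 w≉0 no-factor))
        where
        w≉0 : ¬ (w ≈ₚ [])
        w≉0 = ∣-≉0 (∣-respʳ e (∣-*ʳ {w} {w} U ∣-refl)) num≉0
        wh≃den : w *ₚ h ^ a ≃ den
        wh≃den = ≃-cancelˡ U (Q-≉0 u₀-deg) (≃-trans (≈⇒≃ (P.trans
          (solve 3 (λ U w h → U :* (w :* h) := h :* (w :* U)) P.refl U w (h ^ a)) (*ₚ-congˡ (h ^ a) e))) num≃)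
        no-factor : ∀ f → Irreducible f → ¬ (f ∣ w)
        no-factor f irr f∣w = nd-coprime f irr (∣-trans (∣-*ʳ (h ^ a) f∣w) (≃⇒∣ wh≃den)) (∣-respʳ e (∣-*ʳ U f∣w))

  norm-transform : ∀ {n r} → Good n r → ∃[ T ] Monic n T × norm n r ≃ T ^Q[ n ]
  norm-transform {n} {r} good = go (descend (s ℕ.* n) (κ n) num den (norm-below n r (below d)) (norm-below n 1ₚ (below-1 n))
                                  den≉0 (κ≉0 n) (norm-σ n r (below d)) (norm-σ n 1ₚ (below-1 n)))
    where
    d : Deg n r
    d = good 0
    num = norm n r
    den = norm n 1ₚ
    num-deg : Deg (s ℕ.* n) num
    num-deg = prod-deg s good
    num≉0 : ¬ (num ≈ₚ [])
    num≉0 = deg⇒≉0 num-deg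
    den≉0 : ¬ (den ≈ₚ [])
    den≉0 = norm-≉0 n 1ₚ (below-1 n) (deg⇒≉0 deg-1)
    poles : ∀ e → Irreducible e → e ∣ den → e ∣ h
    poles e irr e∣den = let i , _ , e∣i = euclid-prod s (it n 1ₚ) irr e∣den in pole-∣-h n i irr e∣i
    nd-coprime : ∀ e → Irreducible e → e ∣ den → ¬ (e ∣ num)
    nd-coprime e irr e∣den e∣num =
      let i , i<s , e∣i = euclid-prod s (it n 1ₚ) irr e∣den
          j , _   , e∣j = euclid-prod s (it n r) irr e∣num
      in pole-coprime i j good irr (ℕₚ.<⇒≤ i<s) e∣i e∣j
    go : ∃[ N ] ∃₂ (λ u v → Below (suc N) u × Below (suc N) v × ¬ (v ^Q[ N ] ≈ₚ []) × num *ₚ v ^Q[ N ] ≈ₚ u ^Q[ N ] *ₚ den) →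
         ∃[ T ] Monic n T × norm n r ≃ T ^Q[ n ]
    go (N , u , v , bu , bv , nz , eq) with deg? u | deg? v
    ... | inj₁ z | _ = ⊥-elim (*ₚ-≉0 num≉0 nz (P.trans eq (*ₚ-congʳ den (P.trans (hom-congᶠ N g h z) (hom-[] N g h)))))
    ... | _ | inj₁ z = ⊥-elim (nz (P.trans (hom-congᶠ N g h z) (hom-[] N g h)))
    -- The degree of T is found by comparison: its transform has degree a · s, the norm has degree s
    -- · n.
    ... | inj₂ (_ , du) | inj₂ (_ , dv) = finish (ℕₚ.*-cancelʳ-≡ a n s (≡.trans (deg-unique (Q-deg u₀-deg) (≃-deg num≃U num-deg)) (ℕₚ.*-comm s n))) u₀-deg num≃U
      where
      L = lowestTerms du dv (ℕₚ.≤-pred (deg-below du bu)) (ℕₚ.≤-pred (deg-below dv bv))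
      open LowestTerms L using (a; u₀; u₀-deg)
      open Reduced num≉0 den≉0 poles nd-coprime L eq using (num≃U)
      finish : ∀ {a u₀} → a ≡ n → Deg a u₀ → num ≃ u₀ ^Q[ a ] → ∃[ T ] Monic n T × norm n r ≃ T ^Q[ n ]
      finish ≡.refl du₀ e with normalise du₀
      ... | T , M , u₀≃T = T , M , ≃-trans e (hom-≃ n g h u₀≃T)

-- Orbits of irreducible polynomials and the irreducibles below them.

module OrbitStructure {c ℓ : Level} (𝔽 : FiniteField c ℓ) (𝒬 : Setting.CyclicQuotient 𝔽) where
  open FiniteField 𝔽
  open OverFiniteField 𝔽
  open PolynomialRing 𝔽
  open Euclid 𝔽
  open Factorisation 𝔽
  open Homogeneous 𝔽
  open Action 𝔽
  open Iteration 𝔽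
  open Setting 𝔽
  open CyclicQuotient 𝒬
  open Norm 𝔽 𝒬
  open NormIsTransform 𝔽 𝒬
  open RawMagmaDefs using (_,_)
  open NaturalSolver R.commutativeSemiring using (solve; _:*_; _:=_)

  it-irreducible : ∀ {n r} i → Irreducible r → Good n r → Irreducible (it n r i)
  it-irreducible zero    irr good = irr
  it-irreducible (suc i) irr good = act-irreducible σ (it-irreducible i irr good) (good i) (good (suc i))

  it-Q : ∀ k F i → it (k ℕ.* s) (F ^Q[ k ]) i ≃ F ^Q[ k ]
  it-Q k F i = it-≃0 (k ℕ.* s) i (Q-σ k F)

  orbit-∣-Q : ∀ {n k r F} i → Deg n r → Deg k F → r ∣ F ^Q[ k ] → it n r i ∣ F ^Q[ k ]
  orbit-∣-Q {k = k} {F = F} i dr dF d = ∣-trans (iter-∣ σ i dr (Q-deg dF) d) (≃⇒∣ (it-Q k F i))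

  orbit-∣-Q⁻¹ : ∀ {n k r F} i → i ℕ.≤ s → Good n r → Deg k F → it n r i ∣ F ^Q[ k ] → r ∣ F ^Q[ k ]
  orbit-∣-Q⁻¹ {n} {k} {r} {F} i i≤s good dF d = ∣-trans (≃⇒∣ (≃-sym (it-return n r i (below (good 0)) i≤s)))
    (orbit-∣-Q {k = k} {F = F} (s ℕ.∸ i) (good i) dF d)

  it-multiple : ∀ n {f} i k → it n f i ≃ f → it n f (k ℕ.* i) ≃ f
  it-multiple n     i zero    e = ≃-refl
  it-multiple n {f} i (suc k) e = ≃-trans (≈⇒≃ (P.reflexive (≡.sym (iter-+ σ n f (k ℕ.* i) i))))
    (≃-trans (iter-≃ σ n i (it-multiple n i k e)) e)

  it-period-* : ∀ n f k → Below (suc n) f → it n f (k ℕ.* s) ≃ f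
  it-period-* n f k b = it-multiple n s k (it-period-≃ n f b)

  -- A translate that loses degree vanishes at ∞, so it splits off the linear form of ∞, which is 1
  -- at nominal degree 1. Translating back exhibits a translate of that form as a factor of the
  -- irreducible r.
  it-drop : ∀ {n r} i → Irreducible r → Deg n r → coeff (it n r i) n ≈ 0# → ∃[ t ] r ≃ it 1 1ₚ t
  it-drop {zero}  i irr d z = ⊥-elim (ℕₚ.<⇒≢ (irr-deg>0 irr d) ≡.refl)
  it-drop {suc n} {r} i irr d z = t , go (Irreducible.split-∣1 (irr-≃ r≃yw irr) P.refl)
    where
    -- Since i + i · s′ = i · s is a multiple of the period, t further steps bring the translate
    -- back to r up to a scalar.
    t = i ℕ.* s′
    f = it (suc n) r i
    y = it 1 1ₚ t
    w = it n f t
    b : Below (suc n) f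
    b = mkBelow λ k n≤k → help k (ℕₚ.m≤n⇒m<n∨m≡n n≤k)
      where
      help : ∀ k → suc n ℕ.< k ⊎ suc n ≡ k → coeff f k ≈ 0#
      help k (inj₁ n<k)    = vanish (iter-below σ (suc n) i (below d)) k n<k
      help k (inj₂ ≡.refl) = z
    return : it (suc n) f t ≃ r
    return = ≃-trans (≈⇒≃ (P.reflexive (≡.trans (iter-+ σ (suc n) r i t)
      (≡.cong (it (suc n) r) (≡.trans (ℕₚ.+-comm t i) (≡.sym (ℕₚ.*-suc i s′))))))) (it-period-* (suc n) r i (below d))
    r≃yw : r ≃ y *ₚ w
    r≃yw = ≃-trans (≃-sym return) (≈⇒≃ (P.trans (iter-cong σ (suc n) t (P.sym (*ₚ-identityˡ f)))
      (iter-* σ 1 1ₚ f t (below-1 1) b)))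
    go : y ∣ 1ₚ ⊎ w ∣ 1ₚ → r ≃ y
    go (inj₂ u) = ≃-trans r≃yw (≃-trans (≈⇒≃ (*ₚ-comm y w)) (≃-*-const w (∣1⇒deg-0 u)))
    go (inj₁ u) = ⊥-elim (ℕₚ.<-irrefl ≡.refl
      (deg-below (≃-deg (≃-trans r≃yw (≃-*-const y (∣1⇒deg-0 u))) d) (iter-below σ n t b)))

  good-unless-pole : ∀ {n r} → Irreducible r → Deg n r → (∀ t → ¬ (r ≃ it 1 1ₚ t)) → Good n r
  good-unless-pole {n} irr d not-pole i = mkDeg (λ z → let t , e = it-drop i irr d z in not-pole t e) (iter-below σ n i (below d))

  coprime-h⇒good : ∀ {n r} → Irreducible r → Deg n r → ¬ (r ∣ h) → Good n r
  coprime-h⇒good irr d r∤h = good-unless-pole irr d λ t e → r∤h (pole-∣-h 1 t irr (≃⇒∣ e))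

  nonlinear⇒good : ∀ {n r} → Irreducible r → Deg n r → 1 ℕ.< n → Good n r
  nonlinear⇒good irr d 1<n = good-unless-pole irr d λ t e →
    ℕₚ.<⇒≱ (deg-below (≃-deg e d) (iter-below σ 1 t (below-1 1))) 1<n

  -- If σ fixes ∞, its denominator is constant; every translate of 1 is then constant and none is
  -- associated with an irreducible.
  ∞-fixed⇒good : ∀ {n r} → GL₂.c′ σ ≈ 0# → Irreducible r → Deg n r → Good n r
  ∞-fixed⇒good c≈0 irr d = good-unless-pole irr d λ t e →
    irr-∤1 irr (≃⇒∣ (≃-trans e (it-≃0 1 t (≃-trans (≈⇒≃ eq) (deg-0⇒≃1 den-deg)))))
    where
    eq : act 1 1ₚ σ ≈ₚ denominator σ
    eq = P.trans (hom-1 1 (numerator σ) (denominator σ)) (*ₚ-identityʳ (denominator σ))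
    den-below : Below 1 (denominator σ)
    den-below = below-∷ (GL₂.d σ) (below-cong (P.sym (∷≈[] c≈0 P.refl)) below-[])
    den-deg : Deg 0 (denominator σ)
    den-deg = below-1⇒deg-0 (denominator-≉0 σ) den-below

  Fixed : ℕ → Poly → Set (c ⊔ ℓ)
  Fixed n r = act n r σ ≃ r

  fixed⇒good : ∀ {n r} → Fixed n r → Deg n r → Good n r
  fixed⇒good {n} e d i = ≃-deg (≃-sym (it-≃0 n i e)) d

  record Below-irreducible (n : ℕ) (r : Poly) : Set (c ⊔ ℓ) where
    field
      m j     : ℕ
      F       : Poly
      F-monic : Monic m F
      F-irr   : Irreducible F
      n≡j*m   : n ≡ j ℕ.* m
      r∣F     : r ∣ F ^Q[ m ]
      norm≃   : norm n r ≃ (F ^Q[ m ]) ^ j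

  irreducible-below : ∀ {n r} → Irreducible r → Good n r → Below-irreducible n r
  irreducible-below {n} {r} irr good = go (norm-transform good)
    where
    go : ∃[ T ] Monic n T × norm n r ≃ T ^Q[ n ] → Below-irreducible n r
    go (T , MT , norm≃T) = finish n MT (irr-deg>0 irr (good 0))
      where
      r∣EQ : ∀ {k E} → Monic k E → Irreducible E → E ∣ T → r ∣ E ^Q[ k ]
      r∣EQ {zero}  ME irE E∣T = ⊥-elim (ℕₚ.<⇒≢ (irr-deg>0 irE (monic⇒deg ME)) ≡.refl)
      -- An irreducible factor of E^Q divides the norm and is therefore a conjugate of r; as E^Q is
      -- an eigenform, r itself divides it.
      r∣EQ {suc k} {E} ME irE E∣T =
        let _ , e , _ , ire , e∣EQ = irreducibleFactor (Q-deg (monic⇒deg ME))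
            e∣norm = ∣-trans (∣-trans e∣EQ (Q-∣ (monic⇒deg ME) (monic⇒deg MT) E∣T)) (≃⇒∣ (≃-sym norm≃T))
            i , i<s , e∣it = euclid-prod s (it n r) ire e∣norm
            it≃e = ≃-sym (irr-∣-irr ire (it-irreducible i irr good) e∣it)
        in orbit-∣-Q⁻¹ {k = suc k} {F = E} i (ℕₚ.<⇒≤ i<s) good (monic⇒deg ME) (∣-trans (≃⇒∣ it≃e) e∣EQ)
      finish : ∀ n′ → Monic n′ T → 0 ℕ.< n → Below-irreducible n r
      finish zero M 0<n = ⊥-elim (ℕₚ.<⇒≢ 0<n (deg-unique (monic⇒deg M) (monic⇒deg MT)))
      finish (suc n′) M _ =
        let m , F , MF , irF , F∣T = irreducibleFactor (monic⇒deg M)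
            r∣FQ = r∣EQ MF irF F∣T
            j , n≡ , T≈ = power-of-irreducible MF irF MT λ ME irE E∣T → Q-unique irr ME irE MF irF (r∣EQ ME irE E∣T) r∣FQ
        in record
          { m = m ; j = j ; F = F ; F-monic = MF ; F-irr = irF ; n≡j*m = n≡ ; r∣F = r∣FQ
          ; norm≃ = ≃-trans norm≃T (≈⇒≃ (P.trans (P.trans (hom-congᶠ n g h T≈)
              (P.reflexive (≡.cong ((F ^ j) ^Q[_]) n≡))) (hom-^ j F g h (monic-below MF)))) }

  positive-power : ∀ {n j m} → n ≡ j ℕ.* m → 0 ℕ.< n → ∃[ i ] j ≡ suc i
  positive-power {j = suc i} _ _ = i , ≡.refl
  positive-power {j = zero}  ≡.refl ()

  -- Every irreducible factor of F^Q divides the norm, which is a power of r up to a scalar because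
  -- σ fixes r; so F^Q = rᵏ. The degrees m s = k n and n = j m give s = k j, which leaves two cases
  -- for prime s.
  fixed-below : ∀ {n r} → Monic n r → Irreducible r → Fixed n r →
                ∃[ m ] ∃[ F ] Monic m F × Irreducible F × ∃₂ λ j k → n ≡ j ℕ.* m × s ≡ k ℕ.* j × F ^Q[ m ] ≈ₚ r ^ k
  fixed-below {n} {r} Mr irr fixed = go (irreducible-below irr (fixed⇒good fixed (monic⇒deg Mr)))
    where
    go : Below-irreducible n r →
         ∃[ m ] ∃[ F ] Monic m F × Irreducible F × ∃₂ λ j k → n ≡ j ℕ.* m × s ≡ k ℕ.* j × F ^Q[ m ] ≈ₚ r ^ k
    go B =
      let k , m*s≡k*n , FQ≈ = power-of-irreducible Mr irr (Q-monic F-monic) only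
          s≡k*j = ℕₚ.*-cancelʳ-≡ s (k ℕ.* j) m {{ℕ.>-nonZero (irr-deg>0 F-irr (monic⇒deg F-monic))}}
            (≡.trans (ℕₚ.*-comm s m) (≡.trans m*s≡k*n (≡.trans (≡.cong (k ℕ.*_) n≡j*m) (≡.sym (ℕₚ.*-assoc k j m)))))
      in m , F , F-monic , F-irr , j , k , n≡j*m , s≡k*j , FQ≈
      where
      open Below-irreducible B
      only : ∀ {k e} → Monic k e → Irreducible e → e ∣ F ^Q[ m ] → e ≈ₚ r
      only {e = e} Me ire e∣FQ =
        let i , j≡ = positive-power {n} {j} {m} n≡j*m (irr-deg>0 irr (monic⇒deg Mr))
            e∣norm = ∣-trans (≡.subst (λ j → e ∣ (F ^Q[ m ]) ^ j) (≡.sym j≡) (∣-*ʳ ((F ^Q[ m ]) ^ i) e∣FQ)) (≃⇒∣ (≃-sym norm≃))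
            t , _ , e∣it = euclid-prod s (it n r) ire e∣norm
        in ≃-monic Me Mr (irr-∣-irr ire irr (∣-trans e∣it (≃⇒∣ (it-≃0 n t fixed))))

  module PrimeOrder (s-prime : Prime s) where

    1<s : 1 ℕ.< s
    1<s = ℕ.nonTrivial⇒n>1 s {{prime⇒nonTrivial s-prime}}

    prime-factors : ∀ {k j} → s ≡ k ℕ.* j → (k ≡ 1 × j ≡ s) ⊎ (k ≡ s × j ≡ 1)
    prime-factors {k} {j} e with prime⇒irreducible s-prime (ℕ∣.divides j (≡.trans e (ℕₚ.*-comm k j)))
    ... | inj₁ ≡.refl = inj₁ (≡.refl , ≡.sym (≡.trans e (ℕₚ.*-identityˡ j)))
    ... | inj₂ ≡.refl = inj₂ (≡.refl , ℕₚ.*-cancelˡ-≡ j 1 s (≡.trans (≡.sym e) (≡.sym (ℕₚ.*-identityʳ s))))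

    -- As 0 < i < s with s prime, some multiple of i and some multiple of s differ by 1. Both
    -- stabilise r, hence so does a single step.
    stable⇒fixed : ∀ {n r} i → Below (suc n) r → 0 ℕ.< i → i ℕ.< s → it n r i ≃ r → Fixed n r
    stable⇒fixed {n} {r} i b 0<i i<s e with Coprimality.coprime-Bézout (Coprimality.prime⇒coprime s-prime {{ℕ.>-nonZero 0<i}} i<s)
    ... | Bézout.+- x y eq = close (y ℕ.* i) (x ℕ.* s) eq (it-multiple n i y e) (it-period-* n r x b)
      where
      close : ∀ k l → 1 ℕ.+ k ≡ l → it n r k ≃ r → it n r l ≃ r → Fixed n r
      close k l ≡.refl ek el = ≃-trans (≃-sym (act-≃ n σ ek)) el
    ... | Bézout.-+ x y eq = close (x ℕ.* s) (y ℕ.* i) eq (it-period-* n r x b) (it-multiple n i y e)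
      where
      close : ∀ k l → 1 ℕ.+ k ≡ l → it n r k ≃ r → it n r l ≃ r → Fixed n r
      close k l ≡.refl ek el = ≃-trans (≃-sym (act-≃ n σ ek)) el

    -- Another s - j steps turn the coincidence of the i-th and j-th translates into stability under
    -- s - j + i steps, a number strictly between 0 and s.
    orbit-distinct : ∀ {n r} i j → Below (suc n) r → i ℕ.< j → j ℕ.< s → it n r i ≃ it n r j → Fixed n r
    orbit-distinct {n} {r} i j b i<j j<s e = stable⇒fixed (t ℕ.+ i) b
      (ℕₚ.<-≤-trans (ℕₚ.m<n⇒0<n∸m j<s) (ℕₚ.m≤m+n t i))
      (ℕₚ.<-≤-trans (ℕₚ.+-monoʳ-< t i<j) (ℕₚ.≤-reflexive (ℕₚ.m∸n+n≡m (ℕₚ.<⇒≤ j<s))))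
      (≃-trans (≈⇒≃ (P.reflexive (≡.sym (iter-+ σ n r i t))))
        (≃-trans (iter-≃ σ n t e) (it-return n r j b (ℕₚ.<⇒≤ j<s))))
      where t = s ℕ.∸ j

    free-below : ∀ {n r} → Irreducible r → Good n r → ¬ Fixed n r →
                 ∃[ F ] Monic n F × Irreducible F × norm n r ≃ F ^Q[ n ]
    free-below {n} {r} irr good free = from (irreducible-below irr good)
     where
     from : Below-irreducible n r → ∃[ F ] Monic n F × Irreducible F × norm n r ≃ F ^Q[ n ]
     from B = go j ≡.refl
      where
      open Below-irreducible B
      rest = prod s′ (it n r ∘ suc)
      go : ∀ j′ → j′ ≡ j → ∃[ F ] Monic n F × Irreducible F × norm n r ≃ F ^Q[ n ]
      go zero e = ⊥-elim (ℕₚ.<⇒≢ (irr-deg>0 irr (good 0)) (≡.sym (≡.trans n≡j*m (≡.cong (ℕ._* m) (≡.sym e)))))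
      go (suc zero) e = F , ≡.subst (λ k → Monic k F) m≡n F-monic , F-irr ,
        ≃-trans norm≃ (≈⇒≃ (P.trans (P.reflexive (≡.cong ((F ^Q[ m ]) ^_) (≡.sym e)))
                                    (P.trans (*ₚ-identityʳ (F ^Q[ m ])) (P.reflexive (≡.cong (F ^Q[_]) m≡n)))))
        where
        m≡n : m ≡ n
        m≡n = ≡.sym (≡.trans n≡j*m (≡.trans (≡.cong (ℕ._* m) (≡.sym e)) (ℕₚ.*-identityˡ m)))
      -- Two factors F^Q contribute r² to the norm, so r also divides a later factor of the product,
      -- and this factor is a proper translate of r.
      go (suc (suc j′)) e = ⊥-elim (free (let i , i<s′ , r∣it = euclid-prod s′ (it n r ∘ suc) irr r∣rest
                                          in stable⇒fixed (suc i) (below (good 0)) (s≤s z≤n) (s≤s i<s′)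
                                               (≃-sym (irr-∣-irr irr (it-irreducible (suc i) irr good) r∣it))))
        where
        r∣rest : r ∣ rest
        r∣rest = cancel (let w , eq = r∣F in w *ₚ w *ₚ (F ^Q[ m ]) ^ j′ , (begin
            w *ₚ w *ₚ f ^ j′ *ₚ (r *ₚ r)
              ≈⟨ solve 3 (λ w p r → w :* w :* p :* (r :* r) := (w :* r) :* ((w :* r) :* p)) P.refl w (f ^ j′) r ⟩
            (w *ₚ r) *ₚ ((w *ₚ r) *ₚ f ^ j′)     ≈⟨ *ₚ-cong eq (*ₚ-congʳ (f ^ j′) eq) ⟩
            f ^ suc (suc j′)                     ≡⟨ ≡.cong (f ^_) e ⟩
            f ^ j                                ∎))
          where
          open SetoidReasoning polySetoid
          f = F ^Q[ m ]
          cancel : r *ₚ r ∣ f ^ j → r ∣ rest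
          cancel d = let w , eq = ∣-trans d (≃⇒∣ (≃-sym norm≃)) in w ,
            *ₚ-cancelˡ r (irr-≉0 irr) (P.trans (solve 2 (λ r w → r :* (w :* r) := w :* (r :* r)) P.refl r w) eq)

    reducible-transform : ∀ {n r F} → Good n r → 0 ℕ.< n → norm n r ≃ F ^Q[ n ] → ¬ Irreducible (F ^Q[ n ])
    reducible-transform {n} {r} good 0<n e irr with Irreducible.split-∣1 (irr-≃ (≃-sym e) irr) {r} {prod s′ (it n r ∘ suc)} P.refl
    ... | inj₁ u = ℕₚ.<⇒≢ 0<n (deg-unique (∣1⇒deg-0 u) (good 0))
    ... | inj₂ u = ℕₚ.<⇒≢ (ℕₚ.*-mono-≤ (ℕₚ.≤-pred 1<s) 0<n) (deg-unique (∣1⇒deg-0 u) (prod-deg s′ (good ∘ suc)))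

    -- For prime s the exponent of a fixed r in the transform below it is 1 or s; this is the second
    -- possibility, shown at the end to imply `Ramified`.
    TotallyRamified : ℕ → Poly → Set (c ⊔ ℓ)
    TotallyRamified n F = ∃[ r ] Monic n r × Irreducible r × Fixed n r × F ^Q[ n ] ≈ₚ r ^ s

    fixed-cases : ∀ {n r} → Monic n r → Irreducible r → Fixed n r →
      (∃[ F ] Monic n F × Irreducible F × F ^Q[ n ] ≈ₚ r ^ s) ⊎
      (∃₂ λ m F → n ≡ s ℕ.* m × Monic m F × Irreducible F × F ^Q[ m ] ≈ₚ r)
    fixed-cases {n} {r} Mr irr fixed =
      let m , F , MF , irF , j , k , n≡ , s≡ , e = fixed-below Mr irr fixed in cases {m} {F} {j} {k} MF irF n≡ e (prime-factors {k} {j} s≡)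
      where
      cases : ∀ {m F j k} → Monic m F → Irreducible F → n ≡ j ℕ.* m → F ^Q[ m ] ≈ₚ r ^ k → (k ≡ 1 × j ≡ s) ⊎ (k ≡ s × j ≡ 1) →
              (∃[ F ] Monic n F × Irreducible F × F ^Q[ n ] ≈ₚ r ^ s) ⊎
              (∃₂ λ m F → n ≡ s ℕ.* m × Monic m F × Irreducible F × F ^Q[ m ] ≈ₚ r)
      cases {m} {F} MF irF n≡ e (inj₁ (≡.refl , ≡.refl)) = inj₂ (m , F , n≡ , MF , irF , P.trans e (*ₚ-identityʳ r))
      cases {m} {F} MF irF n≡ e (inj₂ (≡.refl , ≡.refl)) = inj₁ (ramified MF irF e (≡.trans n≡ (ℕₚ.*-identityˡ m)))
        where
        ramified : ∀ {m F} → Monic m F → Irreducible F → F ^Q[ m ] ≈ₚ r ^ s → n ≡ m →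
                   ∃[ F ] Monic n F × Irreducible F × F ^Q[ n ] ≈ₚ r ^ s
        ramified {F = F} MF irF e ≡.refl = F , MF , irF , e

    -- Any irreducible factor r of F^Q serves. It is good because F^Q is coprime to h, and not fixed
    -- because otherwise F^Q would be r or rˢ. Its norm is then the transform of an irreducible,
    -- which `Q-unique` identifies with F.
    split-transform : ∀ {n F} → Monic n F → Irreducible F → ¬ Irreducible (F ^Q[ n ]) → ¬ TotallyRamified n F →
                      ∃[ r ] Monic n r × Irreducible r × Good n r × ¬ Fixed n r × norm n r ≃ F ^Q[ n ]
    split-transform {zero}  MF irF red unram = ⊥-elim (ℕₚ.<⇒≢ (irr-deg>0 irF (monic⇒deg MF)) ≡.refl)
    split-transform {suc n} {F} MF irF red unram = finish (irreducibleFactor (Q-deg (monic⇒deg MF)))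
      where
      finish : ∃₂ (λ m r → Monic m r × Irreducible r × (r ∣ F ^Q[ suc n ])) →
               ∃[ r ] Monic (suc n) r × Irreducible r × Good (suc n) r × ¬ Fixed (suc n) r × norm (suc n) r ≃ F ^Q[ suc n ]
      finish (m , r , Mr , irr , r∣FQ) = conclude (free-below irr good free)
        where
        good : Good m r
        good = coprime-h⇒good irr (monic⇒deg Mr) (Q-coprime-h (monic⇒deg MF) irr r∣FQ)
        unique : ∀ {k E} → Monic k E → Irreducible E → r ∣ E ^Q[ k ] → F ≈ₚ E × suc n ≡ k
        unique ME irE d = let e = Q-unique irr MF irF ME irE r∣FQ d in e , deg-unique (deg-cong e (monic⇒deg MF)) (monic⇒deg ME)
        transform≈ : ∀ {k E} → Monic k E → Irreducible E → r ∣ E ^Q[ k ] → F ^Q[ suc n ] ≈ₚ E ^Q[ k ] × suc n ≡ k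
        transform≈ {E = E} ME irE d = let F≈E , n≡k = unique ME irE d in
          P.trans (hom-congᶠ (suc n) g h F≈E) (P.reflexive (≡.cong (E ^Q[_]) n≡k)) , n≡k
        free : ¬ Fixed m r
        free fixed = cases (fixed-cases Mr irr fixed)
          where
          cases : ¬ ((∃[ E ] Monic m E × Irreducible E × E ^Q[ m ] ≈ₚ r ^ s) ⊎
                     (∃₂ λ k E → m ≡ s ℕ.* k × Monic k E × Irreducible E × E ^Q[ k ] ≈ₚ r))
          cases (inj₂ (k , E , _ , ME , irE , e)) =
            let FQ≈ , _ = transform≈ ME irE (∣-respʳ (P.sym e) ∣-refl)
            in red (irr-cong (P.sym (P.trans FQ≈ e)) irr)
          cases (inj₁ (E , ME , irE , e)) =
            let FQ≈ , n≡m = transform≈ ME irE (∣-respʳ (P.sym e) (∣-*ʳ (r ^ s′) ∣-refl))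
            in unram (r , ≡.subst (λ k → Monic k r) (≡.sym n≡m) Mr , irr ,
                      ≡.subst (λ k → Fixed k r) (≡.sym n≡m) fixed , P.trans FQ≈ e)
        conclude : ∃[ E ] Monic m E × Irreducible E × norm m r ≃ E ^Q[ m ] →
                   ∃[ r ] Monic (suc n) r × Irreducible r × Good (suc n) r × ¬ Fixed (suc n) r × norm (suc n) r ≃ F ^Q[ suc n ]
        conclude (E , ME , irE , e) =
          let FQ≈ , n≡m = transform≈ ME irE (∣-trans (∣-*ʳ (prod s′ (it m r ∘ suc)) ∣-refl) (≃⇒∣ e))
          in ≡.subst (λ k → ∃[ r ] Monic k r × Irreducible r × Good k r × ¬ Fixed k r × norm k r ≃ F ^Q[ suc n ]) (≡.sym n≡m)
               (r , Mr , irr , good , free , ≃-trans e (≈⇒≃ (P.sym FQ≈)))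

-- Fixed points of a matrix, and square roots in characteristic 2.

injective⇒surjective : ∀ {a ℓ} {S : Setoid a ℓ} {k} → Enumeration S k → let open Setoid S in
                       (∀ x y → Dec (x ≈ y)) → (f : Carrier → Carrier) → (∀ {x y} → f x ≈ f y → x ≈ y) → ∀ y → ∃[ x ] f x ≈ y
injective⇒surjective {S = S} {k} E _≟_ f f-injective y with Finₚ.any? (λ i → f (Enumeration.at E i) ≟ y)
... | yes (i , e) = Enumeration.at E i , e
... | no ¬e = ⊥-elim (ℕₚ.<-irrefl ≡.refl (injection⇒≤ E extended injective))
  where
  open Setoid S
  extended : Fin (suc k) → Carrier
  extended Fin.zero    = y
  extended (Fin.suc i) = f (Enumeration.at E i)
  injective : ∀ {i j} → extended i ≈ extended j → i ≡ j
  injective {Fin.zero}  {Fin.zero}  _ = ≡.refl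
  injective {Fin.zero}  {Fin.suc j} e = ⊥-elim (¬e (j , sym e))
  injective {Fin.suc i} {Fin.zero}  e = ⊥-elim (¬e (i , e))
  injective {Fin.suc i} {Fin.suc j} e = ≡.cong Fin.suc (Enumeration.injective E (f-injective e))

module FixedPoints {c ℓ : Level} (𝔽 : FiniteField c ℓ) where
  open FiniteField 𝔽
  open OverFiniteField 𝔽
  open PolynomialRing 𝔽
  open Euclid 𝔽
  open Homogeneous 𝔽
  open Action 𝔽
  open RawMagmaDefs using (_,_)
  open NaturalSolver commutativeSemiring using (solve; con; _:+_; _:*_; _:=_)

  -- Calculation modulo z = 0: a semiring identity may carry multiples of z on both sides. With z =
  -- f + b it takes the place of subtraction.
  absorb : ∀ {z x w y y′} → z ≈ 0# → x + z * y ≈ w + z * y′ → x ≈ w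
  absorb {z} {x} {w} {y} {y′} z≈0 e = trans (sym (drop x y)) (trans e (drop w y′))
    where
    drop : ∀ x y → x + z * y ≈ x
    drop x y = trans (+-congˡ (trans (*-congʳ z≈0) (zeroˡ y))) (+-identityʳ x)

  ≈0-cancel : ∀ {x y} → ¬ (x ≈ 0#) → x * y ≈ 0# → y ≈ 0#
  ≈0-cancel {x} {y} nx e with y ≟ 0#
  ... | yes z = z
  ... | no nz = ⊥-elim (*-≉0 nx nz e)

  linear-* : ∀ a b c d → (b ∷ a ∷ []) *ₚ (d ∷ c ∷ []) ≈ₚ b * d ∷ b * c + a * d ∷ a * c ∷ []
  linear-* a b c d = ∷-cong (+-identityʳ _) (∷-cong (+-congˡ (+-identityʳ _)) P.refl)

  hom-quadratic : ∀ u v w g k → homogeneous 2 (u ∷ v ∷ w ∷ []) g k ≈ₚ u • (k *ₚ k) +ₚ (v • (g *ₚ k) +ₚ w • (g *ₚ g))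
  hom-quadratic u v w g k = P.trans (hom-suc 1 (u ∷ v ∷ w ∷ []) g k)
    (+ₚ-cong (•-cong refl (*ₚ-congˡ k (*ₚ-identityʳ k)))
      (P.trans (*ₚ-congˡ g (hom-linear v w g k))
      (P.trans (*ₚ-distribˡ g (v • k) (w • g)) (+ₚ-cong (*ₚ-• v g k) (*ₚ-• w g g)))))

  -- e = d − a and f = −b, so that the identities below hold in every commutative semiring.
  module _ {a b c d e f : Carrier} {δ : ¬ (a * d - b * c ≈ 0#)} (e+a≈d : e + a ≈ d) (f+b≈0 : f + b ≈ 0#) where
    private
      σ = mat a b c d δ

    Δ : Carrier
    Δ = a * d + f * c

    Δ≉0 : ¬ (Δ ≈ 0#)
    Δ≉0 z = δ (trans (+-congˡ -bc≈fc) z)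
      where
      open SetoidReasoning setoid
      -bc≈fc : - (b * c) ≈ f * c
      -bc≈fc = begin
        - (b * c)                       ≈⟨ +-identityˡ _ ⟨
        0# + - (b * c)                  ≈⟨ +-congʳ (trans (*-congʳ f+b≈0) (zeroˡ c)) ⟨
        (f + b) * c + - (b * c)         ≈⟨ +-congʳ (distribʳ c f b) ⟩
        (f * c + b * c) + - (b * c)     ≈⟨ +-assoc _ _ _ ⟩
        f * c + (b * c + - (b * c))     ≈⟨ +-congˡ (-‿inverseʳ _) ⟩
        f * c + 0#                      ≈⟨ +-identityʳ _ ⟩
        f * c                           ∎

    -- The binary quadratic form det(v, σ v), whose roots are the fixed points of σ.
    Φ : Poly
    Φ = f ∷ e ∷ c ∷ []

    -- The value at σv is det(σv, σ(σv)) = det σ · det(v, σv), and Δ is det σ because f = -b.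
    Φ-σ : act 2 Φ σ ≈ₚ Δ • Φ
    Φ-σ = P.trans (hom-quadratic f e c (b ∷ a ∷ []) (d ∷ c ∷ []))
      (P.trans (+ₚ-cong (•-cong refl (linear-* c d c d)) (+ₚ-cong (•-cong refl (linear-* a b c d)) (•-cong refl (linear-* a b a b))))
      (∷-cong constant (∷-cong linear (∷-cong quadratic P.refl))))
      where
      constant : f * (d * d) + (e * (b * d) + c * (b * b)) ≈ Δ * f
      constant = absorb f+b≈0 (trans (+-congʳ (+-cong (*-congˡ (*-congʳ (sym e+a≈d))) refl))
        (solve 6 (λ a b c d e f → f :* ((e :+ a) :* d) :+ (e :* (b :* d) :+ c :* (b :* b)) :+ (f :+ b) :* (f :* c)
                               := (a :* d :+ f :* c) :* f :+ (f :+ b) :* (b :* c :+ d :* e)) refl a b c d e f))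
      linear : f * (d * c + c * d) + (e * (b * c + a * d) + c * (b * a + a * b)) ≈ Δ * e
      linear = trans (+-congʳ (*-congˡ (+-cong (*-congʳ (sym e+a≈d)) (*-congˡ (sym e+a≈d)))))
        (absorb {y = 0#} f+b≈0
        (solve 6 (λ a b c d e f → (f :* ((e :+ a) :* c :+ c :* (e :+ a)) :+ (e :* (b :* c :+ a :* d) :+ c :* (b :* a :+ a :* b))) :+ (f :+ b) :* con 0
                               := (a :* d :+ f :* c) :* e :+ (f :+ b) :* (con 2 :* c :* a :+ c :* e)) refl a b c d e f))
      quadratic : f * (c * c) + (e * (a * c) + c * (a * a)) ≈ Δ * c
      quadratic = trans
        (solve 5 (λ a c d e f → f :* (c :* c) :+ (e :* (a :* c) :+ c :* (a :* a)) := (a :* (e :+ a) :+ f :* c) :* c) refl a c d e f)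
        (*-congʳ (+-congʳ (*-congˡ e+a≈d)))

    -- The root of g is a fixed point of σ, so g and its image have the same zero.
    root-fixed : ∀ {g} → Monic 1 g → g ∣ Φ → act 1 g σ ≃ g
    root-fixed {g} M (v , eq) = k , k≉0 , eq′
      where
      u = coeff g 0
      g≈ : g ≈ₚ u ∷ 1# ∷ []
      g≈ = P.trans (uncons g) (∷-cong refl (P.trans (uncons (tail g)) (∷-cong (trans (tail-coeff g 0) (lead≈1 M)) (below-0 (below-tail (below-tail (monic-below M)))))))
      -- The coefficient of x in (a x + b) + u (c x + d), the image of g = x + u.
      k = u * c + a
      v-below : Below 2 v
      v-below with deg? v
      ... | inj₁ z = below-cong (P.sym z) below-[]
      ... | inj₂ (m , dv) = below-mono (s≤s (ℕₚ.+-cancelʳ-≤ 1 m 1 (ℕₚ.≤-pred (deg-below (deg-* dv (monic⇒deg M))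
                              (below-cong (P.sym eq) (below-∷ f (below-∷ e (below-∷ c below-[])))))))) (below dv)
      v0 = coeff v 0
      v1 = coeff v 1
      v≈ : v ≈ₚ v0 ∷ v1 ∷ []
      v≈ = P.trans (uncons v) (∷-cong refl (P.trans (uncons (tail v)) (∷-cong (tail-coeff v 0) (below-0 (below-tail (below-tail v-below))))))
      vg≈ : v0 * u ∷ v0 * 1# + v1 * u ∷ v1 * 1# ∷ [] ≈ₚ Φ
      vg≈ = P.trans (P.sym (linear-* v1 v0 1# u)) (P.trans (*ₚ-cong (P.sym v≈) (P.sym g≈)) eq)
      f≈ : v0 * u ≈ f
      f≈ = coeff≈ vg≈ 0
      c≈ : v1 ≈ c
      c≈ = trans (sym (*-identityʳ v1)) (coeff≈ vg≈ 2)
      e≈ : e ≈ v0 + c * u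
      e≈ = trans (sym (coeff≈ vg≈ 1)) (+-cong (*-identityʳ v0) (*-congʳ c≈))
      constant : u * d + 1# * b ≈ k * u
      constant = trans (+-cong (*-congˡ (trans (sym e+a≈d) (+-congʳ e≈))) (*-identityˡ b)) (trans
        (solve 5 (λ a b c u v → u :* ((v :+ c :* u) :+ a) :+ b := (v :* u :+ b) :+ (u :* c :+ a) :* u) refl a b c u v0)
        (trans (+-congʳ (trans (+-congʳ f≈) f+b≈0)) (+-identityˡ _)))
      act≈ : act 1 g σ ≈ₚ u * d + 1# * b ∷ u * c + 1# * a ∷ []
      act≈ = P.trans (act-cong 1 σ g≈) (hom-linear u 1# (b ∷ a ∷ []) (d ∷ c ∷ []))
      eq″ : act 1 g σ ≈ₚ k • (u ∷ 1# ∷ [])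
      eq″ = P.trans act≈ (∷-cong constant (∷-cong (trans (+-congˡ (*-identityˡ a)) (sym (*-identityʳ _))) P.refl))
      eq′ : act 1 g σ ≈ₚ k • g
      eq′ = P.trans eq″ (•-cong refl (P.sym g≈))
      k≉0 : ¬ (k ≈ 0#)
      k≉0 z = act-≉0 1 σ (monic-below M) (deg⇒≉0 (monic⇒deg M)) (P.trans eq′ (•-zero g z))

    -- This situation arises for order 2 with h = h₀ + h₁ x. As a form of degree 2, h vanishes at ∞
    -- and at σ∞, points that an involution exchanges. An involution moving ∞ has trace 0 and square
    -- -Δ, so the natural eigenvalue of h is -Δ; that it is also Δ forces characteristic 2.
    module _ {h₀ h₁ : Carrier} (c≉0 : ¬ (c ≈ 0#)) (h≉0 : ¬ (h₀ ∷ h₁ ∷ [] ≈ₚ [])) (h-σ : act 2 (h₀ ∷ h₁ ∷ []) σ ≈ₚ Δ • (h₀ ∷ h₁ ∷ [])) where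
      private
        den = d ∷ c ∷ []
        X Y : Carrier
        X = h₀ * d + h₁ * b
        Y = h₀ * c + h₁ * a

        -- h₀ + h₁ x vanishes at ∞ as a form of degree 2, so its image is the denominator d + c x
        -- times the linear image X + Y x. The right-hand side has no term in x², whence Y = 0.
        coefficients : d * X ∷ d * Y + c * X ∷ c * Y ∷ [] ≈ₚ Δ • (h₀ ∷ h₁ ∷ [])
        coefficients = P.trans (P.sym (linear-* c d Y X))
          (P.trans (*ₚ-congˡ den (P.sym (hom-linear h₀ h₁ (b ∷ a ∷ []) den)))
          (P.trans (P.sym (hom-raise 1 (h₀ ∷ h₁ ∷ []) (b ∷ a ∷ []) den (below-linear h₁ h₀))) h-σ))

        Y≈0 : Y ≈ 0#
        Y≈0 = ≈0-cancel c≉0 (coeff≈ coefficients 2)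

        cX≈ : c * X ≈ Δ * h₁
        cX≈ = trans (sym (trans (+-congʳ (trans (*-congˡ Y≈0) (zeroʳ d))) (+-identityˡ _))) (coeff≈ coefficients 1)

        h₁≉0 : ¬ (h₁ ≈ 0#)
        h₁≉0 z = h≉0 (∷≈[] (≈0-cancel c≉0 (trans (*-comm c h₀) (trans (sym (trans (+-congˡ (trans (*-congʳ z) (zeroˡ a))) (+-identityʳ _))) Y≈0)))
                            (∷≈[] z P.refl))

      -- Expansion gives c X + h₁ Δ = d Y = 0, whereas c X = Δ h₁; so 2 h₁ Δ = 0.
      char-2 : 1# + 1# ≈ 0#
      char-2 = ≈0-cancel (*-≉0 h₁≉0 Δ≉0) (trans (*-distribˡ-1+1 (h₁ * Δ)) 2h₁Δ≈0)
        where
        *-distribˡ-1+1 : ∀ x → x * (1# + 1#) ≈ x + x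
        *-distribˡ-1+1 x = trans (distribˡ x 1# 1#) (+-cong (*-identityʳ x) (*-identityʳ x))
        2h₁Δ≈0 : h₁ * Δ + h₁ * Δ ≈ 0#
        2h₁Δ≈0 = begin
          h₁ * Δ + h₁ * Δ                     ≈⟨ +-cong (*-comm h₁ Δ) refl ⟩
          Δ * h₁ + h₁ * Δ                     ≈⟨ +-congʳ cX≈ ⟨
          c * X + h₁ * Δ                      ≈⟨ solve 7 (λ a b c d f h₀ h₁ →
              c :* (h₀ :* d :+ h₁ :* b) :+ h₁ :* (a :* d :+ f :* c) := (h₀ :* c :+ h₁ :* a) :* d :+ (f :+ b) :* (h₁ :* c)) refl a b c d f h₀ h₁ ⟩
          Y * d + (f + b) * (h₁ * c)          ≈⟨ +-cong (trans (*-congʳ Y≈0) (zeroˡ d)) (trans (*-congʳ f+b≈0) (zeroˡ _)) ⟩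
          0# + 0#                             ≈⟨ +-identityˡ 0# ⟩
          0#                                  ∎
          where open SetoidReasoning setoid

      trace≈0 : d + a ≈ 0#
      trace≈0 = ≈0-cancel (*-≉0 h₁≉0 Δ≉0) (begin
        h₁ * Δ * (d + a)                ≈⟨ solve 4 (λ h D d a → h :* D :* (d :+ a) := d :* (D :* h) :+ D :* (h :* a)) refl h₁ Δ d a ⟩
        d * (Δ * h₁) + Δ * (h₁ * a)     ≈⟨ +-congʳ (*-congˡ cX≈) ⟨
        d * (c * X) + Δ * (h₁ * a)      ≈⟨ solve 5 (λ c d X D t → d :* (c :* X) :+ D :* t := c :* (d :* X) :+ D :* t) refl c d X Δ (h₁ * a) ⟩
        c * (d * X) + Δ * (h₁ * a)      ≈⟨ +-congʳ (*-congˡ (coeff≈ coefficients 0)) ⟩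
        c * (Δ * h₀) + Δ * (h₁ * a)     ≈⟨ solve 5 (λ c D h k a → c :* (D :* h) :+ D :* (k :* a) := D :* (h :* c :+ k :* a)) refl c Δ h₀ h₁ a ⟩
        Δ * Y                           ≈⟨ trans (*-congˡ Y≈0) (zeroʳ Δ) ⟩
        0#                              ∎)
        where open SetoidReasoning setoid

      double : ∀ x → x + x ≈ 0#
      double x = trans (sym (+-cong (*-identityˡ x) (*-identityˡ x))) (trans (sym (distribʳ x 1# 1#)) (trans (*-congʳ char-2) (zeroˡ x)))

      e≈0 : e ≈ 0#
      e≈0 = begin
        e                ≈⟨ +-identityʳ e ⟨
        e + 0#           ≈⟨ +-congˡ (double a) ⟨
        e + (a + a)      ≈⟨ +-assoc e a a ⟨
        e + a + a        ≈⟨ +-congʳ e+a≈d ⟩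
        d + a            ≈⟨ trace≈0 ⟩
        0#               ∎
        where open SetoidReasoning setoid

      -- Here (x + y)² = x² + y², so squaring is injective, and on a finite field it is then
      -- surjective.
      square-root : ∀ y → ∃[ x ] x * x ≈ y
      square-root = injective⇒surjective (card⇒enumeration finite) _≟_ (λ x → x * x) injective
        where
        injective : ∀ {x y} → x * x ≈ y * y → x ≈ y
        injective {x} {y} eq = begin
          x                ≈⟨ +-identityʳ x ⟨
          x + 0#           ≈⟨ +-congˡ (double y) ⟨
          x + (y + y)      ≈⟨ +-assoc x y y ⟨
          x + y + y        ≈⟨ +-congʳ x+y≈0 ⟩
          0# + y           ≈⟨ +-identityˡ y ⟩
          y                ∎
          where
          open SetoidReasoning setoid
          square≈0 : (x + y) * (x + y) ≈ 0#
          square≈0 = begin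
            (x + y) * (x + y)                        ≈⟨ solve 2 (λ x y → (x :+ y) :* (x :+ y) := x :* x :+ y :* y :+ (x :* y :+ x :* y)) refl x y ⟩
            x * x + y * y + (x * y + x * y)          ≈⟨ +-cong (+-congʳ eq) (double (x * y)) ⟩
            y * y + y * y + 0#                       ≈⟨ +-identityʳ _ ⟩
            y * y + y * y                            ≈⟨ double (y * y) ⟩
            0#                                       ∎
          x+y≈0 : x + y ≈ 0#
          x+y≈0 with (x + y) ≟ 0#
          ... | yes z = z
          ... | no nz = ⊥-elim (*-≉0 nz nz square≈0)

      -- With e = 0 the form is c (x² + f/c) = c (x + w)², where w² = f/c.
      Φ≃square : ∃[ w ] Φ ≃ (w ∷ 1# ∷ []) *ₚ (w ∷ 1# ∷ [])
      Φ≃square =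
        let y , cy≈1 = inverse c c≉0
            w , w²≈ = square-root (f * y)
        in w , c , c≉0 , P.trans
          (∷-cong (trans (sym (*-identityʳ f)) (trans (*-congˡ (trans (sym cy≈1) (*-comm c y))) (trans (sym (*-assoc f y c)) (trans (*-comm _ c) (*-congˡ (sym w²≈))))))
          (∷-cong (trans e≈0 (sym (trans (*-congˡ (trans (+-cong (*-identityʳ w) (*-identityˡ w)) (double w))) (zeroʳ c))))
          (∷-cong (trans (sym (*-identityʳ c)) (*-congˡ (sym (*-identityˡ 1#)))) P.refl)))
          (•-cong refl (P.sym (linear-* 1# w 1# w)))

      Φ-reducible : ¬ Irreducible Φ
      Φ-reducible irr = absurd (Irreducible.split-∣1 (irr-≃ (proj₂ Φ≃square) irr) {L} {L} P.refl)
        where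
        L = proj₁ Φ≃square ∷ 1# ∷ []
        L∤1 : ¬ (L ∣ 1ₚ)
        L∤1 u = ℕₚ.0≢1+n (deg-unique (∣1⇒deg-0 u) (mkDeg 1≉0 (below-linear 1# (proj₁ Φ≃square))))
        absurd : ¬ (L ∣ 1ₚ ⊎ L ∣ 1ₚ)
        absurd (inj₁ u) = L∤1 u
        absurd (inj₂ u) = L∤1 u

-- Ramification forced by a moved point at infinity.

module Ramification {c ℓ : Level} (𝔽 : FiniteField c ℓ) (𝒬 : Setting.CyclicQuotient 𝔽) (s-prime : Prime (suc (Setting.CyclicQuotient.s′ 𝒬))) where
  open FiniteField 𝔽
  open OverFiniteField 𝔽
  open PolynomialRing 𝔽
  open Euclid 𝔽
  open Factorisation 𝔽
  open Homogeneous 𝔽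
  open Action 𝔽
  open Iteration 𝔽
  open Setting 𝔽
  open CyclicQuotient 𝒬
  open Norm 𝔽 𝒬
  open NormIsTransform 𝔽 𝒬
  open OrbitStructure 𝔽 𝒬
  open PrimeOrder s-prime
  open FixedPoints 𝔽
  open RawMagmaDefs using (_,_)

  -- By `fixed-cases` a fixed irreducible r is ramified unless r is itself the transform of a
  -- polynomial of degree deg r / s. For a linear factor s ∤ 1 excludes this; for an irreducible
  -- quadratic only s = 2 needs an argument.
  ∞-moved⇒ramified : ¬ (GL₂.c′ σ ≈ 0#) → ∃₂ λ n F → Monic n F × Irreducible F × TotallyRamified n F
  ∞-moved⇒ramified c≉0 = cases (normalise {2} {quadric} (mkDeg c≉0 (below-∷ f (below-linear (GL₂.c′ σ) e))))
    where
    e = GL₂.d σ - GL₂.a σ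
    f = - GL₂.b σ
    e+a≈d : e + GL₂.a σ ≈ GL₂.d σ
    e+a≈d = trans (+-assoc _ _ _) (trans (+-congˡ (-‿inverseˡ _)) (+-identityʳ _))
    f+b≈0 : f + GL₂.b σ ≈ 0#
    f+b≈0 = -‿inverseˡ _
    quadric : Poly
    quadric = f ∷ e ∷ GL₂.c′ σ ∷ []
    Δσ : Carrier
    Δσ = GL₂.a σ * GL₂.d σ + f * GL₂.c′ σ
    quadric-σ : act 2 quadric σ ≈ₚ Δσ • quadric
    quadric-σ = Φ-σ {δ = GL₂.det≉0 σ} e+a≈d f+b≈0

    -- 2 = s m leaves s = 2 and m = 1. Then Φ′ = F^Q has eigenvalue μ as a transform and Δ as the
    -- fixed-point form. So μ = Δ, and h, whose eigenvalue is μ, meets the hypotheses of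
    -- `Φ-reducible`.
    not-unramified : ∀ {Φ′ m F} → Monic 2 Φ′ → quadric ≃ Φ′ → Irreducible Φ′ → 2 ≡ s ℕ.* m → F ^Q[ m ] ≈ₚ Φ′ → ⊥
    not-unramified {m = zero} M _ irr 2≡s*m _ with ≡.trans 2≡s*m (ℕₚ.*-zeroʳ s)
    ... | ()
    not-unramified {m = suc (suc m)} M _ irr 2≡s*m _ =
      ℕₚ.<⇒≱ {2} {4} (s≤s (s≤s (s≤s z≤n))) (ℕₚ.≤-trans (ℕₚ.*-mono-≤ 1<s (s≤s (s≤s (z≤n {m})))) (ℕₚ.≤-reflexive (≡.sym 2≡s*m)))
    not-unramified {Φ′} {suc zero} {F} M quadric≃Φ′ irr 2≡s*1 FQ≈ =
      Φ-reducible {δ = GL₂.det≉0 σ} e+a≈d f+b≈0 c≉0 h≉0′ h-σ′ (irr-≃ (≃-sym quadric≃Φ′) irr)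
      where
      s≡2 : s ≡ 2
      s≡2 = ≡.sym (≡.trans 2≡s*1 (ℕₚ.*-identityʳ s))
      h≈ : h ≈ₚ coeff h 0 ∷ coeff h 1 ∷ []
      h≈ = P.trans (uncons h) (∷-cong refl (P.trans (uncons (tail h)) (∷-cong (tail-coeff h 0)
             (below-0 (below-tail (below-tail (≡.subst (λ k → Below k h) s≡2 h-below)))))))
      h≉0′ : ¬ (coeff h 0 ∷ coeff h 1 ∷ [] ≈ₚ [])
      h≉0′ z = h≉0 (P.trans h≈ z)
      μ-Φ′ : act 2 Φ′ σ ≈ₚ (μ * 1#) • Φ′
      μ-Φ′ = P.trans (act-cong 2 σ (P.sym FQ≈)) (P.trans (≡.subst (λ k → act k (F ^Q[ 1 ]) σ ≈ₚ (μ * 1#) • F ^Q[ 1 ])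
               (≡.trans (ℕₚ.*-identityˡ s) s≡2) (Q-σ-exact 1 F)) (•-cong refl FQ≈))
      Δ-Φ′ : act 2 Φ′ σ ≈ₚ Δσ • Φ′
      Δ-Φ′ = let l , _ , Φ′≈ = ≃-sym quadric≃Φ′ in
        P.trans (act-cong 2 σ Φ′≈) (P.trans (hom-• 2 l quadric (numerator σ) (denominator σ)) (P.trans (•-cong refl quadric-σ)
          (P.trans (P.sym (•-assoc l Δσ quadric)) (P.trans (•-cong (*-comm l Δσ) P.refl) (P.trans (•-assoc Δσ l quadric) (•-cong refl (P.sym Φ′≈)))))))
      lead : ∀ k → coeff (k • Φ′) 2 ≈ k
      lead k = trans (coeff-• k Φ′ 2) (trans (*-congˡ (lead≈1 M)) (*-identityʳ k))
      μ≈Δ : μ ≈ Δσ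
      μ≈Δ = trans (sym (*-identityʳ μ)) (trans (sym (lead (μ * 1#))) (trans (coeff≈ (P.trans (P.sym μ-Φ′) Δ-Φ′) 2) (lead Δσ)))
      h-σ′ : act 2 (coeff h 0 ∷ coeff h 1 ∷ []) σ ≈ₚ Δσ • (coeff h 0 ∷ coeff h 1 ∷ [])
      h-σ′ = P.trans (act-cong 2 σ (P.sym h≈)) (P.trans (≡.subst (λ k → act k h σ ≈ₚ μ • h) s≡2 h-σ) (•-cong μ≈Δ h≈))

    linear-case : ∀ {g} → Monic 1 g → Fixed 1 g → ∃₂ λ n F → Monic n F × Irreducible F × TotallyRamified n F
    linear-case {g} Mg fixed = from (fixed-cases Mg g-irr fixed)
      where
      g-irr : Irreducible g
      g-irr = no-properFactor⇒irr (monic⇒deg Mg) λ { (m , m<1 , 0<m , _) → ℕₚ.<⇒≱ m<1 0<m }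
      from : (∃[ F ] Monic 1 F × Irreducible F × F ^Q[ 1 ] ≈ₚ g ^ s) ⊎
             (∃₂ λ m F → 1 ≡ s ℕ.* m × Monic m F × Irreducible F × F ^Q[ m ] ≈ₚ g) →
             ∃₂ λ n F → Monic n F × Irreducible F × TotallyRamified n F
      from (inj₁ (F , MF , irF , e)) = 1 , F , MF , irF , g , Mg , g-irr , fixed , e
      from (inj₂ (m , _ , 1≡s*m , _)) = ⊥-elim (ℕₚ.<-irrefl (≡.sym (ℕₚ.m*n≡1⇒m≡1 s m (≡.sym 1≡s*m))) 1<s)

    quadratic-case : ∀ {Φ′} → Monic 2 Φ′ → quadric ≃ Φ′ → Irreducible Φ′ → ∃₂ λ n F → Monic n F × Irreducible F × TotallyRamified n F
    quadratic-case {Φ′} M quadric≃Φ′ irr = from (fixed-cases M irr fixed)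
      where
      fixed : Fixed 2 Φ′
      fixed = ≃-trans (act-≃ 2 σ (≃-sym quadric≃Φ′)) (≃-trans (Δσ , Δ≉0 {δ = GL₂.det≉0 σ} e+a≈d f+b≈0 , quadric-σ) quadric≃Φ′)
      from : (∃[ F ] Monic 2 F × Irreducible F × F ^Q[ 2 ] ≈ₚ Φ′ ^ s) ⊎
             (∃₂ λ m F → 2 ≡ s ℕ.* m × Monic m F × Irreducible F × F ^Q[ m ] ≈ₚ Φ′) →
             ∃₂ λ n F → Monic n F × Irreducible F × TotallyRamified n F
      from (inj₁ (F , MF , irF , e)) = 2 , F , MF , irF , Φ′ , M , irr , fixed , e
      from (inj₂ (m , F , 2≡s*m , _ , _ , e)) = ⊥-elim (not-unramified {Φ′} {m} {F} M quadric≃Φ′ irr 2≡s*m e)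

    cases : ∃[ Φ′ ] Monic 2 Φ′ × quadric ≃ Φ′ → ∃₂ λ n F → Monic n F × Irreducible F × TotallyRamified n F
    cases (Φ′ , M , quadric≃Φ′) with properFactor? 2 Φ′
    ... | no ¬p = quadratic-case M quadric≃Φ′ (no-properFactor⇒irr (monic⇒deg M) ¬p)
    ... | yes (suc zero , _ , _ , g , Mg , g∣Φ′) =
      linear-case Mg (root-fixed {δ = GL₂.det≉0 σ} e+a≈d f+b≈0 Mg (∣-trans g∣Φ′ (≃⇒∣ (≃-sym quadric≃Φ′))))
    ... | yes (suc (suc m) , s≤s (s≤s ()) , _)

-- Counting irreducible polynomials of a given degree.

product-enumeration : ∀ {a ℓ} {S : Setoid a ℓ} {m n} → let open Setoid S in
  (f : Fin m → Fin n → Carrier) → (∀ {i j k l} → f i j ≈ f k l → i ≡ k × j ≡ l) → (∀ x → ∃₂ λ i j → f i j ≈ x) →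
  Enumeration S (m ℕ.* n)
product-enumeration {S = S} {m} {n} f inj surj = record
  { at         = λ i → f (proj₁ (Fin.remQuot {m} n i)) (proj₂ (Fin.remQuot {m} n i))
  ; injective  = λ {i} {j} e → let e₁ , e₂ = inj e in
      ≡.trans (≡.sym (Finₚ.combine-remQuot {m} n i)) (≡.trans (≡.cong₂ Fin.combine e₁ e₂) (Finₚ.combine-remQuot {m} n j))
  ; surjective = λ x → let i , j , e = surj x in Fin.combine i j ,
      trans (reflexive (≡.cong (λ ij → f (proj₁ ij) (proj₂ ij)) (Finₚ.remQuot-combine {m} {n} i j))) e
  }
  where open Setoid S

empty-enumeration : ∀ {a ℓ} {S : Setoid a ℓ} → (Setoid.Carrier S → ⊥) → Enumeration S 0
empty-enumeration none = record { at = λ () ; injective = λ { {()} } ; surjective = λ x → ⊥-elim (none x) }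

module IrreducibleEnumeration {c ℓ : Level} (𝔽 : FiniteField c ℓ) where
  open FiniteField 𝔽
  open OverFiniteField 𝔽
  open Euclid 𝔽
  open Factorisation 𝔽

  monic-enumeration : ∀ n → Enumeration (Subset polySetoid (MonicOfDegree n)) (q ℕ.^ n)
  monic-enumeration n = record
    { at         = λ i → monics n i , fromMonic (monics-monic n i)
    ; injective  = monics-injective n
    ; surjective = λ { (f , M) → monics-surjective n (toMonic M) }
    }

  𝓘-enumeration : ∀ n → ∃[ k ] Enumeration (𝓘 n) k
  𝓘-enumeration n =
    let k , _ , _ , E , _ = partition (monic-enumeration n) (λ f → Irreducible (proj₁ f)) irr-cong
                              (λ { (f , M) → irreducible? (monic⇒deg (toMonic M)) })
    in k , record
      { at         = λ i → let (f , M) , irr = Enumeration.at E i in f , M , irr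
      ; injective  = Enumeration.injective E
      ; surjective = λ { (f , M , irr) → Enumeration.surjective E ((f , M) , irr) }
      }

module Counting {c ℓ : Level} (𝔽 : FiniteField c ℓ) (𝒬 : Setting.CyclicQuotient 𝔽) (s-prime : Prime (suc (Setting.CyclicQuotient.s′ 𝒬))) where
  open FiniteField 𝔽
  open OverFiniteField 𝔽 hiding (C; D; InC)
  open PolynomialRing 𝔽
  open Euclid 𝔽
  open Factorisation 𝔽
  open Homogeneous 𝔽
  open Action 𝔽
  open Iteration 𝔽
  open Setting 𝔽
  open CyclicQuotient 𝒬
  open Norm 𝔽 𝒬
  open NormIsTransform 𝔽 𝒬
  open OrbitStructure 𝔽 𝒬
  open PrimeOrder s-prime
  open IrreducibleEnumeration 𝔽
  open RawMagmaDefs using (_,_)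

  InC : ∀ n → Setoid.Carrier (𝓘 n) → Set (c ⊔ ℓ)
  InC n f = MonicIrreducible (s ℕ.* n) (proj₁ f ^Q[ n ])

  C D Free Fix : ℕ → Setoid (c ⊔ ℓ) ℓ
  C n    = Subset (𝓘 n) (InC n)
  D n    = Subset (𝓘 n) (λ f → ¬ InC n f)
  Fix n  = Subset (𝓘 n) (λ r → Fixed n (proj₁ r))
  Free n = Subset (𝓘 n) (λ r → ¬ Fixed n (proj₁ r))

  Q-monic′ : ∀ {n F} → Monic n F → Monic (s ℕ.* n) (F ^Q[ n ])
  Q-monic′ {n} {F} M = ≡.subst (λ k → Monic k (F ^Q[ n ])) (ℕₚ.*-comm n s) (Q-monic M)

  irr⇒InC : ∀ {n} (f : Setoid.Carrier (𝓘 n)) → Irreducible (proj₁ f ^Q[ n ]) → InC n f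
  irr⇒InC {n} (f , M , _) irr = fromMonic (Q-monic′ {n} {f} (toMonic M)) , irr

  InC-resp : ∀ n {f f′ : Setoid.Carrier (𝓘 n)} → proj₁ f ≈ₚ proj₁ f′ → InC n f → InC n f′
  InC-resp n {f} {f′} e (_ , irr) = irr⇒InC f′ (irr-cong (hom-congᶠ n g h e) irr)

  InC? : ∀ n f → Dec (InC n f)
  InC? n f@(F , M , _) = map′ (irr⇒InC f) proj₂ (irreducible? (Q-deg {n} {F} (monic⇒deg (toMonic M))))

  Fixed-resp : ∀ n {r r′} → r ≈ₚ r′ → Fixed n r → Fixed n r′
  Fixed-resp n e fixed = ≃-trans (≈⇒≃ (act-cong n σ (P.sym e))) (≃-trans fixed (≈⇒≃ e))

  Fixed? : ∀ {n r} → Monic n r → Dec (Fixed n r)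
  Fixed? {n} {r} M = map′ (λ e → k , k≉0 e , e) (λ { (l , _ , e) → P.trans e (•-cong (sym (l≈k l e)) P.refl) }) (act n r σ ≟ₚ (k • r))
    where
    -- As r is monic, this coefficient is the only candidate for the scalar.
    k = coeff (act n r σ) n
    k≉0 : act n r σ ≈ₚ k • r → ¬ (k ≈ 0#)
    k≉0 e z = act-≉0 n σ (monic-below M) (deg⇒≉0 (monic⇒deg M)) (P.trans e (•-zero r z))
    l≈k : ∀ l → act n r σ ≈ₚ l • r → k ≈ l
    l≈k l e = trans (coeff≈ e n) (trans (coeff-• l r n) (trans (*-congˡ (lead≈1 M)) (*-identityʳ l)))

  -- If the j-th translate is fixed, the remaining s - j steps do not move it, so it is r up to a
  -- scalar.
  fixed-return : ∀ {n r} j → Good n r → j ℕ.≤ s → Fixed n (it n r j) → Fixed n r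
  fixed-return {n} {r} j good j≤s fixed = ≃-trans (act-≃ n σ r≃) (≃-trans fixed (≃-sym r≃))
    where
    r≃ : r ≃ it n r j
    r≃ = ≃-trans (≃-sym (it-return n r j (below (good 0)) j≤s)) (it-≃0 n (s ℕ.∸ j) fixed)

  -- Both hypotheses are consequences of n > d(G): in degree n no irreducible is a pole and none
  -- ramifies totally.
  module _ {n : ℕ} (good : ∀ {r} → Monic n r → Irreducible r → Good n r) (unramified : ∀ {F} → Monic n F → Irreducible F → ¬ TotallyRamified n F) where

    record SplitsTo (F r : Poly) : Set (c ⊔ ℓ) where
      field
        r-irr   : Irreducible r
        r-good  : Good n r
        r-free  : ¬ Fixed n r
        r-norm  : norm n r ≃ F ^Q[ n ]

    splits : (f : Setoid.Carrier (D n)) → ∃[ r ] SplitsTo (proj₁ (proj₁ f)) r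
    splits (f@(F , M , irr) , red) =
      let r , _ , r-irr , r-good , r-free , r-norm = split-transform (toMonic M) irr (red ∘ irr⇒InC f) (unramified (toMonic M) irr)
      in r , record { r-irr = r-irr ; r-good = r-good ; r-free = r-free ; r-norm = r-norm }

    conjugate : ∀ {F r} → SplitsTo F r → ∀ j → j ℕ.≤ s → Σ (Setoid.Carrier (Free n)) λ t → it n r j ≃ proj₁ (proj₁ t)
    conjugate {F} {r} S j j≤s =
      let t , Mt , e = normalise (r-good j)
      in ((t , fromMonic Mt , irr-≃ e (it-irreducible j r-irr r-good)) ,
          λ fixed → r-free (fixed-return j r-good j≤s (≃-trans (act-≃ n σ e) (≃-trans fixed (≃-sym e))))) , e
      where open SplitsTo S

    conjugate-∣ : ∀ {F r t} → SplitsTo F r → ∀ {j} → j ℕ.< s → it n r j ≃ t → t ∣ F ^Q[ n ]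
    conjugate-∣ {F} {r} S j<s it≃t = ∣-trans (≃⇒∣ (≃-sym it≃t)) (∣-trans (∣-prod {s} {it n r} j<s) (≃⇒∣ (SplitsTo.r-norm S)))

    conjugate-injective : ∀ {F r} → SplitsTo F r → ∀ {i j} → i ℕ.< s → j ℕ.< s → it n r i ≃ it n r j → i ≡ j
    conjugate-injective S {i} {j} i<s j<s e = cases (ℕₚ.<-cmp i j)
      where
      open SplitsTo S
      cases : Tri (i ℕ.< j) (i ≡ j) (j ℕ.< i) → i ≡ j
      cases (tri≈ _ i≡j _) = i≡j
      cases (tri< i<j _ _) = ⊥-elim (r-free (orbit-distinct i j (below (r-good 0)) i<j j<s e))
      cases (tri> _ _ j<i) = ⊥-elim (r-free (orbit-distinct j i (below (r-good 0)) j<i i<s (≃-sym e)))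

    -- The pair (i, j) names the j-th translate of a chosen factor `ρ i` of the i-th transform.
    -- `Q-unique` recovers i and freeness recovers j. A free r is reached through the irreducible
    -- below it: the norms of r and of some `ρ i` are associated with the same transform, so r is a
    -- conjugate of `ρ i`.
    conjugates-enumerate : ∀ {k} (E : Enumeration (D n) k) → let F = λ i → proj₁ (proj₁ (Enumeration.at E i)) in
      (ρ : Fin k → Poly) → (∀ i → SplitsTo (F i) (ρ i)) →
      (∀ i (j : Fin s) → Σ (Setoid.Carrier (Free n)) λ t → it n (ρ i) (toℕ j) ≃ proj₁ (proj₁ t)) →
      Enumeration (Free n) (k ℕ.* s)
    conjugates-enumerate {k} E ρ ρ-splits element = product-enumeration {S = Free n} (λ i j → proj₁ (element i j)) (λ {i} {j} {i′} {j′} → injective {i} {j} {i′} {j′}) surjective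
      where
      F : Fin k → Poly
      F i = proj₁ (proj₁ (Enumeration.at E i))
      F-monic : ∀ i → Monic n (F i)
      F-monic i = toMonic (proj₁ (proj₂ (proj₁ (Enumeration.at E i))))
      F-irr : ∀ i → Irreducible (F i)
      F-irr i = proj₂ (proj₂ (proj₁ (Enumeration.at E i)))
      injective : ∀ {i j i′ j′} → proj₁ (proj₁ (proj₁ (element i j))) ≈ₚ proj₁ (proj₁ (proj₁ (element i′ j′))) → i ≡ i′ × j ≡ j′
      injective {i} {j} {i′} {j′} e = both i≡i′ e
        where
        t = proj₁ (proj₁ (proj₁ (element i j)))
        t-irr : Irreducible t
        t-irr = proj₂ (proj₂ (proj₁ (proj₁ (element i j))))
        i≡i′ : i ≡ i′
        i≡i′ = Enumeration.injective E (Q-unique t-irr (F-monic i) (F-irr i) (F-monic i′) (F-irr i′)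
          (conjugate-∣ (ρ-splits i) (Finₚ.toℕ<n j) (proj₂ (element i j)))
          (conjugate-∣ (ρ-splits i′) (Finₚ.toℕ<n j′) (≃-trans (proj₂ (element i′ j′)) (≈⇒≃ (P.sym e)))))
        both : ∀ {i′} → i ≡ i′ → t ≈ₚ proj₁ (proj₁ (proj₁ (element i′ j′))) → i ≡ i′ × j ≡ j′
        both ≡.refl e = ≡.refl , Finₚ.toℕ-injective (conjugate-injective (ρ-splits i) (Finₚ.toℕ<n j) (Finₚ.toℕ<n j′)
          (≃-trans (proj₂ (element i j)) (≃-trans (≈⇒≃ e) (≃-sym (proj₂ (element i j′))))))
      surjective : (t : Setoid.Carrier (Free n)) → ∃₂ λ i j → proj₁ (proj₁ (proj₁ (element i j))) ≈ₚ proj₁ (proj₁ t)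
      surjective ((r , M , irr) , free) = locate (free-below irr r-good free)
        where
        r-good : Good n r
        r-good = good (toMonic M) irr
        at-position : ∀ i j → r ∣ it n (ρ i) (toℕ j) → proj₁ (proj₁ (proj₁ (element i j))) ≈ₚ r
        at-position i j r∣it = ≃-monic (toMonic (proj₁ (proj₂ (proj₁ (proj₁ (element i j)))))) (toMonic M)
          (≃-trans (≃-sym (proj₂ (element i j))) (≃-sym (irr-∣-irr irr (it-irreducible (toℕ j) (SplitsTo.r-irr (ρ-splits i)) (SplitsTo.r-good (ρ-splits i))) r∣it)))
        in-orbit : ∀ i → norm n r ≃ F i ^Q[ n ] → ∃₂ λ i j → proj₁ (proj₁ (proj₁ (element i j))) ≈ₚ r
        in-orbit i e =
          let r∣norm = ∣-trans (∣-prod {s} {it n r} {0} (s≤s z≤n)) (≃⇒∣ (≃-trans e (≃-sym (SplitsTo.r-norm (ρ-splits i)))))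
              j , j<s , r∣it = euclid-prod s (it n (ρ i)) irr r∣norm
          in i , Fin.fromℕ< j<s , at-position i (Fin.fromℕ< j<s)
                                    (≡.subst (λ j → r ∣ it n (ρ i) j) (≡.sym (Finₚ.toℕ-fromℕ< j<s)) r∣it)
        locate : ∃[ E′ ] Monic n E′ × Irreducible E′ × norm n r ≃ E′ ^Q[ n ] →
                 ∃₂ λ i j → proj₁ (proj₁ (proj₁ (element i j))) ≈ₚ r
        locate (E′ , ME , irE , norm≃) =
          let i , Fi≈E = Enumeration.surjective E ((E′ , fromMonic ME , irE) , reducible)
          in in-orbit i (≃-trans norm≃ (≈⇒≃ (hom-congᶠ n g h (P.sym Fi≈E))))
          where
          reducible : ¬ InC n (E′ , fromMonic ME , irE)
          reducible inC = reducible-transform {n} {r} {E′} r-good (irr-deg>0 irr (r-good 0)) norm≃ (proj₂ inC)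

    free-enumeration : ∀ {k} → Enumeration (D n) k → Enumeration (Free n) (k ℕ.* s)
    free-enumeration E = conjugates-enumerate E (λ i → proj₁ (splits (Enumeration.at E i))) (λ i → proj₂ (splits (Enumeration.at E i)))
      λ i j → conjugate (proj₂ (splits (Enumeration.at E i))) (toℕ j) (ℕₚ.<⇒≤ (Finₚ.toℕ<n j))

    fixed-descends : ∀ {r} → Monic n r → Irreducible r → Fixed n r →
                     ∃₂ λ m F → n ≡ s ℕ.* m × Monic m F × Irreducible F × F ^Q[ m ] ≈ₚ r
    fixed-descends {r} M irr fixed = cases (fixed-cases M irr fixed)
      where
      cases : (∃[ F ] Monic n F × Irreducible F × F ^Q[ n ] ≈ₚ r ^ s) ⊎
              (∃₂ λ m F → n ≡ s ℕ.* m × Monic m F × Irreducible F × F ^Q[ m ] ≈ₚ r) →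
              ∃₂ λ m F → n ≡ s ℕ.* m × Monic m F × Irreducible F × F ^Q[ m ] ≈ₚ r
      cases (inj₁ (F , MF , irF , e)) = ⊥-elim (unramified MF irF (r , M , irr , fixed , e))
      cases (inj₂ x) = x

    fix-enumeration-none : ¬ (s ℕ∣.∣ n) → Enumeration (Fix n) 0
    fix-enumeration-none s∤n = empty-enumeration {S = Fix n} λ { ((r , M , irr) , fixed) →
      let m , _ , n≡s*m , _ = fixed-descends (toMonic M) irr fixed in s∤n (ℕ∣.divides m (≡.trans n≡s*m (ℕₚ.*-comm s m))) }

    -- Transforms are eigenforms, hence fixed. Conversely `fixed-descends` writes a fixed r as F^Q
    -- with deg F = n / s, and F lies in C(Q, m) because r is irreducible.
    fix-enumeration : ∀ m {k} → n ≡ m ℕ.* s → Enumeration (C m) k → Enumeration (Fix n) k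
    fix-enumeration m {k} n≡ E = record { at = element ; injective = λ {i} {j} → injective {i} {j} ; surjective = surjective }
      where
      F : Fin k → Poly
      F i = proj₁ (proj₁ (Enumeration.at E i))
      F-monic : ∀ i → Monic m (F i)
      F-monic i = toMonic (proj₁ (proj₂ (proj₁ (Enumeration.at E i))))
      F-irr : ∀ i → Irreducible (F i)
      F-irr i = proj₂ (proj₂ (proj₁ (Enumeration.at E i)))
      FQ-irr : ∀ i → Irreducible (F i ^Q[ m ])
      FQ-irr i = proj₂ (proj₂ (Enumeration.at E i))
      element : Fin k → Setoid.Carrier (Fix n)
      element i = (F i ^Q[ m ] , fromMonic (≡.subst (λ k → Monic k (F i ^Q[ m ])) (≡.sym n≡) (Q-monic (F-monic i))) , FQ-irr i) ,
        ≡.subst (λ k → Fixed k (F i ^Q[ m ])) (≡.sym n≡) (Q-σ m (F i))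
      injective : ∀ {i j} → F i ^Q[ m ] ≈ₚ F j ^Q[ m ] → i ≡ j
      injective {i} {j} e = Enumeration.injective E
        (Q-unique (FQ-irr i) (F-monic i) (F-irr i) (F-monic j) (F-irr j) ∣-refl (∣-respʳ e ∣-refl))
      surjective : (t : Setoid.Carrier (Fix n)) → ∃[ i ] F i ^Q[ m ] ≈ₚ proj₁ (proj₁ t)
      surjective ((r , M , irr) , fixed) = locate (fixed-descends (toMonic M) irr fixed)
        where
        locate : ∃₂ (λ m′ F → n ≡ s ℕ.* m′ × Monic m′ F × Irreducible F × F ^Q[ m′ ] ≈ₚ r) → ∃[ i ] F i ^Q[ m ] ≈ₚ r
        locate (m′ , E′ , n≡′ , ME , irE , e) = found (ℕₚ.*-cancelʳ-≡ m′ m s (≡.trans (ℕₚ.*-comm m′ s) (≡.trans (≡.sym n≡′) n≡))) ME e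
          where
          found : ∀ {m′} → m′ ≡ m → Monic m′ E′ → E′ ^Q[ m′ ] ≈ₚ r → ∃[ i ] F i ^Q[ m ] ≈ₚ r
          found ≡.refl ME e =
            let f = E′ , fromMonic ME , irE
                i , Fi≈E = Enumeration.surjective E (f , irr⇒InC f (irr-cong (P.sym e) irr))
            in i , P.trans (hom-congᶠ m g h Fi≈E) e

    C-enumeration : ∀ m → ∃[ k ] Enumeration (C m) k
    C-enumeration m = let _ , E = 𝓘-enumeration m
                          k , _ , _ , EC , _ = partition E (InC m) (λ {f} {f′} → InC-resp m {f} {f′}) (InC? m)
                      in k , EC

    count : ∃₂ λ a b → Enumeration (C n) a × Enumeration (D n) b ×
            (¬ (s ℕ∣.∣ n) → a ℕ.+ b ≡ b ℕ.* s) ×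
            (∀ m → n ≡ m ℕ.* s → ∃[ e ] Enumeration (C m) e × a ℕ.+ b ≡ e ℕ.+ b ℕ.* s)
    count =
      let N , E = 𝓘-enumeration n
          a , b , a+b≡N , EC , ED = partition E (InC n) (λ {f} {f′} → InC-resp n {f} {f′}) (InC? n)
          x , y , x+y≡N , EX , EY = partition E (λ r → Fixed n (proj₁ r)) (Fixed-resp n) (λ { (r , M , _) → Fixed? (toMonic M) })
          y≡bs = card-unique EY (free-enumeration ED)
          total = ≡.trans a+b≡N (≡.sym x+y≡N)
      in a , b , EC , ED ,
         (λ s∤n → ≡.trans total (≡.cong₂ ℕ._+_ (card-unique EX (fix-enumeration-none s∤n)) y≡bs)) ,
         (λ m n≡ → let e , Em = C-enumeration m
                   in e , Em , ≡.trans total (≡.cong₂ ℕ._+_ (card-unique EX (fix-enumeration m n≡ Em)) y≡bs))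

-- Serves to pass between `order` and `suc (pred order)`, which are only propositionally equal.
subset-enumeration : ∀ {a ℓ p r} {S : Setoid a ℓ} {P : Pred (Setoid.Carrier S) p} {R : Pred (Setoid.Carrier S) r} {k} →
  (∀ x → P x → R x) → (∀ x → R x → P x) → Enumeration (Subset S P) k → Enumeration (Subset S R) k
subset-enumeration to from E = record
  { at         = λ i → proj₁ (at i) , to (proj₁ (at i)) (proj₂ (at i))
  ; injective  = injective
  ; surjective = λ { (x , r) → surjective (x , from x r) }
  }
  where open Enumeration E

-- From the subgroup and its quotient map to the abstract data.

module FromSubgroup {c ℓ p : Level} (𝔽 : FiniteField c ℓ) (G : FiniteSubgroup (OverFiniteField.PGL₂ 𝔽) p) (cyclic : IsCyclic (OverFiniteField.PGL₂ 𝔽) G) (order-prime : Prime (FiniteSubgroup.order G)) (Q : OverFiniteField.QuotientMap 𝔽 G) where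
  open FiniteField 𝔽
  open OverFiniteField 𝔽
  open PolynomialRing 𝔽
  open Euclid 𝔽
  open Homogeneous 𝔽
  open Action 𝔽
  open Iteration 𝔽
  open Setting 𝔽
  open FiniteSubgroup G using (Member; order)
  open QuotientMap Q using (g; h; h≉0; coprime; monic; deg-h<; fixedField)
  open RawMagmaDefs using (_,_)
  open RawSemiringDefs (Semiring.rawSemiring semiring) using () renaming (_^_ to _^ᶠ_)
  open RawMonoidDefs (Group.rawMonoid PGL₂) using () renaming (_×_ to infixr 8 _⋆_)
  open NaturalSolver R.commutativeSemiring using (solve; _:*_; _:=_)

  σ : GL₂
  σ = proj₁ cyclic

  private
    generated : ((order ⋆ σ) ∼ I₂) × (∀ A → Member A → ∃[ i ] i ℕ.< order × A ∼ (i ⋆ σ))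
    generated = CyclicSubgroup.generator-power PGL₂ G {σ} (proj₁ (proj₂ cyclic)) (proj₂ (proj₂ cyclic))

  -- `⋆` adds the new factor on the left and `iter` on the right; `iter-+` with a first step of one
  -- iterate reconciles the two.
  act-⋆ : ∀ n f i → Below (suc n) f → act n f (i ⋆ σ) ≈ₚ iter σ n f i
  act-⋆ n f zero    b = act-I n f b
  act-⋆ n f (suc i) b = P.trans (P.sym (act-comp n f σ (i ⋆ σ)))
    (P.trans (act-⋆ n (act n f σ) i (act-below n f σ))
             (P.reflexive (≡.trans (iter-+ σ n f 1 i) (≡.cong (iter σ n f) (ℕₚ.+-comm i 1)))))

  κ : ℕ → Carrier
  κ n = _∼_.k (proj₁ generated) ^ᶠ n

  κ≉0 : ∀ n → ¬ (κ n ≈ 0#)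
  κ≉0 n = ^ᶠ-≉0 n (_∼_.k≉0 (proj₁ generated))

  iter-order : ∀ n f → Below (suc n) f → iter σ n f order ≈ₚ κ n • f
  iter-order n f b = P.trans (P.sym (act-⋆ n f order b))
    (P.trans (act-∼ n f (proj₁ generated)) (•-cong refl (act-I n f b)))

  iter-eigen : ∀ n {k} → ¬ (k ≈ 0#) → ∀ i → ∃[ l ] ¬ (l ≈ 0#) × (∀ f → act n f σ ≈ₚ k • f → iter σ n f i ≈ₚ l • f)
  iter-eigen n nk zero = 1# , 1≉0 , λ f _ → P.sym (•-identity f)
  iter-eigen n {k} nk (suc i) =
    let l , nl , eigen = iter-eigen n nk i
    in l * k , *-≉0 nl nk , λ f e → P.trans (act-cong n σ (eigen f e))
         (P.trans (hom-• n l f (numerator σ) (denominator σ)) (P.trans (•-cong refl e) (P.sym (•-assoc l k f))))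

  -- The scalar is chosen before the form, so numerator and denominator of a function are multiplied
  -- by the same one.
  member-eigen : ∀ n {k} → ¬ (k ≈ 0#) → ∀ A → Member A →
                 ∃[ l ] ¬ (l ≈ 0#) × (∀ f → Below (suc n) f → act n f σ ≈ₚ k • f → act n f A ≈ₚ l • f)
  member-eigen n nk A A∈ =
    let i , _ , A∼ = proj₂ generated A A∈
        l , nl , eigen = iter-eigen n nk i
        m = _∼_.k A∼ ^ᶠ n
    in m * l , *-≉0 (^ᶠ-≉0 n (_∼_.k≉0 A∼)) nl , λ f b e → P.trans (act-∼ n f A∼)
         (P.trans (•-cong refl (P.trans (act-⋆ n f i b) (eigen f e))) (P.sym (•-assoc m l f)))

  -- IsComposite clears denominators with the list lengths, whereas forms have a fixed degree.
  change-degree : ∀ {M N} A num den → Below (suc M) num → Below (suc N) num → Below (suc M) den → Below (suc N) den →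
                  num *ₚ act M den A ≈ₚ act M num A *ₚ den → num *ₚ act N den A ≈ₚ act N num A *ₚ den
  change-degree {M} {N} A num den bM bN cM cN e = *ₚ-cancelˡ (Δ ^ M) (^-≉0 M (denominator-≉0 A)) (begin
      Δ ^ M *ₚ (num *ₚ act N den A)      ≈⟨ solve 3 (λ d x y → d :* (x :* y) := x :* (d :* y)) P.refl (Δ ^ M) num (act N den A) ⟩
      num *ₚ (Δ ^ M *ₚ act N den A)      ≈⟨ *ₚ-congˡ num (hom-change-degree den (numerator A) Δ cM cN) ⟩
      num *ₚ (Δ ^ N *ₚ act M den A)      ≈⟨ solve 3 (λ d x y → x :* (d :* y) := d :* (x :* y)) P.refl (Δ ^ N) num (act M den A) ⟩
      Δ ^ N *ₚ (num *ₚ act M den A)      ≈⟨ *ₚ-congˡ (Δ ^ N) e ⟩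
      Δ ^ N *ₚ (act M num A *ₚ den)      ≈⟨ *ₚ-assoc (Δ ^ N) (act M num A) den ⟨
      Δ ^ N *ₚ act M num A *ₚ den        ≈⟨ *ₚ-congʳ den (hom-change-degree num (numerator A) Δ bM bN) ⟨
      Δ ^ M *ₚ act N num A *ₚ den        ≈⟨ *ₚ-assoc (Δ ^ M) (act N num A) den ⟩
      Δ ^ M *ₚ (act N num A *ₚ den)      ∎)
    where
    open SetoidReasoning polySetoid
    Δ = denominator A

  bound : Poly → Poly → ℕ
  bound num den = length num ℕ.⊔ length den

  bound-num : ∀ num den → Below (suc (bound num den)) num
  bound-num num den = below-mono (ℕₚ.≤-trans (ℕₚ.m≤m⊔n (length num) (length den)) (ℕₚ.n≤1+n _)) (below-length num)

  bound-den : ∀ num den → Below (suc (bound num den)) den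
  bound-den num den = below-mono (ℕₚ.≤-trans (ℕₚ.m≤n⊔m (length num) (length den)) (ℕₚ.n≤1+n _)) (below-length den)

  eigen⇒invariant : ∀ n k num den (den≉0 : ¬ (den ≈ₚ [])) → Below (suc n) num → Below (suc n) den → ¬ (k ≈ 0#) →
                    act n num σ ≈ₚ k • num → act n den σ ≈ₚ k • den →
                    Invariant G (record { num = num ; den = den ; den≉0 = den≉0 })
  eigen⇒invariant n k num den den≉0 bn bd nk en ed A A∈ =
    act-≉0 (bound num den) A (bound-den num den) den≉0 ,
    change-degree A num den bn (bound-num num den) bd (bound-den num den)
      (let l , _ , eigen = member-eigen n nk A A∈
       in P.trans (*ₚ-congˡ num (eigen den bd ed)) (P.trans (*ₚ-• l num den)
            (P.trans (P.sym (•-*ₚ l num den)) (*ₚ-congʳ den (P.sym (eigen num bn en))))))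

  Q-function : RatFunc
  Q-function = QuotientMap.Q Q

  Q-invariant : Invariant G Q-function
  Q-invariant = Equivalence.from (fixedField Q-function) (identity ,
      -- Q is the value at Q of the function x; the exponent 2 is the nominal degree in
      -- `IsComposite`, the length of the coefficient list of x.
      (λ z → ^-≉0 2 h≉0 (P.trans (P.sym (hom-1 2 g h)) z)) ,
      (begin
        g *ₚ homogeneous 2 1ₚ g h                 ≈⟨ *ₚ-congˡ g (hom-1 2 g h) ⟩
        g *ₚ (h *ₚ (h *ₚ 1ₚ))                     ≈⟨ solve 3 (λ g h o → g :* (h :* (h :* o)) := g :* (h :* o) :* h) P.refl g h 1ₚ ⟩
        g *ₚ (h *ₚ 1ₚ) *ₚ h                       ≈⟨ *ₚ-congʳ h (*ₚ-congˡ g (hom-1 1 g h)) ⟨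
        g *ₚ homogeneous 1 1ₚ g h *ₚ h            ≈⟨ *ₚ-congʳ h (hom-0∷ 1 1ₚ g h) ⟨
        homogeneous 2 (0# ∷ 1ₚ) g h *ₚ h          ∎))
    where
    open SetoidReasoning polySetoid
    identity : RatFunc
    identity = record { num = 0# ∷ 1ₚ ; den = 1ₚ ; den≉0 = deg⇒≉0 deg-1 }

  g-monic : Monic order g
  g-monic = toMonic monic

  h-below : Below order h
  h-below = mkBelow deg-h<

  σ-equation : g *ₚ act order h σ ≈ₚ act order g σ *ₚ h
  σ-equation = change-degree σ g h (bound-num g h) (monic-below g-monic) (bound-den g h) (below-mono (ℕₚ.n≤1+n order) h-below)
    (proj₂ (Q-invariant σ (proj₁ (proj₂ cyclic))))

  -- Invariance of Q reads g (h∘σ) = (g∘σ) h. As g is coprime to h, it divides g∘σ, whose degree is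
  -- at most that of g; so g∘σ = μ g, and cancelling g yields the same μ for h.
  eigenvalue : ∃[ μ ] ¬ (μ ≈ 0#) × act order g σ ≈ₚ μ • g × act order h σ ≈ₚ μ • h
  eigenvalue = from (cofactor (monic⇒deg g-monic) gσ-deg g∣gσ)
    where
    gσ = act order g σ
    gσ≉0 : ¬ (gσ ≈ₚ [])
    gσ≉0 = act-≉0 order σ (monic-below g-monic) (deg⇒≉0 (monic⇒deg g-monic))
    g∣gσ : g ∣ gσ
    g∣gσ = coprime-∣ g h gσ coprime (act order h σ , P.trans (*ₚ-comm (act order h σ) g) (P.trans σ-equation (*ₚ-comm gσ h)))
    degree = ≉0⇒deg gσ≉0
    gσ-deg : Deg order gσ
    gσ-deg = ≡.subst (λ k → Deg k gσ) (ℕₚ.≤-antisym (ℕₚ.≤-pred (deg-below (proj₂ degree) (act-below order g σ)))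
                                         (∣⇒deg-≤ (monic⇒deg g-monic) (proj₂ degree) g∣gσ)) (proj₂ degree)
    from : ∃₂ (λ k w → order ≡ k ℕ.+ order × Deg k w × w *ₚ g ≈ₚ gσ) →
           ∃[ μ ] ¬ (μ ≈ 0#) × gσ ≈ₚ μ • g × act order h σ ≈ₚ μ • h
    from (k , w , order≡k+order , dw , e) = μ , lead≉0 d0 , gσ≈ ,
      *ₚ-cancelˡ g (deg⇒≉0 (monic⇒deg g-monic)) (P.trans σ-equation (P.trans (*ₚ-congʳ h gσ≈)
        (P.trans (•-*ₚ μ g h) (P.sym (*ₚ-• μ g h)))))
      where
      d0 : Deg 0 w
      d0 = ≡.subst (λ k → Deg k w) (ℕₚ.+-cancelʳ-≡ order k 0 (≡.sym order≡k+order)) dw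
      μ = coeff w 0
      gσ≈ : gσ ≈ₚ μ • g
      gσ≈ = P.trans (P.sym e) (P.trans (*ₚ-congʳ g (deg-0⇒const d0)) (P.sym (•-as-* μ g)))

  order≡ : order ≡ suc (ℕ.pred order)
  order≡ = ≡.sym (ℕₚ.suc-pred order {{prime⇒nonZero order-prime}})

  𝒬 : CyclicQuotient
  𝒬 = record
    { s′      = ℕ.pred order
    ; σ       = σ
    ; κ       = κ
    ; κ≉0     = κ≉0
    ; period  = λ n f b → ≡.subst (λ k → iter σ n f k ≈ₚ κ n • f) order≡ (iter-order n f b)
    ; g       = g
    ; h       = h
    ; g-monic = ≡.subst (λ k → Monic k g) order≡ g-monic
    ; h-below = ≡.subst (λ k → Below k h) order≡ h-below
    ; coprime = coprime
    ; μ       = proj₁ eigenvalue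
    ; μ≉0     = proj₁ (proj₂ eigenvalue)
    ; g-σ     = ≡.subst (λ k → act k g σ ≈ₚ proj₁ eigenvalue • g) order≡ (proj₁ (proj₂ (proj₂ eigenvalue)))
    ; h-σ     = ≡.subst (λ k → act k h σ ≈ₚ proj₁ eigenvalue • h) order≡ (proj₂ (proj₂ (proj₂ eigenvalue)))
    ; descend = λ n k num den bn bd den≉0 nk en ed →
        let T , nonzero , e = Equivalence.to (fixedField (record { num = num ; den = den ; den≉0 = den≉0 }))
                                (eigen⇒invariant n k num den den≉0 bn bd nk en ed)
            u = RatFunc.num T
            v = RatFunc.den T
        in bound u v , u , v , bound-num u v , bound-den u v , nonzero , e
    }

-- The bound by d(G) and the final count.

+-cancel-ℤ : ∀ x y → + (x ℕ.+ y) ℤ.- + y ≡ + x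
+-cancel-ℤ x y = ≡.trans (≡.cong (ℤ._- + y) (ℤₚ.pos-+ x y))
  (≡.trans (ℤₚ.+-assoc (+ x) (+ y) (ℤ.- + y)) (≡.trans (≡.cong (λ z → + x ℤ.+ z) (ℤₚ.+-inverseʳ (+ y))) (ℤₚ.+-identityʳ (+ x))))

difference : ∀ {a b e} s → s ≡ suc (ℕ.pred s) → a ℕ.+ b ≡ e ℕ.+ b ℕ.* s → + a ℤ.- (+ s ℤ.- ℤ.1ℤ) ℤ.* + b ≡ + e
difference {a} {b} {e} (suc s) _ eq = ≡.trans (≡.cong₂ (λ x y → + x ℤ.- y) a≡ (≡.sym (ℤₚ.pos-* s b))) (+-cancel-ℤ e (s ℕ.* b))
  where
  a≡ : a ≡ e ℕ.+ s ℕ.* b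
  a≡ = ℕₚ.+-cancelʳ-≡ b a (e ℕ.+ s ℕ.* b) (≡.trans eq (≡.trans (≡.cong (e ℕ.+_) (≡.trans (ℕₚ.*-comm b (suc s)) (ℕₚ.+-comm b (s ℕ.* b))))
         (≡.sym (ℕₚ.+-assoc e (s ℕ.* b) b))))

module MainTheorem {c ℓ p : Level} (𝔽 : FiniteField c ℓ) (G : FiniteSubgroup (OverFiniteField.PGL₂ 𝔽) p) (cyclic : IsCyclic (OverFiniteField.PGL₂ 𝔽) G) (order-prime : Prime (FiniteSubgroup.order G)) (Q : OverFiniteField.QuotientMap 𝔽 G) where
  open FiniteField 𝔽
  open OverFiniteField 𝔽
  open PolynomialRing 𝔽
  open Euclid 𝔽
  open Homogeneous 𝔽
  open Action 𝔽
  open Iteration 𝔽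
  open FiniteSubgroup G using (Member; order; ε∈)
  open FromSubgroup 𝔽 G cyclic order-prime Q

  s-prime : Prime (suc (ℕ.pred order))
  s-prime = ≡.subst Prime order≡ order-prime

  open OrbitStructure 𝔽 𝒬
  open PrimeOrder s-prime
  open Ramification 𝔽 𝒬 s-prime
  open Norm 𝔽 𝒬 using (Good; _^Q[_])
  module Count = Counting 𝔽 𝒬 s-prime

  member-fixed : ∀ {n r A} → Below (suc n) r → Fixed n r → Member A → act n r A ≃ r
  member-fixed {n} {r} {A} b (k , nk , e) A∈ =
    let l , nl , eigen = member-eigen n nk A A∈ in l , nl , eigen r b e

  -- At a root A∞ the image under A would lose degree by `hom-linear-lead`, but every member maps r
  -- to a multiple of itself.
  fixed⇒no-root : ∀ {n r} → Monic n r → Fixed n r → NoRootInOrbit∞ G r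
  fixed⇒no-root {n} {r} M fixed A v A∈ (_ , vc≈a) z = lead≉0 (≃-deg (≃-sym (member-fixed (monic-below M) fixed A∈)) (monic⇒deg M))
    (trans (hom-linear-lead n r {GL₂.a A} {GL₂.b A} {GL₂.c′ A} {GL₂.d A} {v} (monic-below M) vc≈a)
           (trans (*-congˡ z) (zeroʳ _)))

  fixed⇒orbit-product : ∀ {n r} → Monic n r → Fixed n r → IsOrbitProduct G n r r
  fixed⇒orbit-product {n} {r} M fixed = r ∷ [] , All.[] AllPairs.∷ AllPairs.[] ,
    (λ t → mk⇔ (λ { (here t≈r) → I₂ , ε∈ , n , fromMonic (monic-cong (P.sym t≈r) M) , 1# , 1≉0 ,
                                   P.trans t≈r (P.trans (P.sym (act-I n r (monic-below M))) (P.sym (•-identity (act n r I₂)))) })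
               (λ { (A , A∈ , m , Mt , k , nk , e) → here (≃-monic (toMonic Mt) M (≃-trans (k , nk , e) (member-fixed (monic-below M) fixed A∈))) })) ,
    P.sym (*ₚ-identityʳ r)

  -- The orbit of a fixed r is r alone, so rˢ is the orbit product to the power `order`, which
  -- exceeds 1.
  totallyRamified⇒Ramified : ∀ {n F} → Monic n F → Irreducible F → TotallyRamified n F → Ramified Q n F
  totallyRamified⇒Ramified {n} {F} MF irF (r , Mr , irr , fixed , e) =
    (fromMonic MF , irF) , n , r , (fromMonic Mr , irr) , fixed⇒no-root Mr fixed , r , order , fixed⇒orbit-product Mr fixed ,
    ℕ.nonTrivial⇒n>1 order {{prime⇒nonTrivial order-prime}} , ≡.subst (λ k → F ^Q[ n ] ≈ₚ r ^ k) (≡.sym order≡) e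

  ramified-bound : ∀ {d n F} → IsRamifiedDegree Q d → Ramified Q n F → n ℕ.≤ d
  ramified-bound (largest _ max) ram = max ram
  ramified-bound (none nope)     ram = ⊥-elim (nope ram)

  module _ {d n : ℕ} (d-degree : IsRamifiedDegree Q d) (d<n : d ℕ.< n) where

    unramified : ∀ {F} → Monic n F → Irreducible F → ¬ TotallyRamified n F
    unramified MF irF ram = ℕₚ.<⇒≱ d<n (ramified-bound d-degree (totallyRamified⇒Ramified MF irF ram))

    -- A pole is linear, so only n = 1 is in question, and there only if σ moves ∞.
    all-good : ∀ {r} → Monic n r → Irreducible r → Good n r
    all-good M irr with 1 ℕₚ.<? n
    ... | yes 1<n = nonlinear⇒good irr (monic⇒deg M) 1<n
    ... | no ¬1<n with GL₂.c′ σ ≟ 0#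
    ...   | yes c≈0 = ∞-fixed⇒good c≈0 irr (monic⇒deg M)
    -- Some F of degree at least 1 ramifies totally, so d ≥ 1 and n > 1 after all.
    ...   | no c≉0 = ⊥-elim (contradiction (∞-moved⇒ramified c≉0))
      where
      contradiction : ¬ (∃₂ λ m F → Monic m F × Irreducible F × TotallyRamified m F)
      contradiction (m , F , MF , irF , ram) = ¬1<n (ℕₚ.≤-<-trans (ℕₚ.≤-trans (irr-deg>0 irF (monic⇒deg MF))
        (ramified-bound d-degree (totallyRamified⇒Ramified MF irF ram))) d<n)

    C-card : ∀ m {k} → Enumeration (Count.C m) k → HasCard (C Q m) k
    C-card m E = enumeration⇒card (subset-enumeration {S = 𝓘 m}
      (λ f → ≡.subst (λ k → MonicIrreducible (k ℕ.* m) (proj₁ f ^Q[ m ])) (≡.sym order≡))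
      (λ f → ≡.subst (λ k → MonicIrreducible (k ℕ.* m) (proj₁ f ^Q[ m ])) order≡) E)

    D-card : ∀ m {k} → Enumeration (Count.D m) k → HasCard (D Q m) k
    D-card m E = enumeration⇒card (subset-enumeration {S = 𝓘 m}
      (λ f → ≡.subst (λ k → ¬ MonicIrreducible (k ℕ.* m) (proj₁ f ^Q[ m ])) (≡.sym order≡))
      (λ f → ≡.subst (λ k → ¬ MonicIrreducible (k ℕ.* m) (proj₁ f ^Q[ m ])) order≡) E)

    conclusion : ∃₂ λ ∣C∣ ∣D∣ → HasCard (C Q n) ∣C∣ × HasCard (D Q n) ∣D∣ ×
      (¬ (order ℕ∣.∣ n) → + ∣C∣ ℤ.- (+ order ℤ.- ℤ.1ℤ) ℤ.* + ∣D∣ ≡ ℤ.0ℤ) ×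
      ((s∣n : order ℕ∣.∣ n) → ∃ λ ∣C[n/s]∣ → HasCard (C Q (ℕ∣.quotient s∣n)) ∣C[n/s]∣ ×
        + ∣C∣ ℤ.- (+ order ℤ.- ℤ.1ℤ) ℤ.* + ∣D∣ ≡ + ∣C[n/s]∣)
    conclusion =
      let a , b , EC , ED , undivided , divided = Count.count all-good unramified
          rescale : ∀ {e} → a ℕ.+ b ≡ e ℕ.+ b ℕ.* suc (ℕ.pred order) → + a ℤ.- (+ order ℤ.- ℤ.1ℤ) ℤ.* + b ≡ + e
          rescale {e} eq = difference order order≡ (≡.subst (λ k → a ℕ.+ b ≡ e ℕ.+ b ℕ.* k) (≡.sym order≡) eq)
      in a , b , C-card n EC , D-card n ED ,
         (λ s∤n → rescale (undivided (λ s∣n → s∤n (≡.subst (ℕ∣._∣ n) (≡.sym order≡) s∣n)))) ,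
         (λ s∣n → let m = ℕ∣.quotient s∣n
                      e , Em , eq = divided m (≡.trans (ℕ∣._∣_.equality s∣n) (≡.cong (m ℕ.*_) order≡))
                  in e , C-card m Em , rescale eq)

open import Data.Integer.Base using (_-_; _*_; 0ℤ; 1ℤ)
open import Data.Nat.Base using (_<_)
open import Data.Nat.Divisibility using (_∣_; _∤_; quotient)

theorem4 : {c ℓ p : Level} (𝔽 : FiniteField c ℓ) →
    let open OverFiniteField 𝔽 in
    (G : FiniteSubgroup PGL₂ p) → IsCyclic PGL₂ G →
    let s = FiniteSubgroup.order G in
    Prime s →
    (Q : QuotientMap G) →
    (d : ℕ) → IsRamifiedDegree Q d →
    (n : ℕ) → d < n →
    ∃₂ λ ∣C∣ ∣D∣ →
    HasCard (C Q n) ∣C∣ ×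
    HasCard (D Q n) ∣D∣ ×
    (s ∤ n → + ∣C∣ - (+ s - 1ℤ) * + ∣D∣ ≡ 0ℤ) ×
    ((s∣n : s ∣ n) →
    ∃ λ ∣C[n/s]∣ →
    HasCard (C Q (quotient s∣n)) ∣C[n/s]∣ ×
    + ∣C∣ - (+ s - 1ℤ) * + ∣D∣ ≡ + ∣C[n/s]∣)
theorem4 𝔽 G cyclic s-prime Q d d-degree n d<n = MainTheorem.conclusion 𝔽 G cyclic s-prime Q d-degree d<n
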